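{- Let $n$ be a positive integer and $\zeta_n$ a primitive $n$-th root of unity. For any nonnegative integer $l$, we have $$\overline{z}_n^t(\{1\}^l;\zeta_n)=\sum_{m=0}^l\frac{(-1)^m}{n^{m+1}}\sum_{\substack{i_0+\cdots+i_m=l\\ 0\leq i_0\leq n-1\\ 1\leq i_1,\ldots,i_m\leq n-1}}\prod_{a=0}^m\binom{n}{i_a+1}\,(1-t)^{i_0}(-t)^{l-i_0},$$ $$\overline{z}_n^t(\{2\}^l;\zeta_n)=\sum_{m=0}^l\frac{(-1)^m}{n^{m+1}}\sum_{\substack{i_0+\cdots+i_m=l\\ 0\leq i_0\leq n-1\\ 1\leq i_1,\ldots,i_m\leq n-1}}\prod_{a=0}^m\frac{1}{i_a+1}\binom{n+i_a}{2i_a+1}\,(t-1)^{i_0}t^{l-i_0},$$ $$\overline{z}_n^t(\{3\}^l;\zeta_n)=\sum_{m=0}^l\frac{(-1)^m}{n^{2m+2}}\sum_{\substack{i_0+\cdots+i_m=l\\ 0\leq i_0\leq n-1\\ 1\leq i_1,\ldots,i_m\leq n-1}}\prod_{a=0}^m\frac{1}{i_a+1}\left[\binom{n+i_a}{3i_a+2}+(-1)^{i_a}\binom{n+2i_a+1}{3i_a+2}\right](t-1)^{i_0}t^{l-i_0},$$ where in each formula the factors $(1-t)^{i_0}(-t)^{l-i_0}$, respectively $(t-1)^{i_0}t^{l-i_0}$, are outside the product over $a$.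
   Context: $\mathbb{N}$ is the set of positive integers and $t$ is a formal parameter. For a multi-index $\mathbf{k}=(k_1,\ldots,k_l)\in\mathbb{N}^l$ the depth is $\mathrm{dep}(\mathbf{k})=l$. The symbol $\{k\}^l$ denotes $k$ repeated $l$ times. Let $q$ be a complex number with $q^m\ne1$ for every positive integer $m<n$ (e.g. $q=\zeta_n$). For $\mathbf{k}\in\mathbb{N}^l$ with $l\ge 1$, $$\overline{z}_n(\mathbf{k};q)=\sum_{n>m_1>\cdots>m_l>0}\frac{q^{(k_1-1)m_1+\cdots+(k_l-1)m_l}}{(1-q^{m_1})^{k_1}\cdots(1-q^{m_l})^{k_l}},$$ and its interpolated version is $$\overline{z}_n^t(\mathbf{k};q)=\sum_{\mathbf{p}}\overline{z}_n(\mathbf{p};q)\,t^{l-\mathrm{dep}(\mathbf{p})},$$ where the sum runs over all $3^{l-1}$ ways of forming $\mathbf{p}=(k_1\Box\cdots\Box k_l)$ by filling each $\Box$ with "," (comma), "$+$" or "$-1+$". For the empty multi-index ($l=0$) the value is $1$. Binomial coefficients $\binom{N}{M}$ with $0\le N<M$ are $0$. -}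

module Defs where

open import Algebra.Apartness.Bundles using (HeytingField; HeytingCommutativeRing)
open import Algebra.Bundles using (CommutativeRing; Semiring)
import Algebra.Definitions.RawSemiring as RawSemiringDefs
open import Algebra.Properties.Monoid.Sum using (sum-syntax; sum⁺-syntax)
open import Data.Fin.Base using (toℕ)
open import Data.Fin.Properties using (toℕ<n)
open import Data.List.Base using
  (List; []; _∷_; _++_; map; foldr; length; upTo; filter; cartesianProduct; cartesianProductWith)
open import Data.Nat.Base using (ℕ; zero; suc; _+_; _*_; _∸_; _<_; NonZero; s≤s; z≤n)
open import Data.Nat.Properties using (_≟_; <-trans)
open import Data.Product.Base using (_×_; _,_; proj₁)
open import Data.Vec.Base using (Vec; []; _∷_)
import Data.Vec.Base as Vec
open import Level using (_⊔_)

-- A multi-index (k₁ , … , k_l) is the list of its entries; all the entries are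
-- meant to be positive, and `filled` then only produces positive entries.

-- The 3^(l-1) multi-indices k₁ □ k₂ □ ⋯ □ k_l, with multiplicity, for
-- (k₁ , … , k_l) = k ∷ ks: the first □ is "," or "+" or "-1+", and in the last
-- two cases the merged entry becomes the first one.
filled : ℕ → List ℕ → List (List ℕ)
filled k []        = (k ∷ []) ∷ []
filled k (k′ ∷ ks) =
  map (k ∷_) (filled k′ ks) ++ filled (k + k′) ks ++ filled (k + k′ ∸ 1) ks

fillings : List ℕ → List (List ℕ)
fillings []       = [] ∷ []
fillings (k ∷ ks) = filled k ks

vectors : ∀ {a} {X : Set a} → List X → (m : ℕ) → List (Vec X m)
vectors xs zero    = [] ∷ []
vectors xs (suc m) = cartesianProductWith _∷_ xs (vectors xs m)

-- The tuples (i₀ , (i₁ , … , i_m)) with i₀ + ⋯ + i_m = l, 0 ≤ i₀ ≤ n - 1 and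
-- 1 ≤ i₁ , … , i_m ≤ n - 1.
indices : (n l m : ℕ) → List (ℕ × Vec ℕ m)
indices n l m = filter (λ (i₀ , is) → i₀ + Vec.sum is ≟ l)
  (cartesianProduct (upTo n) (vectors (map suc (upTo (n ∸ 1))) m))

-- The Heyting field K plays the role of ℂ; its apartness _#_ is the
-- constructive form of ≠, and it is the one that yields inverses.
module FieldDefs {c ℓ₁ ℓ₂} (K : HeytingField c ℓ₁ ℓ₂) where
  open HeytingField K using (Carrier; _≈_; _#_; -_; 0#; 1#; #⇒invertible; #-sym; heytingCommutativeRing)
    renaming (_*_ to _*ᴷ_)

  ring : CommutativeRing c ℓ₁
  ring = HeytingCommutativeRing.commutativeRing heytingCommutativeRing

  open RawSemiringDefs (Semiring.rawSemiring (CommutativeRing.semiring ring))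
    using (_^_) renaming (_×_ to _·_) public

  ι : ℕ → Carrier
  ι k = k · 1#

  -1^_ : ℕ → Carrier
  -1^ k = (- 1#) ^ k

  CharZero : Set ℓ₂
  CharZero = ∀ k → .{{NonZero k}} → ι k # 0#

  -- 1 / (x - y)
  inverse : ∀ {x y} → x # y → Carrier
  inverse x#y = proj₁ (#⇒invertible x#y)

  -- 1 / k, obtained as 1 / (k - 0)
  1/ : CharZero → (k : ℕ) → .{{NonZero k}} → Carrier
  1/ char0 k = inverse (char0 k)

  PowersApartFrom1 : ℕ → Carrier → Set ℓ₂
  PowersApartFrom1 n q = ∀ {m} → 0 < m → m < n → q ^ m # 1#

  record IsPrimitiveRoot (n : ℕ) (ζ : Carrier) : Set (ℓ₁ ⊔ ℓ₂) where
    field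
      ζⁿ≈1  : ζ ^ n ≈ 1#
      apart : PowersApartFrom1 n ζ

  restrict : ∀ {m n q} → m < n → PowersApartFrom1 n q → PowersApartFrom1 m q
  restrict m<n h 0<j j<m = h 0<j (<-trans j<m m<n)

  -- The sum over n > m₁ > ⋯ > m_l > 0 is written as an iterated sum: for fixed
  -- m = m₁, the sum over m₂ , … , m_l is that of (k₂ , … , k_l) with bound m.
  z̄ : (n : ℕ) (q : Carrier) → PowersApartFrom1 n q → List ℕ → Carrier
  z̄ n       q h []       = 1#
  z̄ zero    q h (k ∷ ks) = 0#
  z̄ (suc N) q h (k ∷ ks) = sum-syntax (CommutativeRing.+-monoid ring) N λ i →
    let m   = suc (toℕ i)
        m<n = s≤s (toℕ<n i)
    in q ^ ((k ∸ 1) * m)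
       *ᴷ inverse (#-sym (h {m} (s≤s z≤n) m<n)) ^ k
       *ᴷ z̄ m q (restrict m<n h) ks

-- A commutative K-algebra A with structure map φ, in which the parameter t lives;
-- the formal parameter itself is the case A = K[t].
module AlgebraDefs {c ℓ₁ ℓ₂ a ℓ} (K : HeytingField c ℓ₁ ℓ₂) (A : CommutativeRing a ℓ)
                   (φ : HeytingField.Carrier K → CommutativeRing.Carrier A) where
  open FieldDefs K hiding (_^_; _·_)
  open HeytingField K using () renaming (Carrier to Kᶜ; _*_ to _*ᴷ_; 1# to 1ᴷ)
  open CommutativeRing A using (Carrier; 0#; +-monoid; semiring)
    renaming (_+_ to _+ᴬ_; _*_ to _*ᴬ_)
  open RawSemiringDefs (Semiring.rawSemiring semiring) using (_^_)
  private
    module F = FieldDefs K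

  sumList : ∀ {x} {X : Set x} → List X → (X → Carrier) → Carrier
  sumList xs f = foldr (λ x s → f x +ᴬ s) 0# xs

  z̄ᵗ : (n : ℕ) (q : Kᶜ) → PowersApartFrom1 n q → Carrier → List ℕ → Carrier
  z̄ᵗ n q h t ks = sumList (fillings ks) λ p →
    φ (z̄ n q h p) *ᴬ t ^ (length ks ∸ length p)

  -- ∑_{m=0}^{l} (-1)^m r^(e m) ∑_{i₀+⋯+i_m=l} (∏_{a=0}^{m} b i_a) u^i₀ v^(l-i₀)
  expansion : (n l : ℕ) (r : Kᶜ) (e : ℕ → ℕ) (b : ℕ → Kᶜ) (u v : Carrier) → Carrier
  expansion n l r e b u v = sum⁺-syntax +-monoid l λ j →
    let m = toℕ j in
    φ ((-1^ m) *ᴷ (r F.^ e m)) *ᴬ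
    sumList (indices n l m) λ (i₀ , is) →
      φ (b i₀ *ᴷ Vec.foldr′ (λ i x → b i *ᴷ x) 1ᴷ is) *ᴬ (u ^ i₀ *ᴬ v ^ (l ∸ i₀))

{-# OPTIONS --safe #-}
-- For fixed m the summands of z̄ satisfy f(k) f(k′) = f(k + k′) + f(k + k′ - 1),
-- hence, with a_m = ζ^((k-1)m) / (1 - ζ^m)^k,
--   ∑_l z̄ᵗ({k}^l) x^l = ∏_{m<n} (1 + (1 - t) a_m x) / (1 - t a_m x),
-- and the expansion is U ∑ (-1)^m (V - 1)^m for numerator U and denominator V.
-- It remains to find the coefficients of P(x) = ∏ (1 ± a_m x).  Multiplying the
-- m-th factor by (1 - ζ^m)^k turns it into ∏ (α - ζ^m) over the k roots α of
-- (1 - z)^k ± x z^(k-1).  As ∏_m (α - ζ^m) = (α^n - 1) / (α - 1), this makes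
-- n^k x P(x) a combination of n-th power sums of roots, and these satisfy the
-- same linear recurrence as polynomials in x with binomial coefficients.  The
-- roots need not lie in K, but for k ≤ 3 they are rational functions of a
-- parameter, so the identity holds at enough points x of K to determine P.
module Submission where

open import Algebra.Apartness.Bundles using (HeytingField)
open import Algebra.Bundles using (CommutativeRing)
open import Algebra.Morphism.Structures using (IsRingHomomorphism)
open import Algebra.Solver.Ring.AlmostCommutativeRing using (_-Raw-AlmostCommutative⟶_; fromCommutativeRing)
open import Data.Bool.Base using (true; false; if_then_else_)
open import Data.Fin.Base using (Fin; zero; suc; toℕ)
open import Data.Fin.Properties using (toℕ<n)
open import Data.Integer.Base as ℤ using (ℤ; +_; -[1+_]; _⊖_; _◃_)
import Data.Integer.Properties as ℤₚ
open import Data.List.Base using (List; []; _∷_; _++_; map; foldr; length; upTo; applyUpTo; filter; cartesianProduct; cartesianProductWith; replicate)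
open import Data.List.Relation.Unary.All as All using (All; []; _∷_)
import Data.List.Relation.Unary.All.Properties as Allₚ
open import Data.Maybe.Base using (Maybe; just; nothing)
open import Data.Nat.Base as ℕ using (ℕ; zero; suc; _∸_)
open import Data.Nat.Combinatorics using (_C_; nCk+nC[k+1]≡[n+1]C[k+1]; nC1≡n; k>n⇒nCk≡0)
open import Data.Nat.Properties as ℕₚ using (_≟_)
open import Data.Nat.Solver using (module +-*-Solver)
open import Data.Product.Base using (_×_; _,_; proj₁; proj₂)
open import Data.Sign.Base as Sign using (Sign)
open import Data.Vec.Base as Vec using (Vec; []; _∷_)
open import Level using (_⊔_)
open import Relation.Binary.PropositionalEquality as ≡ using (_≡_)
import Relation.Binary.Reasoning.Setoid as ≈-Reasoning
open import Relation.Nullary.Decidable.Core using (yes; no; does)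
open import Relation.Nullary.Negation.Core using (contradiction)
open import Relation.Unary using (Decidable)
open import Defs

-- The factor x in n^k x P(x) is, up to sign, the value at z = 1 of the polynomial with roots α:
-- each ∏ (α - ζ^m) needs a factor α - 1, and these multiply to ± x. For k = 2, αβ = 1 collapses -
-- (α^n - 1)(β^n - 1) to α^n + β^n - 2. For k = 3 the product leaves e₂ - e₁ of the n-th powers;
-- since αβγ = 1, the pairwise products are the reciprocals of the roots. So two cubics occur, one
-- power sum being taken at - x, which is the source of the two binomials and of the sign (-1)^i.
-- For k = 2 and 3 each power sum first gives two neighbouring binomials. Absorption turns i + 1
-- times their combination into n times one binomial: hence 1/(i + 1), and one power of 1/n less.
-- The parametrisation for k = 3 comes from the reciprocals a, b, c of the roots: a + b + c = 3 and
-- abc = 1 is a plane cubic with singular point a = b = c = 1, and the line (b - 1) = s (a - 1)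
-- through it meets the curve in one further point. Equality in K need not be decidable, so root
-- counting rests on cancelling non-zero-divisors.

open +-*-Solver using () renaming (solve to solveℕ; _:+_ to _⊕_; _:*_ to _⊗_; _:=_ to _⊜_; con to numeral)

-- Ring solver with integer coefficients over an arbitrary commutative ring.

module IntegerCoefficientSolver {c ℓ} (R : CommutativeRing c ℓ) where
  open CommutativeRing R
  open import Algebra.Properties.Ring ring using (-0#≈0#; -‿distribˡ-*; -‿distribʳ-*; -‿involutive)
  open import Algebra.Properties.AbelianGroup +-abelianGroup using (⁻¹-∙-comm)
  -- With the optimised multiple, `1 · 1#` reduces to `1#`, so the literals 0 and 1 of the solver
  -- evaluate definitionally to the constants of the ring.
  open import Algebra.Properties.Semiring.Mult.TCOptimised semiring using (1+×; ×-homo-+; ×1-homo-*) renaming (_×_ to _·_)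
  open ≈-Reasoning setoid

  private
    fromℤ : ℤ → Carrier
    fromℤ (+ n)      = n · 1#
    fromℤ -[1+ n ]   = - (suc n · 1#)

    signed : Sign → Carrier → Carrier
    signed Sign.+ x = x
    signed Sign.- x = - x

    signed-* : ∀ s t x y → signed (s Sign.* t) (x * y) ≈ signed s x * signed t y
    signed-* Sign.+ Sign.+ x y = refl
    signed-* Sign.+ Sign.- x y = -‿distribʳ-* x y
    signed-* Sign.- Sign.+ x y = -‿distribˡ-* x y
    signed-* Sign.- Sign.- x y = begin
      x * y           ≈⟨ -‿involutive (x * y) ⟨
      - (- (x * y))   ≈⟨ -‿cong (-‿distribʳ-* x y) ⟩
      - (x * - y)     ≈⟨ -‿distribˡ-* x (- y) ⟩
      - x * - y       ∎

    fromℤ-◃ : ∀ s n → fromℤ (s ◃ n) ≈ signed s (n · 1#)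
    fromℤ-◃ Sign.+ zero    = refl
    fromℤ-◃ Sign.- zero    = sym -0#≈0#
    fromℤ-◃ Sign.+ (suc n) = refl
    fromℤ-◃ Sign.- (suc n) = refl

    signed-∣∣ : ∀ i → signed (ℤ.sign i) (ℤ.∣ i ∣ · 1#) ≈ fromℤ i
    signed-∣∣ (+ n)    = refl
    signed-∣∣ -[1+ n ] = refl

    fromℤ-* : ∀ i j → fromℤ (i ℤ.* j) ≈ fromℤ i * fromℤ j
    fromℤ-* i j = begin
      fromℤ (i ℤ.* j)
        ≈⟨ fromℤ-◃ (ℤ.sign i Sign.* ℤ.sign j) (ℤ.∣ i ∣ ℕ.* ℤ.∣ j ∣) ⟩
      signed (ℤ.sign i Sign.* ℤ.sign j) ((ℤ.∣ i ∣ ℕ.* ℤ.∣ j ∣) · 1#)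
        ≈⟨ signed-cong (ℤ.sign i Sign.* ℤ.sign j) (×1-homo-* ℤ.∣ i ∣ ℤ.∣ j ∣) ⟩
      signed (ℤ.sign i Sign.* ℤ.sign j) (ℤ.∣ i ∣ · 1# * (ℤ.∣ j ∣ · 1#))
        ≈⟨ signed-* (ℤ.sign i) (ℤ.sign j) _ _ ⟩
      signed (ℤ.sign i) (ℤ.∣ i ∣ · 1#) * signed (ℤ.sign j) (ℤ.∣ j ∣ · 1#)
        ≈⟨ *-cong (signed-∣∣ i) (signed-∣∣ j) ⟩
      fromℤ i * fromℤ j ∎
      where
      signed-cong : ∀ s {x y} → x ≈ y → signed s x ≈ signed s y
      signed-cong Sign.+ eq = eq
      signed-cong Sign.- eq = -‿cong eq

    fromℤ-⊖ : ∀ m n → fromℤ (m ⊖ n) ≈ m · 1# - n · 1#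
    fromℤ-⊖ m       zero    = sym (trans (+-congˡ -0#≈0#) (+-identityʳ _))
    fromℤ-⊖ zero    (suc n) = sym (+-identityˡ _)
    fromℤ-⊖ (suc m) (suc n) = begin
      fromℤ (suc m ⊖ suc n)              ≡⟨ ≡.cong fromℤ (ℤₚ.[1+m]⊖[1+n]≡m⊖n m n) ⟩
      fromℤ (m ⊖ n)                      ≈⟨ fromℤ-⊖ m n ⟩
      M - N                              ≈⟨ +-identityˡ _ ⟨
      0# + (M - N)                       ≈⟨ +-congʳ (-‿inverseʳ 1#) ⟨
      1# - 1# + (M - N)                  ≈⟨ interchange 1# (- 1#) M (- N) ⟩
      (1# + M) + (- 1# - N)              ≈⟨ +-congˡ (⁻¹-∙-comm 1# N) ⟩
      (1# + M) - (1# + N)                ≈⟨ +-cong (1+× m 1#) (-‿cong (1+× n 1#)) ⟨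
      suc m · 1# - suc n · 1#            ∎
      where
      open import Algebra.Properties.CommutativeSemigroup +-commutativeSemigroup using (interchange)
      M = m · 1#
      N = n · 1#

    fromℤ-+ : ∀ i j → fromℤ (i ℤ.+ j) ≈ fromℤ i + fromℤ j
    fromℤ-+ (+ m)    (+ n)    = ×-homo-+ 1# m n
    fromℤ-+ (+ m)    -[1+ n ] = fromℤ-⊖ m (suc n)
    fromℤ-+ -[1+ m ] (+ n)    = trans (fromℤ-⊖ n (suc m)) (+-comm _ _)
    fromℤ-+ -[1+ m ] -[1+ n ] = begin
      - (suc (suc (m ℕ.+ n)) · 1#)         ≡⟨ ≡.cong (λ k → - (suc k · 1#)) (ℕₚ.+-suc m n) ⟨
      - ((suc m ℕ.+ suc n) · 1#)           ≈⟨ -‿cong (×-homo-+ 1# (suc m) (suc n)) ⟩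
      - (suc m · 1# + suc n · 1#)          ≈⟨ ⁻¹-∙-comm _ _ ⟨
      - (suc m · 1#) - suc n · 1#          ∎

    fromℤ-neg : ∀ i → fromℤ (ℤ.- i) ≈ - fromℤ i
    fromℤ-neg (+ zero)  = sym -0#≈0#
    fromℤ-neg (+ suc n) = refl
    fromℤ-neg -[1+ n ]  = sym (-‿involutive _)

    homomorphism : ℤ.+-*-rawRing -Raw-AlmostCommutative⟶ fromCommutativeRing R
    homomorphism = record
      { ⟦_⟧    = fromℤ
      ; +-homo = fromℤ-+
      ; *-homo = fromℤ-*
      ; -‿homo = fromℤ-neg
      ; 0-homo = refl
      ; 1-homo = refl
      }

    -- Normal forms are compared through their integer coefficients, so no decision procedure for
    -- equality in `R` is required.
    fromℤ-≟ : ∀ i j → Maybe (fromℤ i ≈ fromℤ j)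
    fromℤ-≟ i j with i ℤₚ.≟ j
    ... | yes ≡.refl = just refl
    ... | no _       = nothing

  open import Algebra.Solver.Ring ℤ.+-*-rawRing (fromCommutativeRing R) homomorphism fromℤ-≟ public
    using (solve; _:=_; _:+_; _:*_; _:-_; :-_; con) renaming (Polynomial to SolverPolynomial)

-- Formal power series as coefficient sequences.

module PowerSeries {c ℓ} (R : CommutativeRing c ℓ) where
  open CommutativeRing R hiding (zero)
  open import Algebra.Properties.Monoid.Sum +-monoid using (sum; sum⁺-syntax; sum-cong-≋)
  open import Algebra.Properties.Semiring.Exp semiring using (_^_)
  open import Algebra.Properties.Semiring.Sum semiring using (*-distribˡ-sum)
  open IntegerCoefficientSolver R
  open ≈-Reasoning setoid

  Series : Set c
  Series = ℕ → Carrier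

  infix 4 _≋_
  _≋_ : Series → Series → Set ℓ
  f ≋ g = ∀ i → f i ≈ g i

  δ : Series
  δ zero    = 1#
  δ (suc _) = 0#

  shift : Series → Series
  shift f zero    = 0#
  shift f (suc i) = f i

  tail : Series → Series
  tail f i = f (suc i)

  dropConstant : Series → Series
  dropConstant f = shift (tail f)

  -- f stands for ∑ f i x^i, so that linear c f is (1 + c x) f and rescale u f is f (u x).
  linear : Carrier → Series → Series
  linear c f i = f i + c * shift f i

  rescale : Carrier → Series → Series
  rescale u f i = f i * u ^ i

  infixl 7 _⊛_
  _⊛_ : Series → Series → Series
  (f ⊛ g) zero    = f 0 * g 0
  (f ⊛ g) (suc l) = f 0 * g (suc l) + (tail f ⊛ g) l

  infixr 8 _⊛^_
  _⊛^_ : Series → ℕ → Series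
  f ⊛^ zero  = δ
  f ⊛^ suc m = f ⊛ f ⊛^ m

  shift-cong : ∀ {f g} → f ≋ g → shift f ≋ shift g
  shift-cong eq zero    = refl
  shift-cong eq (suc i) = eq i

  linear-cong : ∀ {c d f g} → c ≈ d → f ≋ g → linear c f ≋ linear d g
  linear-cong c≈d f≋g i = +-cong (f≋g i) (*-cong c≈d (shift-cong f≋g i))

  -- Coefficient `l` sees the right factor only up to degree `l`. This makes the degree-by-degree
  -- argument of `quotient-expansion` possible.
  ⊛-congˡ-≤ : ∀ f {g h} l → (∀ i → i ℕ.≤ l → g i ≈ h i) → (f ⊛ g) l ≈ (f ⊛ h) l
  ⊛-congˡ-≤ f zero    eq = *-congˡ (eq 0 ℕ.z≤n)
  ⊛-congˡ-≤ f (suc l) eq =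
    +-cong (*-congˡ (eq (suc l) ℕₚ.≤-refl)) (⊛-congˡ-≤ (tail f) l λ i i≤l → eq i (ℕₚ.m≤n⇒m≤1+n i≤l))

  ⊛-congʳ : ∀ {f g} h → f ≋ g → f ⊛ h ≋ g ⊛ h
  ⊛-congʳ h eq zero    = *-congʳ (eq 0)
  ⊛-congʳ h eq (suc l) = +-cong (*-congʳ (eq 0)) (⊛-congʳ h (λ i → eq (suc i)) l)

  ⊛-congˡ : ∀ f {g h} → g ≋ h → f ⊛ g ≋ f ⊛ h
  ⊛-congˡ f eq l = ⊛-congˡ-≤ f l λ i _ → eq i

  ⊛-linearˡ : ∀ a f g h → (λ i → f i + a * g i) ⊛ h ≋ λ i → (f ⊛ h) i + a * (g ⊛ h) i
  ⊛-linearˡ a f g h zero = solve 4 (λ a x y z → (x :+ a :* y) :* z := x :* z :+ a :* (y :* z)) refl a (f 0) (g 0) (h 0)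
  ⊛-linearˡ a f g h (suc l) = begin
    (f 0 + a * g 0) * h (suc l) + ((λ i → tail f i + a * tail g i) ⊛ h) l
      ≈⟨ +-congˡ (⊛-linearˡ a (tail f) (tail g) h l) ⟩
    (f 0 + a * g 0) * h (suc l) + ((tail f ⊛ h) l + a * (tail g ⊛ h) l)
      ≈⟨ solve 6 (λ a x y z s t → (x :+ a :* y) :* z :+ (s :+ a :* t) := (x :* z :+ s) :+ a :* (y :* z :+ t))
           refl a (f 0) (g 0) (h (suc l)) ((tail f ⊛ h) l) ((tail g ⊛ h) l) ⟩
    (f ⊛ h) (suc l) + a * (g ⊛ h) (suc l) ∎

  ⊛-linearʳ : ∀ a f g h → f ⊛ (λ i → g i + a * h i) ≋ λ i → (f ⊛ g) i + a * (f ⊛ h) i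
  ⊛-linearʳ a f g h zero = solve 4 (λ a x y z → x :* (y :+ a :* z) := x :* y :+ a :* (x :* z)) refl a (f 0) (g 0) (h 0)
  ⊛-linearʳ a f g h (suc l) = begin
    f 0 * (g (suc l) + a * h (suc l)) + (tail f ⊛ (λ i → g i + a * h i)) l
      ≈⟨ +-congˡ (⊛-linearʳ a (tail f) g h l) ⟩
    f 0 * (g (suc l) + a * h (suc l)) + ((tail f ⊛ g) l + a * (tail f ⊛ h) l)
      ≈⟨ solve 6 (λ a x y z s t → x :* (y :+ a :* z) :+ (s :+ a :* t) := (x :* y :+ s) :+ a :* (x :* z :+ t))
           refl a (f 0) (g (suc l)) (h (suc l)) ((tail f ⊛ g) l) ((tail f ⊛ h) l) ⟩
    (f ⊛ g) (suc l) + a * (f ⊛ h) (suc l) ∎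

  ⊛-zeroʳ : ∀ f {g} → (∀ i → g i ≈ 0#) → ∀ l → (f ⊛ g) l ≈ 0#
  ⊛-zeroʳ f eq zero    = trans (*-congˡ (eq 0)) (zeroʳ _)
  ⊛-zeroʳ f eq (suc l) = trans (+-cong (trans (*-congˡ (eq (suc l))) (zeroʳ _)) (⊛-zeroʳ (tail f) eq l)) (+-identityʳ 0#)

  ⊛-zeroˡ : ∀ {f} g → (∀ i → f i ≈ 0#) → ∀ l → (f ⊛ g) l ≈ 0#
  ⊛-zeroˡ g eq zero    = trans (*-congʳ (eq 0)) (zeroˡ _)
  ⊛-zeroˡ g eq (suc l) = trans (+-cong (trans (*-congʳ (eq 0)) (zeroˡ _)) (⊛-zeroˡ g (λ i → eq (suc i)) l)) (+-identityʳ 0#)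

  ⊛-shiftˡ : ∀ f g → shift f ⊛ g ≋ shift (f ⊛ g)
  ⊛-shiftˡ f g zero    = zeroˡ (g 0)
  ⊛-shiftˡ f g (suc l) = trans (+-congʳ (zeroˡ (g (suc l)))) (+-identityˡ _)

  ⊛-shiftʳ : ∀ f g → f ⊛ shift g ≋ shift (f ⊛ g)
  ⊛-shiftʳ f g zero          = zeroʳ (f 0)
  ⊛-shiftʳ f g (suc zero)    = trans (+-congˡ (zeroʳ (f 1))) (+-identityʳ _)
  ⊛-shiftʳ f g (suc (suc l)) = +-congˡ (⊛-shiftʳ (tail f) g (suc l))

  ⊛-identityˡ : ∀ f → δ ⊛ f ≋ f
  ⊛-identityˡ f zero    = *-identityˡ (f 0)
  ⊛-identityˡ f (suc l) = trans (+-cong (*-identityˡ _) (⊛-zeroˡ f (λ _ → refl) l)) (+-identityʳ _)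

  ⊛-identityʳ : ∀ f → f ⊛ δ ≋ f
  ⊛-identityʳ f zero    = *-identityʳ (f 0)
  ⊛-identityʳ f (suc l) = trans (+-cong (zeroʳ (f 0)) (⊛-identityʳ (tail f) l)) (+-identityˡ _)

  linear-⊛ˡ : ∀ a f g → linear a f ⊛ g ≋ linear a (f ⊛ g)
  linear-⊛ˡ a f g l = trans (⊛-linearˡ a f (shift f) g l) (+-congˡ (*-congˡ (⊛-shiftˡ f g l)))

  linear-⊛ʳ : ∀ a f g → f ⊛ linear a g ≋ linear a (f ⊛ g)
  linear-⊛ʳ a f g l = trans (⊛-linearʳ a f g (shift g) l) (+-congˡ (*-congˡ (⊛-shiftʳ f g l)))

  -- Stands in for associativity and commutativity together. Writing f as `f 0` plus x times
  -- `tail f`, linearity in the right factor of `g ⊛_` reduces the claim to `tail f`.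
  ⊛-swap : ∀ f g h → f ⊛ (g ⊛ h) ≋ g ⊛ (f ⊛ h)
  ⊛-swap f g h zero = solve 3 (λ x y z → x :* (y :* z) := y :* (x :* z)) refl (f 0) (g 0) (h 0)
  ⊛-swap f g h (suc l) = begin
    f 0 * (g ⊛ h) (suc l) + (tail f ⊛ (g ⊛ h)) l
      ≈⟨ +-congˡ (⊛-swap (tail f) g h l) ⟩
    f 0 * (g ⊛ h) (suc l) + (g ⊛ (tail f ⊛ h)) l
      ≈⟨ +-comm _ _ ⟩
    (g ⊛ (tail f ⊛ h)) l + f 0 * (g ⊛ h) (suc l)
      ≈⟨ +-congʳ (⊛-shiftʳ g (tail f ⊛ h) (suc l)) ⟨
    (g ⊛ shift (tail f ⊛ h)) (suc l) + f 0 * (g ⊛ h) (suc l)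
      ≈⟨ ⊛-linearʳ (f 0) g (shift (tail f ⊛ h)) h (suc l) ⟨
    (g ⊛ (λ i → shift (tail f ⊛ h) i + f 0 * h i)) (suc l)
      ≈⟨ ⊛-congˡ g (unfold h) (suc l) ⟩
    (g ⊛ (f ⊛ h)) (suc l) ∎
    where
    unfold : ∀ h i → shift (tail f ⊛ h) i + f 0 * h i ≈ (f ⊛ h) i
    unfold h zero    = +-identityˡ _
    unfold h (suc i) = +-comm _ _

  rescale-linear : ∀ u a f → rescale u (linear a f) ≋ linear (a * u) (rescale u f)
  rescale-linear u a f zero =
    solve 3 (λ u a x → (x :+ a :* con (+ 0)) :* con (+ 1) := x :* con (+ 1) :+ a :* u :* con (+ 0)) refl u a (f 0)
  rescale-linear u a f (suc i) =
    solve 5 (λ u a x y w → (x :+ a :* y) :* (u :* w) := x :* (u :* w) :+ a :* u :* (y :* w)) refl u a (f (suc i)) (f i) (u ^ i)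

  ⊛-distrib-sum : ∀ f {M} (g : Fin M → Series) l →
                  (f ⊛ (λ i → sum (λ j → g j i))) l ≈ sum (λ j → (f ⊛ g j) l)
  ⊛-distrib-sum f {zero}  g l = ⊛-zeroʳ f (λ _ → refl) l
  ⊛-distrib-sum f {suc M} g l = begin
    (f ⊛ (λ i → g zero i + rest i)) l              ≈⟨ ⊛-congˡ f (λ i → +-congˡ (sym (*-identityˡ _))) l ⟩
    (f ⊛ (λ i → g zero i + 1# * rest i)) l         ≈⟨ ⊛-linearʳ 1# f (g zero) rest l ⟩
    (f ⊛ g zero) l + 1# * (f ⊛ rest) l             ≈⟨ +-congˡ (*-identityˡ _) ⟩
    (f ⊛ g zero) l + (f ⊛ rest) l                  ≈⟨ +-congˡ (⊛-distrib-sum f (λ j → g (suc j)) l) ⟩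
    (f ⊛ g zero) l + sum (λ j → (f ⊛ g (suc j)) l) ∎
    where
    rest : Series
    rest i = sum (λ j → g (suc j) i)

  -- U / V = ∑ (-1)^m U (V - 1)^m, where the m-th summand starts in degree m.
  quotient-expansion : ∀ U V Z → V 0 ≈ 1# → V ⊛ Z ≋ U →
    ∀ l → Z l ≈ sum⁺-syntax l λ j → (- 1#) ^ toℕ j * (U ⊛ dropConstant V ⊛^ toℕ j) l
  quotient-expansion U V Z V₀≈1 VZ≋U l = Z≈partial l l ℕₚ.≤-refl
    where
    Q : Series
    Q = dropConstant V

    term : ℕ → Series
    term m i = (- 1#) ^ m * (U ⊛ Q ⊛^ m) i

    partialSum : ℕ → Series
    partialSum M i = sum {suc M} λ j → term (toℕ j) i

    -- With V = 1 + Q the equation V Z = U becomes Z = U - Q Z; the partial sums are the iterates of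
    -- S ↦ U - Q S.
    Z-fixed : ∀ i → Z i ≈ U i - (Q ⊛ Z) i
    Z-fixed i = begin
      Z i                                   ≈⟨ solve 2 (λ z q → z := (z :+ con (+ 1) :* q) :- q) refl (Z i) ((Q ⊛ Z) i) ⟩
      (Z i + 1# * (Q ⊛ Z) i) - (Q ⊛ Z) i    ≈⟨ +-congʳ (+-congʳ (⊛-identityˡ Z i)) ⟨
      ((δ ⊛ Z) i + 1# * (Q ⊛ Z) i) - (Q ⊛ Z) i ≈⟨ +-congʳ (⊛-linearˡ 1# δ Q Z i) ⟨
      ((λ j → δ j + 1# * Q j) ⊛ Z) i - (Q ⊛ Z) i ≈⟨ +-congʳ (⊛-congʳ Z split i) ⟩
      (V ⊛ Z) i - (Q ⊛ Z) i                 ≈⟨ +-congʳ (VZ≋U i) ⟩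
      U i - (Q ⊛ Z) i ∎
      where
      split : ∀ j → δ j + 1# * Q j ≈ V j
      split zero    = trans (trans (+-congˡ (zeroʳ 1#)) (+-identityʳ 1#)) (sym V₀≈1)
      split (suc j) = trans (+-identityˡ _) (*-identityˡ _)

    partialSum-suc : ∀ M i → partialSum (suc M) i ≈ U i - (Q ⊛ partialSum M) i
    partialSum-suc M i = begin
      term 0 i + sum {suc M} (λ j → term (suc (toℕ j)) i)
        ≈⟨ +-cong (trans (*-identityˡ _) (⊛-identityʳ U i)) (sum-cong-≋ {suc M} λ j → next (toℕ j)) ⟩
      U i + sum {suc M} (λ j → - 1# * (Q ⊛ term (toℕ j)) i)
        ≈⟨ +-congˡ (*-distribˡ-sum {suc M} (- 1#) (λ j → (Q ⊛ term (toℕ j)) i)) ⟨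
      U i + - 1# * sum {suc M} (λ j → (Q ⊛ term (toℕ j)) i)
        ≈⟨ +-congˡ (*-congˡ (⊛-distrib-sum Q {suc M} (λ j → term (toℕ j)) i)) ⟨
      U i + - 1# * (Q ⊛ partialSum M) i
        ≈⟨ solve 2 (λ x y → x :+ (:- con (+ 1)) :* y := x :- y) refl _ _ ⟩
      U i - (Q ⊛ partialSum M) i ∎
      where
      next : ∀ m → term (suc m) i ≈ - 1# * (Q ⊛ term m) i
      next m = begin
        (- 1# * (- 1#) ^ m) * (U ⊛ (Q ⊛ Q ⊛^ m)) i  ≈⟨ *-congˡ (⊛-swap U Q (Q ⊛^ m) i) ⟩
        (- 1# * (- 1#) ^ m) * (Q ⊛ (U ⊛ Q ⊛^ m)) i  ≈⟨ *-assoc _ _ _ ⟩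
        - 1# * ((- 1#) ^ m * (Q ⊛ (U ⊛ Q ⊛^ m)) i)  ≈⟨ *-congˡ (+-identityˡ _) ⟨
        - 1# * (0# + (- 1#) ^ m * (Q ⊛ (U ⊛ Q ⊛^ m)) i)
          ≈⟨ *-congˡ (+-congʳ (⊛-zeroʳ Q (λ _ → refl) i)) ⟨
        - 1# * ((Q ⊛ (λ _ → 0#)) i + (- 1#) ^ m * (Q ⊛ (U ⊛ Q ⊛^ m)) i)
          ≈⟨ *-congˡ (⊛-linearʳ ((- 1#) ^ m) Q (λ _ → 0#) (U ⊛ Q ⊛^ m) i) ⟨
        - 1# * (Q ⊛ (λ j → 0# + term m j)) i
          ≈⟨ *-congˡ (⊛-congˡ Q (λ j → +-identityˡ _) i) ⟩
        - 1# * (Q ⊛ term m) i ∎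

    -- `Q` has no constant term, so each application of S ↦ U - Q S extends the agreement with `Z`
    -- by one degree.
    Z≈partial : ∀ M i → i ℕ.≤ M → Z i ≈ partialSum M i
    Z≈partial zero zero _ = begin
      Z 0                   ≈⟨ Z-fixed 0 ⟩
      U 0 - 0# * Z 0        ≈⟨ solve 2 (λ u z → u :- con (+ 0) :* z := con (+ 1) :* (u :* con (+ 1)) :+ con (+ 0)) refl (U 0) (Z 0) ⟩
      partialSum 0 0        ∎
    Z≈partial (suc M) i i≤1+M = begin
      Z i                        ≈⟨ Z-fixed i ⟩
      U i - (Q ⊛ Z) i            ≈⟨ +-congˡ (-‿cong (Q⊛Z≈ i i≤1+M)) ⟩
      U i - (Q ⊛ partialSum M) i ≈⟨ partialSum-suc M i ⟨
      partialSum (suc M) i       ∎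
      where
      Q⊛Z≈ : ∀ i → i ℕ.≤ suc M → (Q ⊛ Z) i ≈ (Q ⊛ partialSum M) i
      Q⊛Z≈ zero    _           = trans (zeroˡ _) (sym (zeroˡ _))
      Q⊛Z≈ (suc i) (ℕ.s≤s i≤M) = +-cong (trans (zeroˡ _) (sym (zeroˡ _)))
        (⊛-congˡ-≤ (tail Q) i λ j j≤i → Z≈partial M j (ℕₚ.≤-trans j≤i i≤M))

-- Sums over lists and over index tuples.

module ListSum {c ℓ} (R : CommutativeRing c ℓ) where
  open CommutativeRing R hiding (zero)
  open PowerSeries R
  open IntegerCoefficientSolver R
  open ≈-Reasoning setoid

  module _ {x} {X : Set x} where
    sumOver : List X → (X → Carrier) → Carrier
    sumOver xs f = foldr (λ x s → f x + s) 0# xs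

    sumOver-cong-All : ∀ {p} {P : X → Set p} {f g : X → Carrier} {xs} →
                       All P xs → (∀ {x} → P x → f x ≈ g x) → sumOver xs f ≈ sumOver xs g
    sumOver-cong-All []         eq = refl
    sumOver-cong-All (px ∷ pxs) eq = +-cong (eq px) (sumOver-cong-All pxs eq)

    sumOver-cong : ∀ xs {f g : X → Carrier} → (∀ x → f x ≈ g x) → sumOver xs f ≈ sumOver xs g
    sumOver-cong []       eq = refl
    sumOver-cong (x ∷ xs) eq = +-cong (eq x) (sumOver-cong xs eq)

    sumOver-zero : ∀ xs → sumOver xs (λ _ → 0#) ≈ 0#
    sumOver-zero []       = refl
    sumOver-zero (_ ∷ xs) = trans (+-identityˡ _) (sumOver-zero xs)

    sumOver-++ : ∀ xs ys (f : X → Carrier) → sumOver (xs ++ ys) f ≈ sumOver xs f + sumOver ys f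
    sumOver-++ []       ys f = sym (+-identityˡ _)
    sumOver-++ (x ∷ xs) ys f = trans (+-congˡ (sumOver-++ xs ys f)) (sym (+-assoc _ _ _))

    sumOver-+ : ∀ xs (f g : X → Carrier) → sumOver xs (λ x → f x + g x) ≈ sumOver xs f + sumOver xs g
    sumOver-+ []       f g = sym (+-identityˡ 0#)
    sumOver-+ (x ∷ xs) f g = trans (+-congˡ (sumOver-+ xs f g))
      (solve 4 (λ a b c d → (a :+ b) :+ (c :+ d) := (a :+ c) :+ (b :+ d)) refl (f x) (g x) (sumOver xs f) (sumOver xs g))

    *-distribˡ-sumOver : ∀ a xs (f : X → Carrier) → a * sumOver xs f ≈ sumOver xs (λ x → a * f x)
    *-distribˡ-sumOver a []       f = zeroʳ a
    *-distribˡ-sumOver a (x ∷ xs) f = trans (distribˡ a _ _) (+-congˡ (*-distribˡ-sumOver a xs f))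

    sumOver-filter : ∀ {p} {P : X → Set p} (P? : Decidable P) xs (f : X → Carrier) →
                     sumOver (filter P? xs) f ≈ sumOver xs (λ x → if does (P? x) then f x else 0#)
    sumOver-filter P? []       f = refl
    sumOver-filter P? (x ∷ xs) f with does (P? x)
    ... | true  = +-congˡ (sumOver-filter P? xs f)
    ... | false = trans (sumOver-filter P? xs f) (sym (+-identityˡ _))

  module _ {x y} {X : Set x} {Y : Set y} where
    sumOver-map : ∀ (h : X → Y) xs (f : Y → Carrier) → sumOver (map h xs) f ≈ sumOver xs (λ x → f (h x))
    sumOver-map h []       f = refl
    sumOver-map h (x ∷ xs) f = +-congˡ (sumOver-map h xs f)

  module _ {x y z} {X : Set x} {Y : Set y} {Z : Set z} where
    sumOver-cartesianProductWith : ∀ (h : X → Y → Z) xs ys (f : Z → Carrier) →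
      sumOver (cartesianProductWith h xs ys) f ≈ sumOver xs (λ x → sumOver ys (λ y → f (h x y)))
    sumOver-cartesianProductWith h []       ys f = refl
    sumOver-cartesianProductWith h (x ∷ xs) ys f = trans
      (sumOver-++ (map (h x) ys) (cartesianProductWith h xs ys) f)
      (+-cong (sumOver-map (h x) ys f) (sumOver-cartesianProductWith h xs ys f))

  *-if : ∀ b a x → (if b then a * x else 0#) ≈ a * (if b then x else 0#)
  *-if true  a x = refl
  *-if false a x = sym (zeroʳ a)

  shift^ : ℕ → Series → Series
  shift^ zero    X = X
  shift^ (suc i) X = shift (shift^ i X)

  -- A convolution is the sum of the shifts of `X` weighted by the coefficients of `F`. The function
  -- `h` is general because the tail of `applyUpTo h` is `applyUpTo` of `h` after the successor, so
  -- the case `upTo` alone would not pass through the induction.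
  sumOver-shift^ : ∀ (h : ℕ → ℕ) n F X l (Ψ : ℕ → Carrier) → (∀ i → n ℕ.≤ i → F i ≈ 0#) →
    (∀ i → Ψ (h i) ≈ F i * shift^ i X l) → sumOver (applyUpTo h n) Ψ ≈ (F ⊛ X) l
  sumOver-shift^ h zero F X l Ψ F≈0 eq = sym (⊛-zeroˡ X (λ i → F≈0 i ℕ.z≤n) l)
  -- In degree 0 every proper shift vanishes; the remaining terms are disposed of by the same
  -- statement for the zero series.
  sumOver-shift^ h (suc n) F X zero Ψ F≈0 eq = trans
    (+-cong (eq 0) (trans (sumOver-shift^ (λ i → h (suc i)) n (λ _ → 0#) (λ _ → 0#) 0 Ψ (λ _ _ → refl)
      λ i → trans (eq (suc i)) (trans (zeroʳ _) (sym (zeroˡ _)))) (zeroˡ 0#)))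
    (+-identityʳ _)
  sumOver-shift^ h (suc n) F X (suc l) Ψ F≈0 eq = +-cong (eq 0)
    (sumOver-shift^ (λ i → h (suc i)) n (tail F) X l Ψ (λ i n≤i → F≈0 (suc i) (ℕ.s≤s n≤i)) (λ i → eq (suc i)))

  module _ (Q : Series) where
    product : ∀ {m} → Vec ℕ m → Carrier
    product = Vec.foldr′ (λ i x → Q i * x) 1#

    homogeneous : ∀ {m} → List (Vec ℕ m) → Series
    homogeneous vs s = sumOver vs λ is → if does (Vec.sum is ≟ s) then product is else 0#

    -- The test `i + Vec.sum is ≟ s` computes by stripping successors from `i` and `s` in parallel,
    -- exactly as `shift^` does. Using the indicator `does` rather than a filtered list is what
    -- makes this definitional.
    sumOver-translate : ∀ {m} i (vs : List (Vec ℕ m)) s →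
      sumOver vs (λ is → if does (i ℕ.+ Vec.sum is ≟ s) then product is else 0#) ≈ shift^ i (homogeneous vs) s
    sumOver-translate zero    vs s       = refl
    sumOver-translate (suc i) vs zero    = sumOver-zero vs
    sumOver-translate (suc i) vs (suc s) = sumOver-translate i vs s

    -- The entries i₁ , ... , i_m start at 1, which is why the constant term of `Q` is dropped; the
    -- upper limit n - 1 loses nothing as `Q` vanishes from degree n on.
    homogeneous-vectors : ∀ n → (∀ i → n ℕ.≤ i → Q i ≈ 0#) → ∀ m →
      homogeneous (vectors (map suc (upTo (n ∸ 1))) m) ≋ dropConstant Q ⊛^ m
    homogeneous-vectors n Q≈0 zero    zero    = +-identityʳ 1#
    homogeneous-vectors n Q≈0 zero    (suc s) = +-identityʳ 0#
    homogeneous-vectors n Q≈0 (suc m) s = begin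
      homogeneous (cartesianProductWith _∷_ (map suc (upTo (n ∸ 1))) vs) s
        ≈⟨ sumOver-cartesianProductWith _∷_ (map suc (upTo (n ∸ 1))) vs _ ⟩
      sumOver (map suc (upTo (n ∸ 1))) (λ i → sumOver vs λ is → if does (i ℕ.+ Vec.sum is ≟ s) then Q i * product is else 0#)
        ≈⟨ sumOver-map suc (upTo (n ∸ 1)) _ ⟩
      sumOver (upTo (n ∸ 1)) (λ i → sumOver vs λ is → if does (suc i ℕ.+ Vec.sum is ≟ s) then Q (suc i) * product is else 0#)
        ≈⟨ sumOver-cong (upTo (n ∸ 1)) (λ i → pull-out i) ⟩
      sumOver (upTo (n ∸ 1)) (λ i → Q (suc i) * shift^ (suc i) (homogeneous vs) s)
        ≈⟨ convolution s ⟩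
      (dropConstant Q ⊛ homogeneous vs) s
        ≈⟨ ⊛-congˡ (dropConstant Q) (homogeneous-vectors n Q≈0 m) s ⟩
      (dropConstant Q ⊛^ suc m) s ∎
      where
      vs : List (Vec ℕ m)
      vs = vectors (map suc (upTo (n ∸ 1))) m

      pull-out : ∀ i → sumOver vs (λ is → if does (suc i ℕ.+ Vec.sum is ≟ s) then Q (suc i) * product is else 0#)
                       ≈ Q (suc i) * shift^ (suc i) (homogeneous vs) s
      pull-out i = begin
        sumOver vs (λ is → if does (suc i ℕ.+ Vec.sum is ≟ s) then Q (suc i) * product is else 0#)
          ≈⟨ sumOver-cong vs (λ is → *-if (does (suc i ℕ.+ Vec.sum is ≟ s)) _ _) ⟩
        sumOver vs (λ is → Q (suc i) * (if does (suc i ℕ.+ Vec.sum is ≟ s) then product is else 0#))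
          ≈⟨ *-distribˡ-sumOver _ vs _ ⟨
        Q (suc i) * sumOver vs (λ is → if does (suc i ℕ.+ Vec.sum is ≟ s) then product is else 0#)
          ≈⟨ *-congˡ (sumOver-translate (suc i) vs s) ⟩
        Q (suc i) * shift^ (suc i) (homogeneous vs) s ∎

      convolution : ∀ s → sumOver (upTo (n ∸ 1)) (λ i → Q (suc i) * shift^ (suc i) (homogeneous vs) s)
                          ≈ (dropConstant Q ⊛ homogeneous vs) s
      convolution zero = trans (sumOver-cong (upTo (n ∸ 1)) (λ i → zeroʳ _))
        (trans (sumOver-zero (upTo (n ∸ 1))) (sym (zeroˡ _)))
      convolution (suc s) = trans
        (sumOver-shift^ (λ i → i) (n ∸ 1) (tail Q) (homogeneous vs) s _
          (λ i n∸1≤i → Q≈0 (suc i) (ℕₚ.≤-trans (ℕₚ.m≤n+m∸n n 1) (ℕ.s≤s n∸1≤i))) (λ _ → refl))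
        (sym (trans (+-congʳ (zeroˡ _)) (+-identityˡ _)))

  sumOver-indices : ∀ n l m U Q → (∀ i → n ℕ.≤ i → U i ≈ 0#) → (∀ i → n ℕ.≤ i → Q i ≈ 0#) →
    sumOver (indices n l m) (λ (i₀ , is) → U i₀ * product Q is) ≈ (U ⊛ dropConstant Q ⊛^ m) l
  sumOver-indices n l m U Q U≈0 Q≈0 = begin
    sumOver (indices n l m) (λ (i₀ , is) → U i₀ * product Q is)
      ≈⟨ sumOver-filter (λ (i₀ , is) → i₀ ℕ.+ Vec.sum is ≟ l) (cartesianProduct (upTo n) vs) _ ⟩
    sumOver (cartesianProduct (upTo n) vs) (λ (i₀ , is) → if does (i₀ ℕ.+ Vec.sum is ≟ l) then U i₀ * product Q is else 0#)
      ≈⟨ sumOver-cartesianProductWith _,_ (upTo n) vs _ ⟩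
    sumOver (upTo n) (λ i₀ → sumOver vs λ is → if does (i₀ ℕ.+ Vec.sum is ≟ l) then U i₀ * product Q is else 0#)
      ≈⟨ sumOver-shift^ (λ i → i) n U (homogeneous Q vs) l _ U≈0 pull-out ⟩
    (U ⊛ homogeneous Q vs) l
      ≈⟨ ⊛-congˡ U (homogeneous-vectors Q n Q≈0 m) l ⟩
    (U ⊛ dropConstant Q ⊛^ m) l ∎
    where
    vs : List (Vec ℕ m)
    vs = vectors (map suc (upTo (n ∸ 1))) m

    pull-out : ∀ i → sumOver vs (λ is → if does (i ℕ.+ Vec.sum is ≟ l) then U i * product Q is else 0#)
                     ≈ U i * shift^ i (homogeneous Q vs) l
    pull-out i = trans (sumOver-cong vs λ is → *-if (does (i ℕ.+ Vec.sum is ≟ l)) _ _)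
      (trans (sym (*-distribˡ-sumOver _ vs _)) (*-congˡ (sumOver-translate Q i vs l)))

-- Sums over the fillings of a multi-index.

filled-length : ∀ k ks → All (λ p → length p ℕ.≤ suc (length ks)) (filled k ks)
filled-length k []        = ℕₚ.≤-refl ∷ []
filled-length k (k′ ∷ ks) = Allₚ.++⁺
  (Allₚ.map⁺ (All.map ℕ.s≤s (filled-length k′ ks)))
  (Allₚ.++⁺ (All.map ℕₚ.m≤n⇒m≤1+n (filled-length (k ℕ.+ k′) ks))
            (All.map ℕₚ.m≤n⇒m≤1+n (filled-length (k ℕ.+ k′ ∸ 1) ks)))

module FillingSum {c ℓ} (R : CommutativeRing c ℓ) (t : CommutativeRing.Carrier R) where
  open CommutativeRing R hiding (zero)
  open import Algebra.Properties.Semiring.Exp semiring using (_^_)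
  open IntegerCoefficientSolver R
  open PowerSeries R
  open ListSum R
  open ≈-Reasoning setoid

  fillingSum : (List ℕ → Carrier) → List ℕ → Carrier
  fillingSum Φ ks = sumOver (fillings ks) λ p → Φ p * t ^ (length ks ∸ length p)

  fillingSum-cong : ∀ {Φ Ψ} ks → (∀ p → Φ p ≈ Ψ p) → fillingSum Φ ks ≈ fillingSum Ψ ks
  fillingSum-cong ks eq = sumOver-cong (fillings ks) λ p → *-congʳ (eq p)

  fillingSum-+ : ∀ Φ Ψ ks → fillingSum (λ p → Φ p + Ψ p) ks ≈ fillingSum Φ ks + fillingSum Ψ ks
  fillingSum-+ Φ Ψ ks = trans (sumOver-cong (fillings ks) (λ p → distribʳ _ _ _)) (sumOver-+ (fillings ks) _ _)

  fillingSum-* : ∀ a Φ ks → fillingSum (λ p → a * Φ p) ks ≈ a * fillingSum Φ ks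
  fillingSum-* a Φ ks = trans (sumOver-cong (fillings ks) (λ p → *-assoc _ _ _)) (sym (*-distribˡ-sumOver a (fillings ks) _))

  fillingSum-∷ : ∀ Φ k k′ ks → fillingSum Φ (k ∷ k′ ∷ ks) ≈
    fillingSum (λ p → Φ (k ∷ p)) (k′ ∷ ks)
    + t * (fillingSum Φ (k ℕ.+ k′ ∷ ks) + fillingSum Φ (k ℕ.+ k′ ∸ 1 ∷ ks))
  fillingSum-∷ Φ k k′ ks = begin
    sumOver (map (k ∷_) (filled k′ ks) ++ filled (k ℕ.+ k′) ks ++ filled (k ℕ.+ k′ ∸ 1) ks) weight
      ≈⟨ sumOver-++ (map (k ∷_) (filled k′ ks)) _ _ ⟩
    sumOver (map (k ∷_) (filled k′ ks)) weight + sumOver (filled (k ℕ.+ k′) ks ++ filled (k ℕ.+ k′ ∸ 1) ks) weight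
      ≈⟨ +-cong (sumOver-map (k ∷_) (filled k′ ks) _) (sumOver-++ (filled (k ℕ.+ k′) ks) _ _) ⟩
    fillingSum (λ p → Φ (k ∷ p)) (k′ ∷ ks) + (sumOver (filled (k ℕ.+ k′) ks) weight + sumOver (filled (k ℕ.+ k′ ∸ 1) ks) weight)
      ≈⟨ +-congˡ (trans (+-cong (merged (k ℕ.+ k′)) (merged (k ℕ.+ k′ ∸ 1))) (sym (distribˡ t _ _))) ⟩
    fillingSum (λ p → Φ (k ∷ p)) (k′ ∷ ks) + t * (fillingSum Φ (k ℕ.+ k′ ∷ ks) + fillingSum Φ (k ℕ.+ k′ ∸ 1 ∷ ks)) ∎
    where
    weight : List ℕ → Carrier
    weight p = Φ p * t ^ (suc (suc (length ks)) ∸ length p)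

    merged : ∀ j → sumOver (filled j ks) weight ≈ t * fillingSum Φ (j ∷ ks)
    merged j = trans
      -- The length bound makes the truncated difference in the exponent an honest one, so that a
      -- merger costs exactly one factor t.
      (sumOver-cong-All (filled-length j ks) λ {p} len≤ → trans
        (*-congˡ (reflexive (≡.cong (t ^_) (ℕₚ.+-∸-assoc 1 len≤))))
        (solve 3 (λ t x y → x :* (t :* y) := t :* (x :* y)) refl t (Φ p) (t ^ (suc (length ks) ∸ length p))))
      (sym (*-distribˡ-sumOver t (filled j ks) _))

  -- The two ways of merging k and k′ add up to g k g k′, hence an entry that has
  -- absorbed several neighbours contributes the product of their weights.
  module Merging (g : ℕ → Carrier)
                 (g-merge : ∀ i j → g (suc i ℕ.+ suc j) + g (suc i ℕ.+ suc j ∸ 1) ≈ g (suc i) * g (suc j))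
                 (H : List ℕ → Carrier) where
    -- For nested sums `H` with bound M this is the part added when the bound becomes M + 1: the
    -- largest index takes the new value and the other entries are summed below it.
    prefixed : List ℕ → Carrier
    prefixed []      = 0#
    prefixed (k ∷ p) = g k * H p

    -- What follows an entry sitting at the new largest index: either the next entry begins a sum
    -- below that index, or it is merged in as well, at the cost of t and its own weight.
    absorbed : List ℕ → Carrier
    absorbed []       = H []
    absorbed (k ∷ ks) = fillingSum H (k ∷ ks) + t * (g k * absorbed ks)

    -- The first entry has to be arbitrary, since merging changes it in the recursive calls.
    -- Positivity of all entries keeps k + k′ - 1 positive, so that `g-merge` applies again.
    fillingSum-prefixed : ∀ {ks} i → All (λ k → 0 ℕ.< k) ks →
                          fillingSum prefixed (suc i ∷ ks) ≈ g (suc i) * absorbed ks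
    fillingSum-prefixed i [] = trans (+-identityʳ _) (*-identityʳ _)
    fillingSum-prefixed {suc j ∷ ks} i (_ ∷ 0<ks) = begin
      fillingSum prefixed (suc i ∷ suc j ∷ ks)
        ≈⟨ fillingSum-∷ prefixed (suc i) (suc j) ks ⟩
      fillingSum (λ p → g (suc i) * H p) (suc j ∷ ks)
        + t * (fillingSum prefixed (suc i ℕ.+ suc j ∷ ks) + fillingSum prefixed (i ℕ.+ suc j ∷ ks))
        ≈⟨ +-cong (fillingSum-* (g (suc i)) H (suc j ∷ ks)) (*-congˡ (+-cong
             (fillingSum-prefixed (i ℕ.+ suc j) 0<ks)
             (≡.subst (λ k → fillingSum prefixed (k ∷ ks) ≈ g k * absorbed ks) (≡.sym (ℕₚ.+-suc i j))
               (fillingSum-prefixed (i ℕ.+ j) 0<ks)))) ⟩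
      g (suc i) * fillingSum H (suc j ∷ ks)
        + t * (g (suc i ℕ.+ suc j) * absorbed ks + g (i ℕ.+ suc j) * absorbed ks)
        ≈⟨ +-congˡ (*-congˡ (trans (sym (distribʳ _ _ _)) (*-congʳ (g-merge i j)))) ⟩
      g (suc i) * fillingSum H (suc j ∷ ks) + t * (g (suc i) * g (suc j) * absorbed ks)
        ≈⟨ solve 5 (λ a b t s w → a :* s :+ t :* (a :* b :* w) := a :* (s :+ t :* (b :* w)))
             refl (g (suc i)) (g (suc j)) t _ _ ⟩
      g (suc i) * absorbed (suc j ∷ ks) ∎

    -- As generating series, Z′ = Z + a x Y and Y = Z + t a x Y, where Y collects the values of
    -- `absorbed`. Eliminating Y gives (1 - t a x) Z′ = (1 + (1 - t) a x) Z, one factor of the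
    -- product formula.
    linear-fillingSum : ∀ {H′} → (∀ p → H′ p ≈ H p + prefixed p) → H [] ≈ 1# → ∀ k → let a = g (suc k) in
      linear (- (t * a)) (λ l → fillingSum H′ (replicate l (suc k)))
        ≋ linear ((1# - t) * a) (λ l → fillingSum H (replicate l (suc k)))
    linear-fillingSum {H′} H′≈ H[]≈1 k = main
      where
      a : Carrier
      a = g (suc k)

      Z Z′ Y : Series
      Z  l = fillingSum H (replicate l (suc k))
      Z′ l = fillingSum H′ (replicate l (suc k))
      Y  l = absorbed (replicate l (suc k))

      Z₀≈1 : Z 0 ≈ 1#
      Z₀≈1 = trans (+-identityʳ _) (trans (*-identityʳ _) H[]≈1)

      Z′₀≈1 : Z′ 0 ≈ 1#
      Z′₀≈1 = trans (+-identityʳ _) (trans (*-identityʳ _) (trans (H′≈ []) (trans (+-identityʳ _) H[]≈1)))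

      Z′-suc : ∀ l → Z′ (suc l) ≈ Z (suc l) + a * Y l
      Z′-suc l = trans (fillingSum-cong (replicate (suc l) (suc k)) H′≈) (trans
        (fillingSum-+ H prefixed (replicate (suc l) (suc k)))
        (+-congˡ (fillingSum-prefixed k (Allₚ.replicate⁺ l (ℕ.s≤s ℕ.z≤n)))))

      main : linear (- (t * a)) Z′ ≋ linear ((1# - t) * a) Z
      main zero = +-cong (trans Z′₀≈1 (sym Z₀≈1)) (trans (zeroʳ _) (sym (zeroʳ _)))
      main (suc zero) = begin
        Z′ 1 + - (t * a) * Z′ 0               ≈⟨ +-cong (trans (Z′-suc 0) (+-congˡ (*-congˡ H[]≈1))) (*-congˡ Z′₀≈1) ⟩
        (Z 1 + a * 1#) + - (t * a) * 1#
          ≈⟨ solve 3 (λ z a t → (z :+ a :* con (+ 1)) :+ :- (t :* a) :* con (+ 1) := z :+ (con (+ 1) :- t) :* a :* con (+ 1)) refl (Z 1) a t ⟩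
        Z 1 + (1# - t) * a * 1#               ≈⟨ +-congˡ (*-congˡ Z₀≈1) ⟨
        Z 1 + (1# - t) * a * Z 0 ∎
      main (suc (suc l)) = begin
        Z′ (suc (suc l)) + - (t * a) * Z′ (suc l)
          ≈⟨ +-cong (Z′-suc (suc l)) (*-congˡ (Z′-suc l)) ⟩
        (Z (suc (suc l)) + a * (Z (suc l) + t * (a * Y l))) + - (t * a) * (Z (suc l) + a * Y l)
          ≈⟨ solve 5 (λ z₂ z₁ y a t → (z₂ :+ a :* (z₁ :+ t :* (a :* y))) :+ :- (t :* a) :* (z₁ :+ a :* y)
                                      := z₂ :+ (con (+ 1) :- t) :* a :* z₁) refl (Z (suc (suc l))) (Z (suc l)) (Y l) a t ⟩
        Z (suc (suc l)) + (1# - t) * a * Z (suc l) ∎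

-- Polynomials, interpolation and roots of unity over a commutative ring.

module Polynomial {c ℓ} (R : CommutativeRing c ℓ) where
  open CommutativeRing R hiding (zero)
  open import Algebra.Properties.Semiring.Exp semiring using (_^_; ^-homo-*; ^-assocʳ; ^-congˡ)
  open import Algebra.Properties.Semiring.Mult semiring using () renaming (_×_ to _·_)
  open IntegerCoefficientSolver R
  open PowerSeries R
  open ≈-Reasoning setoid

  -- Non-zero-divisors take the place of nonzero elements: they suffice for counting roots and are
  -- available without deciding equality.
  Regular : Carrier → Set (c ⊔ ℓ)
  Regular x = ∀ {y} → x * y ≈ 0# → y ≈ 0#

  regular-resp : ∀ {x y} → x ≈ y → Regular x → Regular y
  regular-resp x≈y reg yz≈0 = reg (trans (*-congʳ x≈y) yz≈0)

  regular-* : ∀ {x y} → Regular x → Regular y → Regular (x * y)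
  regular-* x-reg y-reg xyz≈0 = y-reg (x-reg (trans (sym (*-assoc _ _ _)) xyz≈0))

  regular-neg : ∀ {x} → Regular x → Regular (- x)
  regular-neg {x} reg {z} eq = reg (begin
    x * z           ≈⟨ solve 2 (λ x z → x :* z := :- ((:- x) :* z)) refl x z ⟩
    - (- x * z)     ≈⟨ -‿cong eq ⟩
    - 0#            ≈⟨ solve 0 (:- con (+ 0) := con (+ 0)) refl ⟩
    0#              ∎)

  regular-cancel : ∀ {x y z} → Regular x → x * y ≈ x * z → y ≈ z
  regular-cancel {x} {y} {z} reg eq = begin
    y            ≈⟨ solve 2 (λ y z → y := (y :- z) :+ z) refl y z ⟩
    (y - z) + z  ≈⟨ +-congʳ (reg (trans (solve 3 (λ x y z → x :* (y :- z) := x :* y :- x :* z) refl x y z)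
                                  (trans (+-congʳ eq) (-‿inverseʳ _)))) ⟩
    0# + z       ≈⟨ +-identityˡ z ⟩
    z            ∎

  unit⇒regular : ∀ {x y} → x * y ≈ 1# → Regular x
  unit⇒regular {x} {y} xy≈1 {z} xz≈0 = begin
    z            ≈⟨ *-identityˡ z ⟨
    1# * z       ≈⟨ *-congʳ xy≈1 ⟨
    x * y * z    ≈⟨ solve 3 (λ x y z → x :* y :* z := y :* (x :* z)) refl x y z ⟩
    y * (x * z)  ≈⟨ *-congˡ xz≈0 ⟩
    y * 0#       ≈⟨ zeroʳ y ⟩
    0#           ∎

  1^ : ∀ n → 1# ^ n ≈ 1#
  1^ zero    = refl
  1^ (suc n) = trans (*-identityˡ _) (1^ n)

  ∏ : ℕ → (ℕ → Carrier) → Carrier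
  ∏ zero    h = 1#
  ∏ (suc n) h = ∏ n h * h n

  ∏-cong : ∀ n {g h} → (∀ m → m ℕ.< n → g m ≈ h m) → ∏ n g ≈ ∏ n h
  ∏-cong zero    eq = refl
  ∏-cong (suc n) eq = *-cong (∏-cong n λ m m<n → eq m (ℕₚ.m<n⇒m<1+n m<n)) (eq n ℕₚ.≤-refl)

  ∏-* : ∀ n g h → ∏ n (λ m → g m * h m) ≈ ∏ n g * ∏ n h
  ∏-* zero    g h = sym (*-identityˡ 1#)
  ∏-* (suc n) g h = trans (*-congʳ (∏-* n g h))
    (solve 4 (λ a b c d → (a :* b) :* (c :* d) := (a :* c) :* (b :* d)) refl (∏ n g) (∏ n h) (g n) (h n))

  -- Horner evaluation of the first `B` coefficients; a polynomial of degree at most d therefore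
  -- appears as `eval (suc d)`.
  eval : ℕ → Series → Carrier → Carrier
  eval zero    f x = 0#
  eval (suc B) f x = f 0 + x * eval B (tail f) x

  eval-cong : ∀ B {f g} x → (∀ i → i ℕ.< B → f i ≈ g i) → eval B f x ≈ eval B g x
  eval-cong zero    x eq = refl
  eval-cong (suc B) x eq = +-cong (eq 0 (ℕ.s≤s ℕ.z≤n)) (*-congˡ (eval-cong B x λ i i<B → eq (suc i) (ℕ.s≤s i<B)))

  eval-linear : ∀ B a f g x → eval B (λ i → f i + a * g i) x ≈ eval B f x + a * eval B g x
  eval-linear zero    a f g x = sym (trans (+-identityˡ _) (zeroʳ a))
  eval-linear (suc B) a f g x = trans (+-congˡ (*-congˡ (eval-linear B a (tail f) (tail g) x)))
    (solve 6 (λ a x u v s t → (u :+ a :* v) :+ x :* (s :+ a :* t) := (u :+ x :* s) :+ a :* (v :+ x :* t))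
      refl a x (f 0) (g 0) (eval B (tail f) x) (eval B (tail g) x))

  eval-zero : ∀ B {f} x → (∀ i → f i ≈ 0#) → eval B f x ≈ 0#
  eval-zero zero    x eq = refl
  eval-zero (suc B) x eq = trans (+-cong (eq 0) (trans (*-congˡ (eval-zero B x (λ i → eq (suc i)))) (zeroʳ x))) (+-identityʳ 0#)

  eval-δ : ∀ B x → eval (suc B) δ x ≈ 1#
  eval-δ B x = trans (+-congˡ (trans (*-congˡ (eval-zero B x (λ _ → refl))) (zeroʳ x))) (+-identityʳ 1#)

  eval-extend : ∀ B f x → f B ≈ 0# → eval (suc B) f x ≈ eval B f x
  eval-extend zero    f x eq = trans (+-cong eq (zeroʳ x)) (+-identityʳ 0#)
  eval-extend (suc B) f x eq = +-congˡ (*-congˡ (eval-extend B (tail f) x eq))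

  -- Both sides keep the same number of coefficients although multiplication by x raises the degree,
  -- so the top coefficient of `f` must vanish.
  eval-shift : ∀ B f x → f B ≈ 0# → eval (suc B) (shift f) x ≈ x * eval (suc B) f x
  eval-shift B f x eq = trans (+-identityˡ _) (*-congˡ (sym (eval-extend B f x eq)))

  -- synthetic division by X - r
  quot : ℕ → Series → Carrier → Series
  quot zero    f r i       = 0#
  quot (suc B) f r zero    = eval (suc B) (tail f) r
  quot (suc B) f r (suc i) = quot B (tail f) r i

  eval-quot : ∀ B f r x → eval (suc B) f x - eval (suc B) f r ≈ (x - r) * eval B (quot B f r) x
  eval-quot zero f r x =
    solve 3 (λ c r x → (c :+ x :* con (+ 0)) :- (c :+ r :* con (+ 0)) := (x :- r) :* con (+ 0)) refl (f 0) r x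
  eval-quot (suc B) f r x = begin
    (f 0 + x * E x) - (f 0 + r * E r)
      ≈⟨ solve 5 (λ c r x s t → (c :+ x :* s) :- (c :+ r :* t) := (x :- r) :* t :+ x :* (s :- t)) refl (f 0) r x (E x) (E r) ⟩
    (x - r) * E r + x * (E x - E r)
      ≈⟨ +-congˡ (*-congˡ (eval-quot B (tail f) r x)) ⟩
    (x - r) * E r + x * ((x - r) * q)
      ≈⟨ solve 4 (λ d x t q → d :* t :+ x :* (d :* q) := d :* (t :+ x :* q)) refl (x - r) x (E r) q ⟩
    (x - r) * (E r + x * q) ∎
    where
    E : Carrier → Carrier
    E = eval (suc B) (tail f)

    q : Carrier
    q = eval B (quot B (tail f) r) x

  eval-root : ∀ B f r x → eval (suc B) f r ≈ 0# → eval (suc B) f x ≈ (x - r) * eval B (quot B f r) x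
  eval-root B f r x root = begin
    eval (suc B) f x                      ≈⟨ solve 1 (λ a → a := a :- con (+ 0)) refl _ ⟩
    eval (suc B) f x - 0#                 ≈⟨ +-congˡ (-‿cong root) ⟨
    eval (suc B) f x - eval (suc B) f r   ≈⟨ eval-quot B f r x ⟩
    (x - r) * eval B (quot B f r) x       ∎

  quot-leading : ∀ B f r → quot (suc B) f r B ≈ f (suc B)
  quot-leading zero    f r = trans (+-congˡ (zeroʳ r)) (+-identityʳ _)
  quot-leading (suc B) f r = quot-leading B (tail f) r

  -- The constant coefficient of the quotient is the value of `tail f` at r. Once it vanishes, f r =
  -- 0 forces `f 0` to vanish, and r is also a root of `tail f`, which carries the induction.
  quot-zero : ∀ B f r → eval (suc B) f r ≈ 0# → (∀ i → i ℕ.< B → quot B f r i ≈ 0#) → ∀ i → i ℕ.< suc B → f i ≈ 0#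
  quot-zero zero    f r root q≈0 zero    _ = trans (sym (trans (+-congˡ (zeroʳ r)) (+-identityʳ _))) root
  quot-zero zero    f r root q≈0 (suc i) (ℕ.s≤s ())
  quot-zero (suc B) f r root q≈0 zero _ = begin
    f 0                                   ≈⟨ trans (+-congˡ (zeroʳ r)) (+-identityʳ _) ⟨
    f 0 + r * 0#                          ≈⟨ +-congˡ (*-congˡ (q≈0 0 (ℕ.s≤s ℕ.z≤n))) ⟨
    f 0 + r * eval (suc B) (tail f) r     ≈⟨ root ⟩
    0#                                    ∎
  quot-zero (suc B) f r root q≈0 (suc i) (ℕ.s≤s i<1+B) =
    quot-zero B (tail f) r (q≈0 0 (ℕ.s≤s ℕ.z≤n)) (λ j j<B → q≈0 (suc j) (ℕ.s≤s j<B)) i i<1+B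

  RegularDifferences : ℕ → (ℕ → Carrier) → Set (c ⊔ ℓ)
  RegularDifferences B r = ∀ {i j} → i ℕ.< j → j ℕ.< B → Regular (r i - r j)

  restrict-differences : ∀ {B r} → RegularDifferences (suc B) r → RegularDifferences B r
  restrict-differences reg i<j j<B = reg i<j (ℕₚ.m<n⇒m<1+n j<B)

  -- Split off the last root; at every other root the factor `r i - r B` is regular and can be
  -- cancelled, so the quotient inherits the remaining roots.
  roots-product : ∀ B f r x → RegularDifferences B r → (∀ i → i ℕ.< B → eval (suc B) f (r i) ≈ 0#) →
                  eval (suc B) f x ≈ f B * ∏ B (λ i → x - r i)
  roots-product zero f r x reg root = solve 2 (λ c x → c :+ x :* con (+ 0) := c :* con (+ 1)) refl (f 0) x
  roots-product (suc B) f r x reg root = begin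
    eval (suc (suc B)) f x
      ≈⟨ eval-root (suc B) f (r B) x (root B ℕₚ.≤-refl) ⟩
    (x - r B) * eval (suc B) (quot (suc B) f (r B)) x
      ≈⟨ *-congˡ (roots-product B (quot (suc B) f (r B)) r x (restrict-differences {r = r} reg) λ i i<B →
           reg i<B ℕₚ.≤-refl (trans (sym (eval-root (suc B) f (r B) (r i) (root B ℕₚ.≤-refl))) (root i (ℕₚ.m<n⇒m<1+n i<B)))) ⟩
    (x - r B) * (quot (suc B) f (r B) B * ∏ B (λ i → x - r i))
      ≈⟨ *-congˡ (*-congʳ (quot-leading B f (r B))) ⟩
    (x - r B) * (f (suc B) * ∏ B (λ i → x - r i))
      ≈⟨ solve 3 (λ d c p → d :* (c :* p) := c :* (p :* d)) refl (x - r B) (f (suc B)) _ ⟩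
    f (suc B) * (∏ B (λ i → x - r i) * (x - r B)) ∎

  vanishing⇒zero : ∀ B f r → RegularDifferences B r → (∀ i → i ℕ.< B → eval B f (r i) ≈ 0#) → ∀ i → i ℕ.< B → f i ≈ 0#
  vanishing⇒zero (suc B) f r reg root = quot-zero B f (r B) (root B ℕₚ.≤-refl)
    (vanishing⇒zero B (quot B f (r B)) r (restrict-differences {r = r} reg) λ i i<B →
      reg i<B ℕₚ.≤-refl (trans (sym (eval-root B f (r B) (r i) (root B ℕₚ.≤-refl))) (root i (ℕₚ.m<n⇒m<1+n i<B))))

  interpolation-unique : ∀ B f g r → RegularDifferences B r →
    (∀ i → i ℕ.< B → eval B f (r i) ≈ eval B g (r i)) → ∀ i → i ℕ.< B → f i ≈ g i
  interpolation-unique B f g r reg eq i i<B = begin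
    f i                        ≈⟨ solve 2 (λ f g → f := (f :+ (:- con (+ 1)) :* g) :+ g) refl (f i) (g i) ⟩
    (f i + - 1# * g i) + g i   ≈⟨ +-congʳ (vanishing⇒zero B (λ j → f j + - 1# * g j) r reg root i i<B) ⟩
    0# + g i                   ≈⟨ +-identityˡ _ ⟩
    g i                        ∎
    where
    root : ∀ i → i ℕ.< B → eval B (λ j → f j + - 1# * g j) (r i) ≈ 0#
    root i i<B = begin
      eval B (λ j → f j + - 1# * g j) (r i)    ≈⟨ eval-linear B (- 1#) f g (r i) ⟩
      eval B f (r i) + - 1# * eval B g (r i)   ≈⟨ +-congʳ (eq i i<B) ⟩
      eval B g (r i) + - 1# * eval B g (r i)   ≈⟨ solve 1 (λ a → a :+ (:- con (+ 1)) :* a := con (+ 0)) refl _ ⟩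
      0#                                       ∎

  -- the coefficients of ∏ (1 + f m x), over m < N
  elementary : (ℕ → Carrier) → ℕ → Series
  elementary f zero    = δ
  elementary f (suc N) = linear (f N) (elementary f N)

  elementary-0 : ∀ f N → elementary f N 0 ≈ 1#
  elementary-0 f zero    = refl
  elementary-0 f (suc N) = trans (+-cong (elementary-0 f N) (zeroʳ _)) (+-identityʳ 1#)

  elementary-degree : ∀ f N i → N ℕ.< i → elementary f N i ≈ 0#
  elementary-degree f zero    (suc i) _ = refl
  elementary-degree f (suc N) (suc i) (ℕ.s≤s N<i) = trans
    (+-cong (elementary-degree f N (suc i) (ℕₚ.m<n⇒m<1+n N<i)) (trans (*-congˡ (elementary-degree f N i N<i)) (zeroʳ _)))
    (+-identityʳ 0#)

  eval-elementary : ∀ f N B x → N ℕ.< B → eval B (elementary f N) x ≈ ∏ N (λ m → 1# + f m * x)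
  eval-elementary f zero    (suc B) x _ = eval-δ B x
  eval-elementary f (suc N) (suc B) x (ℕ.s≤s N<B) = begin
    eval (suc B) (linear (f N) F) x
      ≈⟨ eval-linear (suc B) (f N) F (shift F) x ⟩
    eval (suc B) F x + f N * eval (suc B) (shift F) x
      ≈⟨ +-congˡ (*-congˡ (eval-shift B F x (elementary-degree f N B N<B))) ⟩
    eval (suc B) F x + f N * (x * eval (suc B) F x)
      ≈⟨ solve 3 (λ E a x → E :+ a :* (x :* E) := E :* (con (+ 1) :+ a :* x)) refl _ (f N) x ⟩
    eval (suc B) F x * (1# + f N * x)
      ≈⟨ *-congʳ (eval-elementary f N (suc B) x (ℕₚ.m<n⇒m<1+n N<B)) ⟩
    ∏ N (λ m → 1# + f m * x) * (1# + f N * x) ∎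
    where
    F : Series
    F = elementary f N

  geometric : ∀ n x → (x - 1#) * eval n (λ _ → 1#) x ≈ x ^ n - 1#
  geometric zero    x = solve 1 (λ x → (x :- con (+ 1)) :* con (+ 0) := con (+ 1) :- con (+ 1)) refl x
  geometric (suc n) x = begin
    (x - 1#) * (1# + x * eval n (λ _ → 1#) x)
      ≈⟨ solve 2 (λ x E → (x :- con (+ 1)) :* (con (+ 1) :+ x :* E) := (x :- con (+ 1)) :+ x :* ((x :- con (+ 1)) :* E)) refl x _ ⟩
    (x - 1#) + x * ((x - 1#) * eval n (λ _ → 1#) x)   ≈⟨ +-congˡ (*-congˡ (geometric n x)) ⟩
    (x - 1#) + x * (x ^ n - 1#)
      ≈⟨ solve 2 (λ x p → (x :- con (+ 1)) :+ x :* (p :- con (+ 1)) := x :* p :- con (+ 1)) refl x _ ⟩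
    x ^ suc n - 1# ∎

  module RootsOfUnity (N : ℕ) (ζ : Carrier) (ζⁿ≈1 : ζ ^ suc N ≈ 1#)
                      (regular : ∀ m → m ℕ.< N → Regular (ζ ^ suc m - 1#)) where
    -- (x ^ n - 1) / (x - 1) for n = suc N
    ∏ζ : Carrier → Carrier
    ∏ζ x = ∏ N (λ m → x - ζ ^ suc m)

    ζ^-regular : ∀ m → Regular (ζ ^ m)
    ζ^-regular zero    = unit⇒regular (*-identityˡ 1#)
    ζ^-regular (suc m) = regular-* (unit⇒regular ζⁿ≈1) (ζ^-regular m)

    -- The powers ζ , ... , ζ^N are N roots of 1 + x + ⋯ + x^N, whose leading coefficient is 1. In
    -- this form the product can also be evaluated at x = 1, where (x^n - 1) / (x - 1) is of no use.
    ∏ζ≈eval : ∀ x → ∏ζ x ≈ eval (suc N) (λ _ → 1#) x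
    ∏ζ≈eval x = trans (sym (*-identityˡ _)) (sym (roots-product N (λ _ → 1#) (λ m → ζ ^ suc m) x differences root))
      where
      -- ζ^i - ζ^j = - ζ^i (ζ^(j-i) - 1) for i < j, and ζ^i is a unit because ζ^n = 1.
      differences : RegularDifferences N (λ m → ζ ^ suc m)
      differences {i} {j} i<j j<N = regular-resp eq
        (regular-neg (regular-* (ζ^-regular (suc i)) (regular (j ∸ suc i) (ℕₚ.≤-<-trans (ℕₚ.m∸n≤m j (suc i)) j<N))))
        where
        eq : - (ζ ^ suc i * (ζ ^ suc (j ∸ suc i) - 1#)) ≈ ζ ^ suc i - ζ ^ suc j
        eq = begin
          - (ζ ^ suc i * (ζ ^ suc (j ∸ suc i) - 1#))
            ≈⟨ solve 2 (λ a b → :- (a :* (b :- con (+ 1))) := a :- a :* b) refl _ _ ⟩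
          ζ ^ suc i - ζ ^ suc i * ζ ^ suc (j ∸ suc i)
            ≈⟨ +-congˡ (-‿cong (^-homo-* ζ (suc i) (suc (j ∸ suc i)))) ⟨
          ζ ^ suc i - ζ ^ (suc i ℕ.+ suc (j ∸ suc i))
            ≡⟨ ≡.cong (λ k → ζ ^ suc i - ζ ^ k) (≡.trans (ℕₚ.+-suc (suc i) _) (≡.cong suc (ℕₚ.m+[n∸m]≡n i<j))) ⟩
          ζ ^ suc i - ζ ^ suc j ∎

      root : ∀ i → i ℕ.< N → eval (suc N) (λ _ → 1#) (ζ ^ suc i) ≈ 0#
      root i i<N = regular i i<N (begin
        (ζ ^ suc i - 1#) * eval (suc N) (λ _ → 1#) (ζ ^ suc i)  ≈⟨ geometric (suc N) (ζ ^ suc i) ⟩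
        (ζ ^ suc i) ^ suc N - 1#                                ≈⟨ +-congʳ (^-assocʳ ζ (suc i) (suc N)) ⟩
        ζ ^ (suc i ℕ.* suc N) - 1#                              ≡⟨ ≡.cong (λ k → ζ ^ k - 1#) (ℕₚ.*-comm (suc i) (suc N)) ⟩
        ζ ^ (suc N ℕ.* suc i) - 1#                              ≈⟨ +-congʳ (^-assocʳ ζ (suc N) (suc i)) ⟨
        (ζ ^ suc N) ^ suc i - 1#                                ≈⟨ +-congʳ (trans (^-congˡ (suc i) ζⁿ≈1) (1^ (suc i))) ⟩
        1# - 1#                                                 ≈⟨ -‿inverseʳ 1# ⟩
        0#                                                      ∎)

    [x-1]∏ζ : ∀ x → (x - 1#) * ∏ζ x ≈ x ^ suc N - 1#
    [x-1]∏ζ x = trans (*-congˡ (∏ζ≈eval x)) (geometric (suc N) x)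

    ∏ζ1≈n : ∏ζ 1# ≈ suc N · 1#
    ∏ζ1≈n = trans (∏ζ≈eval 1#) (go (suc N))
      where
      go : ∀ n → eval n (λ _ → 1#) 1# ≈ n · 1#
      go zero    = refl
      go (suc n) = +-congˡ (trans (*-identityˡ _) (go n))

-- Binomial identities in the natural numbers.

pascal : ∀ n k → suc n C suc k ≡ (n C k) ℕ.+ (n C suc k)
pascal n k = ≡.sym (nCk+nC[k+1]≡[n+1]C[k+1] n k)

-- The second difference in the upper index lowers the lower index by 2; `pascal³` is the third
-- difference. Negative terms are moved across to stay in ℕ.
pascal² : ∀ n k → ((2 ℕ.+ n) C (2 ℕ.+ k)) ℕ.+ (n C (2 ℕ.+ k)) ≡ 2 ℕ.* ((1 ℕ.+ n) C (2 ℕ.+ k)) ℕ.+ (n C k)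
pascal² n k
  rewrite pascal (1 ℕ.+ n) (1 ℕ.+ k) | pascal n (1 ℕ.+ k) | pascal n k
  = solveℕ 3 (λ x₀ x₁ x₂ → ((x₀ ⊕ x₁) ⊕ (x₁ ⊕ x₂)) ⊕ x₂
      ⊜ numeral 2 ⊗ (x₁ ⊕ x₂) ⊕ x₀) ≡.refl (n C k) (n C (1 ℕ.+ k)) (n C (2 ℕ.+ k))

pascal³ : ∀ n k → ((3 ℕ.+ n) C (3 ℕ.+ k)) ℕ.+ 3 ℕ.* ((1 ℕ.+ n) C (3 ℕ.+ k))
                  ≡ 3 ℕ.* ((2 ℕ.+ n) C (3 ℕ.+ k)) ℕ.+ (n C (3 ℕ.+ k)) ℕ.+ (n C k)
pascal³ n k
  rewrite pascal (2 ℕ.+ n) (2 ℕ.+ k) | pascal (1 ℕ.+ n) (2 ℕ.+ k) | pascal (1 ℕ.+ n) (1 ℕ.+ k)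
        | pascal n (2 ℕ.+ k) | pascal n (1 ℕ.+ k) | pascal n k
  = solveℕ 4 (λ x₀ x₁ x₂ x₃ →
      (((x₀ ⊕ x₁) ⊕ (x₁ ⊕ x₂)) ⊕ ((x₁ ⊕ x₂) ⊕ (x₂ ⊕ x₃)))
        ⊕ numeral 3 ⊗ (x₂ ⊕ x₃)
      ⊜ numeral 3 ⊗ ((x₁ ⊕ x₂) ⊕ (x₂ ⊕ x₃)) ⊕ x₃ ⊕ x₀)
      ≡.refl (n C k) (n C (1 ℕ.+ k)) (n C (2 ℕ.+ k)) (n C (3 ℕ.+ k))

absorption : ∀ n k → suc k ℕ.* (suc n C suc k) ≡ suc n ℕ.* (n C k)
absorption n zero = begin
  1 ℕ.* (suc n C 1)   ≡⟨ ℕₚ.*-identityˡ _ ⟩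
  suc n C 1         ≡⟨ nC1≡n (suc n) ⟩
  suc n             ≡⟨ ℕₚ.*-identityʳ _ ⟨
  suc n ℕ.* (n C 0)   ∎
  where open ≡.≡-Reasoning
absorption zero (suc k) = begin
  suc (suc k) ℕ.* (1 C suc (suc k))   ≡⟨ ≡.cong (suc (suc k) ℕ.*_) (k>n⇒nCk≡0 {1} {suc (suc k)} (ℕ.s≤s (ℕ.s≤s ℕ.z≤n))) ⟩
  suc (suc k) ℕ.* 0                 ≡⟨ ℕₚ.*-zeroʳ (suc (suc k)) ⟩
  0                                 ≡⟨ ≡.cong (1 ℕ.*_) (k>n⇒nCk≡0 {0} {suc k} (ℕ.s≤s ℕ.z≤n)) ⟨
  1 ℕ.* (0 C suc k)                   ∎
  where open ≡.≡-Reasoning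
absorption (suc n) (suc k) = begin
  (2 ℕ.+ k) ℕ.* ((2 ℕ.+ n) C (2 ℕ.+ k))
    ≡⟨ ≡.cong ((2 ℕ.+ k) ℕ.*_) (pascal (suc n) (suc k)) ⟩
  (2 ℕ.+ k) ℕ.* (A ℕ.+ B)
    ≡⟨ solveℕ 3 (λ k a b → (numeral 2 ⊕ k) ⊗ (a ⊕ b) ⊜
         a ⊕ (numeral 1 ⊕ k) ⊗ a ⊕ (numeral 2 ⊕ k) ⊗ b) ≡.refl k A B ⟩
  A ℕ.+ suc k ℕ.* A ℕ.+ suc (suc k) ℕ.* B
    ≡⟨ ≡.cong₂ (λ s t → A ℕ.+ s ℕ.+ t) (absorption n k) (absorption n (suc k)) ⟩
  A ℕ.+ suc n ℕ.* (n C k) ℕ.+ suc n ℕ.* (n C suc k)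
    ≡⟨ ≡.cong (λ a → a ℕ.+ suc n ℕ.* (n C k) ℕ.+ suc n ℕ.* (n C suc k)) (pascal n k) ⟩
  ((n C k) ℕ.+ (n C suc k)) ℕ.+ suc n ℕ.* (n C k) ℕ.+ suc n ℕ.* (n C suc k)
    ≡⟨ solveℕ 3 (λ n a b → (a ⊕ b) ⊕ (numeral 1 ⊕ n) ⊗ a ⊕ (numeral 1 ⊕ n) ⊗ b
         ⊜ (numeral 2 ⊕ n) ⊗ (a ⊕ b)) ≡.refl n (n C k) (n C suc k) ⟩
  (2 ℕ.+ n) ℕ.* ((n C k) ℕ.+ (n C suc k))
    ≡⟨ ≡.cong ((2 ℕ.+ n) ℕ.*_) (pascal n k) ⟨
  (2 ℕ.+ n) ℕ.* A ∎
  where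
  open ≡.≡-Reasoning
  A = suc n C suc k
  B = suc n C suc (suc k)

-- The coefficient of X^(n-1) x^j in (1 - X)^(k-1) / ((1 - X)^k - x X^(k-c)).  At
-- n = 0 truncated subtraction gives the term of index -1 of the recurrence.
binomialCoefficient : (c k n j : ℕ) → ℕ
binomialCoefficient c k n j = (n ℕ.+ c ℕ.* j ∸ 1) C (k ℕ.* j)

-- For positive second index the upper argument before subtraction is a successor, so truncation is
-- harmless and the difference identities apply.
binomialCoefficient-suc : ∀ c k n j → binomialCoefficient (suc c) k n (suc j) ≡ (c ℕ.+ n ℕ.+ suc c ℕ.* j) C (k ℕ.+ k ℕ.* j)
binomialCoefficient-suc c k n j = ≡.cong₂ (λ a b → (a ∸ 1) C b)
  (solveℕ 3 (λ c n j → n ⊕ (numeral 1 ⊕ c) ⊗ (numeral 1 ⊕ j)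
     ⊜ numeral 1 ⊕ (c ⊕ n ⊕ (numeral 1 ⊕ c) ⊗ j)) ≡.refl c n j)
  (ℕₚ.*-suc k j)

binomialCoefficient-1-2 : ∀ n j → binomialCoefficient 1 2 (2 ℕ.+ n) (suc j) ℕ.+ binomialCoefficient 1 2 n (suc j)
  ≡ 2 ℕ.* binomialCoefficient 1 2 (1 ℕ.+ n) (suc j) ℕ.+ binomialCoefficient 1 2 (1 ℕ.+ n) j
binomialCoefficient-1-2 n j = ≡.trans
  (≡.cong₂ ℕ._+_ (binomialCoefficient-suc 0 2 (2 ℕ.+ n) j) (binomialCoefficient-suc 0 2 n j))
  (≡.trans (pascal² (n ℕ.+ 1 ℕ.* j) (2 ℕ.* j))
  (≡.cong (λ z → 2 ℕ.* z ℕ.+ ((n ℕ.+ 1 ℕ.* j) C (2 ℕ.* j))) (≡.sym (binomialCoefficient-suc 0 2 (1 ℕ.+ n) j))))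

-- The values c = 0 and c = 1 give the two cubic families. The hypothesis puts `m` outermost in the
-- upper index, which is the literal shape of `pascal³`.
binomialCoefficient-c-3 : ∀ c n j →
  (∀ m → binomialCoefficient (suc c) 3 (m ℕ.+ n) (suc j) ≡ (m ℕ.+ (c ℕ.+ n ℕ.+ suc c ℕ.* j)) C (3 ℕ.+ 3 ℕ.* j)) →
  binomialCoefficient (suc c) 3 (3 ℕ.+ n) (suc j) ℕ.+ 3 ℕ.* binomialCoefficient (suc c) 3 (1 ℕ.+ n) (suc j)
  ≡ 3 ℕ.* binomialCoefficient (suc c) 3 (2 ℕ.+ n) (suc j) ℕ.+ binomialCoefficient (suc c) 3 n (suc j)
    ℕ.+ binomialCoefficient (suc c) 3 (suc (c ℕ.+ n)) j
binomialCoefficient-c-3 c n j eq = ≡.trans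
  (≡.cong₂ (λ x y → x ℕ.+ 3 ℕ.* y) (eq 3) (eq 1))
  (≡.trans (pascal³ (c ℕ.+ n ℕ.+ suc c ℕ.* j) (3 ℕ.* j))
  (≡.cong₂ (λ x y → 3 ℕ.* x ℕ.+ y ℕ.+ ((c ℕ.+ n ℕ.+ suc c ℕ.* j) C (3 ℕ.* j))) (≡.sym (eq 2)) (≡.sym (eq 0))))

-- Linear recurrences for polynomials with binomial coefficients.

module BinomialRecurrence {a ℓ} (R : CommutativeRing a ℓ) where
  open CommutativeRing R hiding (zero)
  open import Algebra.Properties.Semiring.Mult semiring using (×-homo-+; ×1-homo-*) renaming (_×_ to _·_)
  open IntegerCoefficientSolver R
  open PowerSeries R
  open Polynomial R
  open ≈-Reasoning setoid

  ι : ℕ → Carrier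
  ι n = n · 1#

  -- evaluates definitionally to ι
  ⓘ : ∀ {m} → ℕ → SolverPolynomial m
  ⓘ zero    = con (+ 0)
  ⓘ (suc n) = con (+ 1) :+ ⓘ n

  𝟙 𝟚 𝟛 : ∀ {m} → SolverPolynomial m
  𝟙 = con (+ 1)
  𝟚 = ⓘ 2
  𝟛 = ⓘ 3

  ι-+ : ∀ m n → ι (m ℕ.+ n) ≈ ι m + ι n
  ι-+ = ×-homo-+ 1#

  ι-* : ∀ m n → ι (m ℕ.* n) ≈ ι m * ι n
  ι-* = ×1-homo-*

  binomials : (c k n : ℕ) → Series
  binomials c k n j = ι (binomialCoefficient c k n j)

  binomials-degree : ∀ c k n j → n ℕ.+ c ℕ.* j ℕ.≤ k ℕ.* j → 0 ℕ.< k ℕ.* j → binomials c k n j ≈ 0#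
  binomials-degree c k n j le 0<kj = reflexive (≡.cong ι (k>n⇒nCk≡0 {n ℕ.+ c ℕ.* j ∸ 1} {k ℕ.* j} (pred-< le 0<kj)))
    where
    pred-< : ∀ {m n} → m ℕ.≤ n → 0 ℕ.< n → m ∸ 1 ℕ.< n
    pred-< {zero}  _   0<n = 0<n
    pred-< {suc m} m<n _   = m<n

  -- The recurrences are asked for only below `L`, because for the truncated binomial polynomials
  -- they are established only while the degrees fit under the truncation bound.
  recurrence₂-unique : ∀ L {f g : ℕ → Carrier} p q →
    (∀ m → m ℕ.< L → f (2 ℕ.+ m) ≈ p * f (1 ℕ.+ m) - q * f m) →
    (∀ m → m ℕ.< L → g (2 ℕ.+ m) ≈ p * g (1 ℕ.+ m) - q * g m) →
    f 0 ≈ g 0 → f 1 ≈ g 1 → ∀ m → m ℕ.≤ L → f m ≈ g m × f (1 ℕ.+ m) ≈ g (1 ℕ.+ m)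
  recurrence₂-unique L p q f-rec g-rec eq₀ eq₁ zero    _ = eq₀ , eq₁
  recurrence₂-unique L p q f-rec g-rec eq₀ eq₁ (suc m) m<L
    with eqₘ , eqₘ₊₁ ← recurrence₂-unique L p q f-rec g-rec eq₀ eq₁ m (ℕₚ.<⇒≤ m<L) =
    eqₘ₊₁ , trans (f-rec m m<L) (trans (+-cong (*-congˡ eqₘ₊₁) (-‿cong (*-congˡ eqₘ))) (sym (g-rec m m<L)))

  recurrence₃-unique : ∀ L {f g : ℕ → Carrier} p q →
    (∀ m → m ℕ.< L → f (3 ℕ.+ m) ≈ p * f (2 ℕ.+ m) - q * f (1 ℕ.+ m) + f m) →
    (∀ m → m ℕ.< L → g (3 ℕ.+ m) ≈ p * g (2 ℕ.+ m) - q * g (1 ℕ.+ m) + g m) →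
    f 0 ≈ g 0 → f 1 ≈ g 1 → f 2 ≈ g 2 →
    ∀ m → m ℕ.≤ L → f m ≈ g m × f (1 ℕ.+ m) ≈ g (1 ℕ.+ m) × f (2 ℕ.+ m) ≈ g (2 ℕ.+ m)
  recurrence₃-unique L p q f-rec g-rec eq₀ eq₁ eq₂ zero    _ = eq₀ , eq₁ , eq₂
  recurrence₃-unique L p q f-rec g-rec eq₀ eq₁ eq₂ (suc m) m<L
    with eqₘ , eqₘ₊₁ , eqₘ₊₂ ← recurrence₃-unique L p q f-rec g-rec eq₀ eq₁ eq₂ m (ℕₚ.<⇒≤ m<L) =
    eqₘ₊₁ , eqₘ₊₂ , trans (f-rec m m<L)
      (trans (+-cong (+-cong (*-congˡ eqₘ₊₂) (-‿cong (*-congˡ eqₘ₊₁))) eqₘ) (sym (g-rec m m<L)))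

  eval-+ : ∀ B f g x → eval B (λ i → f i + g i) x ≈ eval B f x + eval B g x
  eval-+ B f g x = trans (eval-cong B x (λ i _ → +-congˡ (sym (*-identityˡ (g i)))))
    (trans (eval-linear B 1# f g x) (+-congˡ (*-identityˡ _)))

  eval-* : ∀ B a f x → eval B (λ i → a * f i) x ≈ a * eval B f x
  eval-* B a f x = trans (eval-cong B x (λ i _ → sym (+-identityˡ (a * f i))))
    (trans (eval-linear B a (λ _ → 0#) f x) (trans (+-congʳ (eval-zero B x (λ _ → refl))) (+-identityˡ _)))

  private
    solve-for : ∀ {x y z} → x + y ≈ z → x ≈ z - y
    solve-for {x} {y} eq = trans (solve 2 (λ x y → x := (x :+ y) :- y) refl x y) (+-congʳ eq)

  eval-difference₂ : ∀ B {f₀ f₁ f₂ s} x → s B ≈ 0# →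
    (∀ j → f₂ j + f₀ j ≈ ι 2 * f₁ j + shift s j) →
    eval (suc B) f₂ x ≈ ι 2 * eval (suc B) f₁ x + x * eval (suc B) s x - eval (suc B) f₀ x
  eval-difference₂ B {f₀} {f₁} {f₂} {s} x sB≈0 eq = solve-for (begin
    eval (suc B) f₂ x + eval (suc B) f₀ x             ≈⟨ eval-+ (suc B) f₂ f₀ x ⟨
    eval (suc B) (λ j → f₂ j + f₀ j) x                ≈⟨ eval-cong (suc B) x (λ j _ → eq j) ⟩
    eval (suc B) (λ j → ι 2 * f₁ j + shift s j) x     ≈⟨ eval-+ (suc B) (λ j → ι 2 * f₁ j) (shift s) x ⟩
    eval (suc B) (λ j → ι 2 * f₁ j) x + eval (suc B) (shift s) x
      ≈⟨ +-cong (eval-* (suc B) (ι 2) f₁ x) (eval-shift B s x sB≈0) ⟩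
    ι 2 * eval (suc B) f₁ x + x * eval (suc B) s x    ∎)

  eval-difference₃ : ∀ B {f₀ f₁ f₂ f₃ s} x → s B ≈ 0# →
    (∀ j → f₃ j + ι 3 * f₁ j ≈ ι 3 * f₂ j + f₀ j + shift s j) →
    eval (suc B) f₃ x ≈ ι 3 * eval (suc B) f₂ x + eval (suc B) f₀ x + x * eval (suc B) s x - ι 3 * eval (suc B) f₁ x
  eval-difference₃ B {f₀} {f₁} {f₂} {f₃} {s} x sB≈0 eq = solve-for (begin
    eval (suc B) f₃ x + ι 3 * eval (suc B) f₁ x              ≈⟨ eval-linear (suc B) (ι 3) f₃ f₁ x ⟨
    eval (suc B) (λ j → f₃ j + ι 3 * f₁ j) x                 ≈⟨ eval-cong (suc B) x (λ j _ → eq j) ⟩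
    eval (suc B) (λ j → ι 3 * f₂ j + f₀ j + shift s j) x     ≈⟨ eval-+ (suc B) (λ j → ι 3 * f₂ j + f₀ j) (shift s) x ⟩
    eval (suc B) (λ j → ι 3 * f₂ j + f₀ j) x + eval (suc B) (shift s) x
      ≈⟨ +-cong (trans (eval-+ (suc B) (λ j → ι 3 * f₂ j) f₀ x) (+-congʳ (eval-* (suc B) (ι 3) f₂ x))) (eval-shift B s x sB≈0) ⟩
    ι 3 * eval (suc B) f₂ x + eval (suc B) f₀ x + x * eval (suc B) s x ∎)

  binomials-1-2 : ∀ n j → binomials 1 2 (2 ℕ.+ n) j + binomials 1 2 n j
                          ≈ ι 2 * binomials 1 2 (1 ℕ.+ n) j + shift (binomials 1 2 (1 ℕ.+ n)) j
  binomials-1-2 n zero    = solve 0 (ⓘ 1 :+ ⓘ 1 := ⓘ 2 :* ⓘ 1 :+ con (+ 0)) refl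
  binomials-1-2 n (suc j) = begin
    ι (b 2) + ι (b 0)                                                 ≈⟨ ι-+ (b 2) (b 0) ⟨
    ι (b 2 ℕ.+ b 0)                                                   ≡⟨ ≡.cong ι (binomialCoefficient-1-2 n j) ⟩
    ι (2 ℕ.* b 1 ℕ.+ binomialCoefficient 1 2 (1 ℕ.+ n) j)             ≈⟨ ι-+ (2 ℕ.* b 1) _ ⟩
    ι (2 ℕ.* b 1) + binomials 1 2 (1 ℕ.+ n) j                         ≈⟨ +-congʳ (ι-* 2 (b 1)) ⟩
    ι 2 * ι (b 1) + binomials 1 2 (1 ℕ.+ n) j                         ∎
    where
    b : ℕ → ℕ
    b m = binomialCoefficient 1 2 (m ℕ.+ n) (suc j)

  binomials-c-3 : ∀ c →
    (∀ n j m → binomialCoefficient (suc c) 3 (m ℕ.+ n) (suc j) ≡ (m ℕ.+ (c ℕ.+ n ℕ.+ suc c ℕ.* j)) C (3 ℕ.+ 3 ℕ.* j)) →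
    ∀ n j → let f = λ m → binomials (suc c) 3 (m ℕ.+ n) in
    f 3 j + ι 3 * f 1 j ≈ ι 3 * f 2 j + f 0 j + shift (binomials (suc c) 3 (suc (c ℕ.+ n))) j
  binomials-c-3 c eq n zero = begin
    ι (b₀ 3) + ι 3 * ι (b₀ 1)                ≈⟨ +-cong (ι-b₀ 3) (*-congˡ (ι-b₀ 1)) ⟩
    1# + ι 3 * 1#
      ≈⟨ solve 1 (λ t → con (+ 1) :+ t :* con (+ 1) := t :* con (+ 1) :+ con (+ 1) :+ con (+ 0)) refl (ι 3) ⟩
    ι 3 * 1# + 1# + 0#                       ≈⟨ +-congʳ (+-cong (*-congˡ (ι-b₀ 2)) (ι-b₀ 0)) ⟨
    ι 3 * ι (b₀ 2) + ι (b₀ 0) + 0#           ∎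
    where
    b₀ : ℕ → ℕ
    b₀ m = binomialCoefficient (suc c) 3 (m ℕ.+ n) 0

    ι-b₀ : ∀ m → ι (b₀ m) ≈ 1#
    ι-b₀ m = +-identityʳ 1#
  binomials-c-3 c eq n (suc j) = begin
    ι (b 3) + ι 3 * ι (b 1)                  ≈⟨ +-congˡ (ι-* 3 (b 1)) ⟨
    ι (b 3) + ι (3 ℕ.* b 1)                  ≈⟨ ι-+ (b 3) (3 ℕ.* b 1) ⟨
    ι (b 3 ℕ.+ 3 ℕ.* b 1)                    ≡⟨ ≡.cong ι (binomialCoefficient-c-3 c n j (eq n j)) ⟩
    ι (3 ℕ.* b 2 ℕ.+ b 0 ℕ.+ s)              ≈⟨ ι-+ (3 ℕ.* b 2 ℕ.+ b 0) s ⟩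
    ι (3 ℕ.* b 2 ℕ.+ b 0) + ι s              ≈⟨ +-congʳ (ι-+ (3 ℕ.* b 2) (b 0)) ⟩
    ι (3 ℕ.* b 2) + ι (b 0) + ι s            ≈⟨ +-congʳ (+-congʳ (ι-* 3 (b 2))) ⟩
    ι 3 * ι (b 2) + ι (b 0) + ι s            ∎
    where
    b : ℕ → ℕ
    b m = binomialCoefficient (suc c) 3 (m ℕ.+ n) (suc j)

    s : ℕ
    s = binomialCoefficient (suc c) 3 (suc (c ℕ.+ n)) j

  module _ (x : Carrier) where
    private
      degree : ∀ c k B n → suc n ℕ.≤ B → binomials c (suc (c ℕ.+ k)) n B ≈ 0#
      degree c k B n n<B = binomials-degree c (suc (c ℕ.+ k)) n B
        (ℕₚ.+-mono-≤ (ℕₚ.<⇒≤ n<B) (ℕₚ.*-monoˡ-≤ B (ℕₚ.m≤m+n c k)))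
        (ℕₚ.≤-trans (ℕₚ.≤-trans (ℕ.s≤s ℕ.z≤n) n<B) (ℕₚ.m≤m+n B ((c ℕ.+ k) ℕ.* B)))

    recurrence-1-2 : ∀ B n → 2 ℕ.+ n ℕ.≤ B → let E = λ m → eval (suc B) (binomials 1 2 m) x in
      E (2 ℕ.+ n) ≈ (ι 2 + x) * E (1 ℕ.+ n) - E n
    recurrence-1-2 B n n+2≤B = trans
      (eval-difference₂ B x (degree 1 0 B (1 ℕ.+ n) n+2≤B) (binomials-1-2 n))
      (+-congʳ (sym (distribʳ _ _ _)))

    recurrence-1-3 : ∀ B n → 2 ℕ.+ n ℕ.≤ B → let E = λ m → eval (suc B) (binomials 1 3 m) x in
      E (3 ℕ.+ n) ≈ ι 3 * E (2 ℕ.+ n) - (ι 3 - x) * E (1 ℕ.+ n) + E n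
    recurrence-1-3 B n n+2≤B = trans
      (eval-difference₃ B x (degree 1 1 B (1 ℕ.+ n) n+2≤B)
        (binomials-c-3 0 (λ n j m → ≡.trans (binomialCoefficient-suc 0 3 (m ℕ.+ n) j) (≡.cong (_C (3 ℕ.+ 3 ℕ.* j)) (ℕₚ.+-assoc m n (1 ℕ.* j)))) n))
      (solve 5 (λ t x a b c → t :* a :+ c :+ x :* b :- t :* b := t :* a :- (t :- x) :* b :+ c) refl (ι 3) x _ _ _)

    recurrence-2-3 : ∀ B n → 3 ℕ.+ n ℕ.≤ B → let E = λ m → eval (suc B) (binomials 2 3 m) x in
      E (3 ℕ.+ n) ≈ (ι 3 + x) * E (2 ℕ.+ n) - ι 3 * E (1 ℕ.+ n) + E n
    recurrence-2-3 B n n+3≤B = trans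
      (eval-difference₃ B x (degree 2 0 B (2 ℕ.+ n) n+3≤B)
        (binomials-c-3 1 (λ n j m → ≡.trans (binomialCoefficient-suc 1 3 (m ℕ.+ n) j)
          (≡.cong (_C (3 ℕ.+ 3 ℕ.* j)) (solveℕ 3 (λ m n j → numeral 1 ⊕ (m ⊕ n) ⊕ j
             ⊜ m ⊕ (numeral 1 ⊕ n ⊕ j)) ≡.refl m n (2 ℕ.* j)))) n))
      (solve 5 (λ t x a b c → t :* a :+ c :+ x :* a :- t :* b := (t :+ x) :* a :- t :* b :+ c) refl (ι 3) x _ _ _)

-- Power sums of the roots of the quadratics and cubics.

module PowerSums {a ℓ} (R : CommutativeRing a ℓ) where
  open CommutativeRing R hiding (zero)
  open import Algebra.Properties.Semiring.Exp semiring using (_^_)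
  open IntegerCoefficientSolver R
  open PowerSeries R
  open Polynomial R
  open BinomialRecurrence R
  open ≈-Reasoning setoid

  ≈-both : ∀ {x₁ x₂ y₁ y₂} → x₁ ≈ y₁ → x₂ ≈ y₂ → x₁ ≈ x₂ → y₁ ≈ y₂
  ≈-both e₁ e₂ e = trans (sym e₁) (trans e e₂)

  eval-constant : ∀ B f x → (∀ i → f (suc i) ≈ 0#) → eval (suc B) f x ≈ f 0
  eval-constant B f x eq = trans (+-congˡ (trans (*-congˡ (eval-zero B x eq)) (zeroʳ x))) (+-identityʳ _)

  binomials-0 : ∀ c k n → binomials c k n 0 ≈ 1#
  binomials-0 c k n rewrite ℕₚ.*-zeroʳ k = +-identityʳ 1#

  module _ (B : ℕ) (x : Carrier) where
    private
      E : (c k n : ℕ) → Carrier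
      E c k n = eval (suc B) (binomials c k n) x

    eval-binomials-1 : ∀ c k n → (∀ j → n ℕ.+ c ℕ.* suc j ℕ.≤ suc k ℕ.* suc j) → E c (suc k) n ≈ 1#
    eval-binomials-1 c k n le = trans
      (eval-constant B (binomials c (suc k) n) x λ j → binomials-degree c (suc k) n (suc j) (le j) (ℕ.s≤s ℕ.z≤n))
      (binomials-0 c (suc k) n)

    E-1-2 : ∀ n → n ℕ.≤ 1 → E 1 2 n ≈ 1#
    E-1-2 n n≤1 = eval-binomials-1 1 1 n λ j → ℕₚ.+-monoˡ-≤ (1 ℕ.* suc j) (ℕₚ.≤-trans n≤1 (ℕ.s≤s ℕ.z≤n))

    E-1-3 : ∀ n → n ℕ.≤ 2 → E 1 3 n ≈ 1#
    E-1-3 n n≤2 = eval-binomials-1 1 2 n λ j → ℕₚ.≤-trans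
      (ℕₚ.+-mono-≤ (ℕₚ.≤-trans n≤2 (ℕₚ.*-monoʳ-≤ 2 {1} {suc j} (ℕ.s≤s ℕ.z≤n))) ℕₚ.≤-refl)
      (ℕₚ.≤-reflexive (≡.sym (ℕₚ.*-distribʳ-+ (suc j) 2 1)))

    E-2-3 : ∀ n → n ℕ.≤ 1 → E 2 3 n ≈ 1#
    E-2-3 n n≤1 = eval-binomials-1 2 2 n λ j → ℕₚ.+-monoˡ-≤ (2 ℕ.* suc j) (ℕₚ.≤-trans n≤1 (ℕ.s≤s ℕ.z≤n))

    E-2-3-2 : 1 ℕ.≤ B → E 2 3 2 ≈ 1# + x
    E-2-3-2 (ℕ.s≤s {n = B′} _) = trans
      (+-cong (+-identityʳ 1#) (*-congˡ (trans
        (eval-constant B′ (tail (binomials 2 3 2)) x λ j → binomials-degree 2 3 2 (2 ℕ.+ j) (le j) (ℕ.s≤s ℕ.z≤n))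
        (+-identityʳ 1#))))
      (+-congˡ (*-identityʳ x))
      where
      le : ∀ j → 2 ℕ.+ 2 ℕ.* (2 ℕ.+ j) ℕ.≤ 3 ℕ.* (2 ℕ.+ j)
      le j = ℕₚ.+-monoˡ-≤ (2 ℕ.* (2 ℕ.+ j)) (ℕₚ.m≤m+n 2 j)

    -- Two initial values decide, as both sides obey the recurrence of α and β. The right-hand side
    -- is the case k = 2, c = 1 of (k - c) E_(n+1) + c E_n, which the logarithmic derivative of (1 -
    -- X)^k - x X^(k-c) = ∏ (1 - α X) produces when E_0 = 1.
    powerSum-1-2 : ∀ α β → α * β ≈ 1# → α + β ≈ ι 2 + x → ∀ n → 3 ℕ.+ n ℕ.≤ B →
      α ^ n + β ^ n ≈ E 1 2 (1 ℕ.+ n) + E 1 2 n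
    powerSum-1-2 α β αβ≈1 α+β≈ n 3+n≤B = proj₁ (recurrence₂-unique n (ι 2 + x) 1#
      (λ m m<n → begin
        α * (α * α ^ m) + β * (β * β ^ m)
          ≈⟨ solve 4 (λ a b u v → a :* (a :* u) :+ b :* (b :* v) := (a :+ b) :* (a :* u :+ b :* v) :- (a :* b) :* (u :+ v)) refl α β (α ^ m) (β ^ m) ⟩
        (α + β) * (α * α ^ m + β * β ^ m) - (α * β) * (α ^ m + β ^ m)
          ≈⟨ +-cong (*-congʳ α+β≈) (-‿cong (*-congʳ αβ≈1)) ⟩
        (ι 2 + x) * (α * α ^ m + β * β ^ m) - 1# * (α ^ m + β ^ m) ∎)
      (λ m m<n → trans
        (+-cong (recurrence-1-2 x B (1 ℕ.+ m) (ℕₚ.≤-trans (ℕ.s≤s (ℕ.s≤s (ℕₚ.m≤n⇒m≤1+n m<n))) 3+n≤B))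
                (recurrence-1-2 x B m (ℕₚ.≤-trans (ℕₚ.+-monoʳ-≤ 2 (ℕₚ.m≤n⇒m≤1+n (ℕₚ.<⇒≤ m<n))) 3+n≤B)))
        (solve 4 (λ p s t u → (p :* s :- t) :+ (p :* t :- u) := p :* (s :+ t) :- 𝟙 :* (t :+ u)) refl (ι 2 + x) _ _ _))
      (sym (+-cong (E-1-2 1 ℕₚ.≤-refl) (E-1-2 0 ℕ.z≤n)))
      (begin
        α * 1# + β * 1#                ≈⟨ +-cong (*-identityʳ α) (*-identityʳ β) ⟩
        α + β                          ≈⟨ α+β≈ ⟩
        ι 2 + x                        ≈⟨ solve 1 (λ x → 𝟚 :+ x := ((𝟚 :+ x) :* 𝟙 :- 𝟙) :+ 𝟙) refl x ⟩
        ((ι 2 + x) * 1# - 1#) + 1#     ≈⟨ +-cong (+-cong (*-congˡ (E-1-2 1 ℕₚ.≤-refl)) (-‿cong (E-1-2 0 ℕ.z≤n))) (E-1-2 1 ℕₚ.≤-refl) ⟨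
        ((ι 2 + x) * E 1 2 1 - E 1 2 0) + E 1 2 1
          ≈⟨ +-congʳ (recurrence-1-2 x B 0 (ℕₚ.≤-trans (ℕₚ.m≤n⇒m≤1+n (ℕₚ.m≤m+n 2 n)) 3+n≤B)) ⟨
        E 1 2 2 + E 1 2 1              ∎)
      n ℕₚ.≤-refl)

  module _ {α β γ p q : Carrier}
           (e₁ : α + β + γ ≈ p) (e₂ : α * β + β * γ + γ * α ≈ q) (e₃ : α * β * γ ≈ 1#) where
    powerSum : ℕ → Carrier
    powerSum m = α ^ m + β ^ m + γ ^ m

    powerSum-recurrence : ∀ m → powerSum (3 ℕ.+ m) ≈ p * powerSum (2 ℕ.+ m) - q * powerSum (1 ℕ.+ m) + powerSum m
    powerSum-recurrence m = begin
      powerSum (3 ℕ.+ m)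
        ≈⟨ solve 6 (λ a b c u v w →
             a :* (a :* (a :* u)) :+ b :* (b :* (b :* v)) :+ c :* (c :* (c :* w)) :=
             (a :+ b :+ c) :* (a :* (a :* u) :+ b :* (b :* v) :+ c :* (c :* w))
             :- (a :* b :+ b :* c :+ c :* a) :* (a :* u :+ b :* v :+ c :* w) :+ (a :* b :* c) :* (u :+ v :+ w))
             refl α β γ (α ^ m) (β ^ m) (γ ^ m) ⟩
      (α + β + γ) * powerSum (2 ℕ.+ m) - (α * β + β * γ + γ * α) * powerSum (1 ℕ.+ m) + (α * β * γ) * powerSum m
        ≈⟨ +-cong (+-cong (*-congʳ e₁) (-‿cong (*-congʳ e₂))) (trans (*-congʳ e₃) (*-identityˡ _)) ⟩
      p * powerSum (2 ℕ.+ m) - q * powerSum (1 ℕ.+ m) + powerSum m ∎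

    powerSum-1 : powerSum 1 ≈ p
    powerSum-1 = trans (+-cong (+-cong (*-identityʳ α) (*-identityʳ β)) (*-identityʳ γ)) e₁

    powerSum-2 : powerSum 2 ≈ p * p - ι 2 * q
    powerSum-2 = begin
      powerSum 2
        ≈⟨ solve 3 (λ a b c → a :* (a :* 𝟙) :+ b :* (b :* 𝟙) :+ c :* (c :* 𝟙) :=
             (a :+ b :+ c) :* (a :+ b :+ c) :- 𝟚 :* (a :* b :+ b :* c :+ c :* a)) refl α β γ ⟩
      (α + β + γ) * (α + β + γ) - ι 2 * (α * β + β * γ + γ * α)
        ≈⟨ +-cong (*-cong e₁ e₁) (-‿cong (*-congˡ e₂)) ⟩
      p * p - ι 2 * q ∎

  module _ (B : ℕ) (x : Carrier) {α β γ : Carrier} where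
    private
      E : (c n : ℕ) → Carrier
      E c n = eval (suc B) (binomials c 3 n) x

    -- The case k = 3, c = 1 of (k - c) E_(n+1) + c E_n. These symmetric functions are those of the
    -- pairwise products of the original roots.
    powerSum-1-3 : (e₁ : α + β + γ ≈ ι 3) (e₂ : α * β + β * γ + γ * α ≈ ι 3 - x) (e₃ : α * β * γ ≈ 1#) →
      ∀ n → 3 ℕ.+ n ℕ.≤ B → powerSum e₁ e₂ e₃ n ≈ ι 2 * E 1 (1 ℕ.+ n) + E 1 n
    powerSum-1-3 e₁ e₂ e₃ n 3+n≤B = proj₁ (recurrence₃-unique n (ι 3) (ι 3 - x)
      (λ m _ → powerSum-recurrence e₁ e₂ e₃ m)
      (λ m m<n → trans
        (+-cong (*-congˡ (recurrence-1-3 x B (1 ℕ.+ m) (ℕₚ.≤-trans (ℕ.s≤s (ℕ.s≤s (ℕₚ.m≤n⇒m≤1+n m<n))) 3+n≤B)))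
                (recurrence-1-3 x B m (ℕₚ.≤-trans (ℕₚ.+-monoʳ-≤ 2 (ℕₚ.m≤n⇒m≤1+n (ℕₚ.<⇒≤ m<n))) 3+n≤B)))
        (solve 6 (λ p q s t u v → 𝟚 :* (p :* s :- q :* t :+ u) :+ (p :* t :- q :* u :+ v) :=
           p :* (𝟚 :* s :+ t) :- q :* (𝟚 :* t :+ u) :+ (𝟚 :* u :+ v)) refl (ι 3) (ι 3 - x) _ _ _ _))
      (≈-both refl (sym (+-cong (*-congˡ (E-1-3 B x 1 (ℕ.s≤s ℕ.z≤n))) (E-1-3 B x 0 ℕ.z≤n)))
        (solve 0 (𝟙 :+ 𝟙 :+ 𝟙 := 𝟚 :* 𝟙 :+ 𝟙) refl))
      (≈-both (sym (powerSum-1 e₁ e₂ e₃)) (sym (+-cong (*-congˡ (E-1-3 B x 2 ℕₚ.≤-refl)) (E-1-3 B x 1 (ℕ.s≤s ℕ.z≤n))))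
        (solve 0 (𝟛 := 𝟚 :* 𝟙 :+ 𝟙) refl))
      (≈-both (sym (powerSum-2 e₁ e₂ e₃)) (sym (+-cong (*-congˡ E3) (E-1-3 B x 2 ℕₚ.≤-refl)))
        (solve 1 (λ x → 𝟛 :* 𝟛 :- 𝟚 :* (𝟛 :- x) := 𝟚 :* (𝟛 :* 𝟙 :- (𝟛 :- x) :* 𝟙 :+ 𝟙) :+ 𝟙) refl x))
      n ℕₚ.≤-refl)
      where
      E3 : E 1 3 ≈ ι 3 * 1# - (ι 3 - x) * 1# + 1#
      E3 = trans (recurrence-1-3 x B 0 (ℕₚ.≤-trans (ℕₚ.m≤n⇒m≤1+n (ℕₚ.m≤m+n 2 n)) 3+n≤B))
        (+-cong (+-cong (*-congˡ (E-1-3 B x 2 ℕₚ.≤-refl)) (-‿cong (*-congˡ (E-1-3 B x 1 (ℕ.s≤s ℕ.z≤n))))) (E-1-3 B x 0 ℕ.z≤n))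

    -- The case k = 3, c = 2 of (k - c) E_(n+1) + c E_n. It is meant for the original roots, with -
    -- x in the place of x.
    powerSum-2-3 : (e₁ : α + β + γ ≈ ι 3 + x) (e₂ : α * β + β * γ + γ * α ≈ ι 3) (e₃ : α * β * γ ≈ 1#) →
      ∀ n → 3 ℕ.+ n ℕ.≤ B → powerSum e₁ e₂ e₃ n ≈ E 2 (1 ℕ.+ n) + ι 2 * E 2 n
    powerSum-2-3 e₁ e₂ e₃ n 3+n≤B = proj₁ (recurrence₃-unique n (ι 3 + x) (ι 3)
      (λ m _ → powerSum-recurrence e₁ e₂ e₃ m)
      (λ m m<n → trans
        (+-cong (recurrence-2-3 x B (1 ℕ.+ m) (ℕₚ.≤-trans (ℕₚ.+-monoʳ-≤ 3 m<n) 3+n≤B))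
                (*-congˡ (recurrence-2-3 x B m (ℕₚ.≤-trans (ℕₚ.+-monoʳ-≤ 3 (ℕₚ.<⇒≤ m<n)) 3+n≤B))))
        (solve 6 (λ p q s t u v → (p :* s :- q :* t :+ u) :+ 𝟚 :* (p :* t :- q :* u :+ v) :=
           p :* (s :+ 𝟚 :* t) :- q :* (t :+ 𝟚 :* u) :+ (u :+ 𝟚 :* v)) refl (ι 3 + x) (ι 3) _ _ _ _))
      (≈-both refl (sym (+-cong E1 (*-congˡ E0))) (solve 0 (𝟙 :+ 𝟙 :+ 𝟙 := 𝟙 :+ 𝟚 :* 𝟙) refl))
      (≈-both (sym (powerSum-1 e₁ e₂ e₃)) (sym (+-cong E2 (*-congˡ E1)))
        (solve 1 (λ x → 𝟛 :+ x := (𝟙 :+ x) :+ 𝟚 :* 𝟙) refl x))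
      (≈-both (sym (powerSum-2 e₁ e₂ e₃)) (sym (+-cong E3 (*-congˡ E2)))
        (solve 1 (λ x → (𝟛 :+ x) :* (𝟛 :+ x) :- 𝟚 :* 𝟛 :=
          ((𝟛 :+ x) :* (𝟙 :+ x) :- 𝟛 :* 𝟙 :+ 𝟙) :+ 𝟚 :* (𝟙 :+ x)) refl x))
      n ℕₚ.≤-refl)
      where
      E0 = E-2-3 B x 0 ℕ.z≤n
      E1 = E-2-3 B x 1 ℕₚ.≤-refl
      E2 = E-2-3-2 B x (ℕₚ.≤-trans (ℕ.s≤s ℕ.z≤n) 3+n≤B)

      E3 : E 2 3 ≈ (ι 3 + x) * (1# + x) - ι 3 * 1# + 1#
      E3 = trans (recurrence-2-3 x B 0 (ℕₚ.≤-trans (ℕₚ.m≤m+n 3 n) 3+n≤B))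
        (+-cong (+-cong (*-congˡ E2) (-‿cong (*-congˡ E1))) E0)

  eval-binomial-theorem : ∀ n B x → n ℕ.≤ B → eval (suc B) (λ j → ι (n C j)) x ≈ (1# + x) ^ n
  eval-binomial-theorem zero    B x _   = trans (eval-cong (suc B) x (λ i _ → ι[0Ci] i)) (eval-δ B x)
    where
    ι[0Ci] : ∀ i → ι (0 C i) ≈ δ i
    ι[0Ci] zero    = +-identityʳ 1#
    ι[0Ci] (suc i) = refl
  eval-binomial-theorem (suc n) B x n<B = begin
    eval (suc B) (λ j → ι (suc n C j)) x
      ≈⟨ eval-cong (suc B) x (λ j _ → step j) ⟩
    eval (suc B) (λ j → ι (n C j) + shift (λ j → ι (n C j)) j) x
      ≈⟨ eval-+ (suc B) (λ j → ι (n C j)) (shift (λ j → ι (n C j))) x ⟩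
    F + eval (suc B) (shift (λ j → ι (n C j))) x
      ≈⟨ +-congˡ (eval-shift B (λ j → ι (n C j)) x (reflexive (≡.cong ι (k>n⇒nCk≡0 n<B)))) ⟩
    F + x * F
      ≈⟨ solve 2 (λ F x → F :+ x :* F := (𝟙 :+ x) :* F) refl F x ⟩
    (1# + x) * F
      ≈⟨ *-congˡ (eval-binomial-theorem n B x (ℕₚ.<⇒≤ n<B)) ⟩
    (1# + x) ^ suc n ∎
    where
    F : Carrier
    F = eval (suc B) (λ j → ι (n C j)) x

    step : ∀ j → ι (suc n C j) ≈ ι (n C j) + shift (λ j → ι (n C j)) j
    step zero    = sym (+-identityʳ _)
    step (suc j) = trans (reflexive (≡.cong ι (pascal n j))) (trans (ι-+ (n C j) (n C suc j)) (+-comm _ _))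

-- By Pascal the bracket is (a + b) X - b Z. Multiplied by s, the first term is (k + 1) X = (m + 1)
-- Z by absorption, and (m + 1) Z - b s Z = n Z. In ℕ the subtracted term is added to both sides and
-- cancelled.
weighted-absorption : ∀ a b s n k m → suc m ≡ n ℕ.+ b ℕ.* s → suc k ≡ (a ℕ.+ b) ℕ.* s →
  s ℕ.* (a ℕ.* (suc m C suc k) ℕ.+ b ℕ.* (m C suc k)) ≡ n ℕ.* (m C k)
weighted-absorption a b s n k m m≡ k≡ = ℕₚ.+-cancelʳ-≡ (b ℕ.* s ℕ.* Z) _ _ (begin
  s ℕ.* (a ℕ.* X ℕ.+ b ℕ.* Y) ℕ.+ b ℕ.* s ℕ.* Z
    ≡⟨ ≡.cong (λ x → s ℕ.* (a ℕ.* x ℕ.+ b ℕ.* Y) ℕ.+ b ℕ.* s ℕ.* Z) (pascal m k) ⟩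
  s ℕ.* (a ℕ.* (Z ℕ.+ Y) ℕ.+ b ℕ.* Y) ℕ.+ b ℕ.* s ℕ.* Z
    ≡⟨ solveℕ 5 (λ a b s y z →
         s ⊗ (a ⊗ (z ⊕ y) ⊕ b ⊗ y) ⊕ b ⊗ s ⊗ z
         ⊜ (a ⊕ b) ⊗ s ⊗ (z ⊕ y)) ≡.refl a b s Y Z ⟩
  (a ℕ.+ b) ℕ.* s ℕ.* (Z ℕ.+ Y)
    ≡⟨ ≡.cong₂ ℕ._*_ k≡ (pascal m k) ⟨
  suc k ℕ.* X
    ≡⟨ absorption m k ⟩
  suc m ℕ.* Z
    ≡⟨ ≡.cong (ℕ._* Z) m≡ ⟩
  (n ℕ.+ b ℕ.* s) ℕ.* Z
    ≡⟨ ℕₚ.*-distribʳ-+ Z n (b ℕ.* s) ⟩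
  n ℕ.* Z ℕ.+ b ℕ.* s ℕ.* Z ∎)
  where
  open ≡.≡-Reasoning
  X = suc m C suc k
  Y = m C suc k
  Z = m C k

-- Points of the base ring at which the roots are rational.

module Coefficients {a ℓ} (R : CommutativeRing a ℓ) where
  open CommutativeRing R hiding (zero)
  open import Algebra.Properties.Semiring.Exp semiring using (_^_)
  open IntegerCoefficientSolver R
  open PowerSeries R
  open Polynomial R
  open BinomialRecurrence R
  open PowerSums R
  open ≈-Reasoning setoid

  eval-rescale : ∀ B f u x → eval B f (u * x) ≈ eval B (rescale u f) x
  eval-rescale zero    f u x = refl
  eval-rescale (suc B) f u x = +-cong (sym (*-identityʳ _)) (begin
    u * x * eval B (tail f) (u * x)            ≈⟨ *-congˡ (eval-rescale B (tail f) u x) ⟩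
    u * x * eval B (rescale u (tail f)) x
      ≈⟨ solve 3 (λ u x e → u :* x :* e := x :* (u :* e)) refl u x _ ⟩
    x * (u * eval B (rescale u (tail f)) x)    ≈⟨ *-congˡ (eval-* B u (rescale u (tail f)) x) ⟨
    x * eval B (λ i → u * rescale u (tail f) i) x
      ≈⟨ *-congˡ (eval-cong B x (λ i _ → solve 3 (λ u f v → u :* (f :* v) := f :* (u :* v)) refl u (f (suc i)) (u ^ i))) ⟩
    x * eval B (tail (rescale u f)) x ∎)

  module _ (ρ : ℕ → Carrier) (ρ-inverse : ∀ m → ι (suc m) * ρ m ≈ 1#) where
    private
      ι-regular : ∀ m → Regular (ι (suc m))
      ι-regular m = unit⇒regular (ρ-inverse m)

      ρ-regular : ∀ m → Regular (ρ m)
      ρ-regular m = unit⇒regular (trans (*-comm _ _) (ρ-inverse m))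

    module Points₁ where
      x : ℕ → Carrier
      x = ι

      differences : ∀ B → RegularDifferences B x
      differences B {i} i<j _ with d , ≡.refl ← ℕₚ.m≤n⇒∃[o]m+o≡n i<j =
        regular-resp (begin
          - ι (suc d)                  ≈⟨ solve 2 (λ i d → :- d := i :- (i :+ d)) refl (ι i) (ι (suc d)) ⟩
          ι i - (ι i + ι (suc d))      ≈⟨ +-congˡ (-‿cong (ι-+ i (suc d))) ⟨
          ι i - ι (i ℕ.+ suc d)        ≡⟨ ≡.cong (λ k → ι i - ι k) (ℕₚ.+-suc i d) ⟩
          ι i - ι (suc i ℕ.+ d)        ∎)
        (regular-neg (ι-regular d))

    module Points₂ where
      α β x : ℕ → Carrier
      α i = ι (2 ℕ.+ i)
      β i = ρ (1 ℕ.+ i)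
      x i = α i + β i - ι 2

      αβ≈1 : ∀ i → α i * β i ≈ 1#
      αβ≈1 i = ρ-inverse (1 ℕ.+ i)

      α+β≈2+x : ∀ i → α i + β i ≈ ι 2 + x i
      α+β≈2+x i = solve 3 (λ a b t → a :+ b := t :+ (a :+ b :- t)) refl (α i) (β i) (ι 2)

      -- As β = 1 / α, the difference of two values is (α - α′)(αα′ - 1) / (αα′), and αα′ - 1 is a
      -- positive integer.
      differences : ∀ B → RegularDifferences B x
      differences B {i} i<j _ with d , ≡.refl ← ℕₚ.m≤n⇒∃[o]m+o≡n i<j =
        regular-resp eq
          (regular-neg (regular-* (ι-regular d) (regular-* (regular-* (ρ-regular (1 ℕ.+ i)) (ρ-regular (1 ℕ.+ j))) (ι-regular M))))
        where
        j = suc i ℕ.+ d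
        -- Chosen so that (2 + i)(2 + j) = 2 + M, that is, αα′ - 1 = M + 1.
        M = suc (i ℕ.+ d) ℕ.+ (1 ℕ.+ i) ℕ.* (2 ℕ.+ j)

        αα′ : α i * α j ≈ 1# + ι (suc M)
        αα′ = trans (sym (ι-* (2 ℕ.+ i) (2 ℕ.+ j))) (reflexive (≡.cong ι
          (solveℕ 2 (λ i d →
             (numeral 2 ⊕ i) ⊗ (numeral 2 ⊕ (numeral 1 ⊕ i ⊕ d))
             ⊜ numeral 2 ⊕ (numeral 1 ⊕ (i ⊕ d)
                ⊕ (numeral 1 ⊕ i) ⊗ (numeral 2 ⊕ (numeral 1 ⊕ i ⊕ d)))) ≡.refl i d)))

        α-diff : α j ≈ α i + ι (suc d)
        α-diff = trans (reflexive (≡.cong ι (≡.sym (ℕₚ.+-suc (2 ℕ.+ i) d)))) (ι-+ (2 ℕ.+ i) (suc d))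

        eq : - (ι (suc d) * (β i * β j * ι (suc M))) ≈ x i - x j
        eq = begin
          - (ι (suc d) * (β i * β j * ι (suc M)))
            ≈⟨ solve 4 (λ D b b′ m → :- (D :* (b :* b′ :* m)) := :- (D :* (b :* b′ :* ((𝟙 :+ m) :- 𝟙)))) refl (ι (suc d)) (β i) (β j) (ι (suc M)) ⟩
          - (ι (suc d) * (β i * β j * ((1# + ι (suc M)) - 1#)))
            ≈⟨ -‿cong (*-cong D≈ (*-congˡ (+-congʳ (sym αα′)))) ⟩
          - ((α j - α i) * (β i * β j * (α i * α j - 1#)))
            ≈⟨ solve 4 (λ a a′ b b′ → :- ((a′ :- a) :* (b :* b′ :* (a :* a′ :- 𝟙))) :=
                 :- ((a′ :- a) :* ((a :* b) :* (a′ :* b′)) :- (a′ :* b′) :* b :+ (a :* b) :* b′)) refl (α i) (α j) (β i) (β j) ⟩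
          - ((α j - α i) * ((α i * β i) * (α j * β j)) - (α j * β j) * β i + (α i * β i) * β j)
            ≈⟨ -‿cong (+-cong (+-cong (*-congˡ (*-cong (αβ≈1 i) (αβ≈1 j))) (-‿cong (*-congʳ (αβ≈1 j)))) (*-congʳ (αβ≈1 i))) ⟩
          - ((α j - α i) * (1# * 1#) - 1# * β i + 1# * β j)
            ≈⟨ solve 5 (λ a a′ b b′ t → :- ((a′ :- a) :* (𝟙 :* 𝟙) :- 𝟙 :* b :+ 𝟙 :* b′) := (a :+ b :- t) :- (a′ :+ b′ :- t))
                 refl (α i) (α j) (β i) (β j) (ι 2) ⟩
          x i - x j ∎
          where
          D≈ : ι (suc d) ≈ α j - α i
          D≈ = trans (solve 2 (λ a D → D := (a :+ D) :- a) refl (α i) (ι (suc d))) (+-congʳ (sym α-diff))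

    -- The curve α + β + γ = 3 - x, αβ + βγ + γα = 3, αβγ = 1 is rational: with
    -- s = i + 1, σ = 1 / s and τ = 1 / (s + 1), the roots are - s (s + 1),
    -- - (s + 1) / s² and s / (s + 1)².
    module Points₃ where
      s σ τ w ω α β γ x : ℕ → Carrier
      s i = ι (1 ℕ.+ i)
      σ i = ρ i
      τ i = ρ (1 ℕ.+ i)
      w i = s i * (1# + s i)
      ω i = σ i * τ i
      α i = - w i
      β i = - (σ i + σ i * σ i)
      γ i = τ i - τ i * τ i
      x i = ι 3 - (α i + β i + γ i)

      sσ≈1 : ∀ i → s i * σ i ≈ 1#
      sσ≈1 = ρ-inverse

      [1+s]τ≈1 : ∀ i → (1# + s i) * τ i ≈ 1#
      [1+s]τ≈1 i = ρ-inverse (1 ℕ.+ i)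

      ω≈σ-τ : ∀ i → ω i ≈ σ i - τ i
      ω≈σ-τ i = begin
        σ i * τ i   ≈⟨ solve 3 (λ s σ τ → σ :* τ := σ :* ((𝟙 :+ s) :* τ) :- τ :* (s :* σ)) refl (s i) (σ i) (τ i) ⟩
        σ i * ((1# + s i) * τ i) - τ i * (s i * σ i)   ≈⟨ +-cong (*-congˡ ([1+s]τ≈1 i)) (-‿cong (*-congˡ (sσ≈1 i))) ⟩
        σ i * 1# - τ i * 1#   ≈⟨ solve 2 (λ σ τ → σ :* 𝟙 :- τ :* 𝟙 := σ :- τ) refl (σ i) (τ i) ⟩
        σ i - τ i ∎

      wω≈1 : ∀ i → w i * ω i ≈ 1#
      wω≈1 i = begin
        w i * ω i                           ≈⟨ solve 3 (λ s σ τ → s :* (𝟙 :+ s) :* (σ :* τ) := (s :* σ) :* ((𝟙 :+ s) :* τ)) refl (s i) (σ i) (τ i) ⟩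
        (s i * σ i) * ((1# + s i) * τ i)    ≈⟨ *-cong (sσ≈1 i) ([1+s]τ≈1 i) ⟩
        1# * 1#                             ≈⟨ *-identityˡ 1# ⟩
        1#                                  ∎

      s[σ+σ²] : ∀ i → s i * (σ i + σ i * σ i) ≈ 1# + σ i
      s[σ+σ²] i = begin
        s i * (σ i + σ i * σ i)       ≈⟨ solve 2 (λ s σ → s :* (σ :+ σ :* σ) := (s :* σ) :* (𝟙 :+ σ)) refl (s i) (σ i) ⟩
        (s i * σ i) * (1# + σ i)      ≈⟨ *-congʳ (sσ≈1 i) ⟩
        1# * (1# + σ i)               ≈⟨ *-identityˡ _ ⟩
        1# + σ i                      ∎

      [1+s][τ-τ²] : ∀ i → (1# + s i) * (τ i - τ i * τ i) ≈ 1# - τ i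
      [1+s][τ-τ²] i = begin
        (1# + s i) * (τ i - τ i * τ i)      ≈⟨ solve 2 (λ s τ → (𝟙 :+ s) :* (τ :- τ :* τ) := ((𝟙 :+ s) :* τ) :* (𝟙 :- τ)) refl (s i) (τ i) ⟩
        ((1# + s i) * τ i) * (1# - τ i)     ≈⟨ *-congʳ ([1+s]τ≈1 i) ⟩
        1# * (1# - τ i)                     ≈⟨ *-identityˡ _ ⟩
        1# - τ i                            ∎

      [1+σ][1-τ]≈1 : ∀ i → (1# + σ i) * (1# - τ i) ≈ 1#
      [1+σ][1-τ]≈1 i = begin
        (1# + σ i) * (1# - τ i)             ≈⟨ solve 2 (λ σ τ → (𝟙 :+ σ) :* (𝟙 :- τ) := 𝟙 :+ (σ :- τ) :- σ :* τ) refl (σ i) (τ i) ⟩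
        1# + (σ i - τ i) - ω i              ≈⟨ +-congˡ (-‿cong (ω≈σ-τ i)) ⟩
        1# + (σ i - τ i) - (σ i - τ i)      ≈⟨ solve 2 (λ σ τ → 𝟙 :+ (σ :- τ) :- (σ :- τ) := 𝟙) refl (σ i) (τ i) ⟩
        1#                                  ∎

      e₁ : ∀ i → α i + β i + γ i ≈ ι 3 - x i
      e₁ i = solve 2 (λ t e → e := t :- (t :- e)) refl (ι 3) (α i + β i + γ i)

      e₂ : ∀ i → α i * β i + β i * γ i + γ i * α i ≈ ι 3
      e₂ i = begin
        α i * β i + β i * γ i + γ i * α i
          ≈⟨ solve 3 (λ s b c → (:- (s :* (𝟙 :+ s))) :* (:- b) :+ (:- b) :* c :+ c :* (:- (s :* (𝟙 :+ s))) :=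
               (𝟙 :+ s) :* (s :* b) :- b :* c :- s :* ((𝟙 :+ s) :* c)) refl (s i) (σ i + σ i * σ i) (γ i) ⟩
        (1# + s i) * (s i * (σ i + σ i * σ i)) - (σ i + σ i * σ i) * γ i - s i * ((1# + s i) * γ i)
          ≈⟨ +-cong (+-cong (*-congˡ (s[σ+σ²] i)) (-‿cong (solve 2 (λ σ τ → (σ :+ σ :* σ) :* (τ :- τ :* τ) := (σ :* τ) :* ((𝟙 :+ σ) :* (𝟙 :- τ))) refl (σ i) (τ i))))
                    (-‿cong (*-congˡ ([1+s][τ-τ²] i))) ⟩
        (1# + s i) * (1# + σ i) - ω i * ((1# + σ i) * (1# - τ i)) - s i * (1# - τ i)
          ≈⟨ +-congʳ (+-congˡ (-‿cong (*-cong (ω≈σ-τ i) ([1+σ][1-τ]≈1 i)))) ⟩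
        (1# + s i) * (1# + σ i) - (σ i - τ i) * 1# - s i * (1# - τ i)
          ≈⟨ solve 3 (λ s σ τ → (𝟙 :+ s) :* (𝟙 :+ σ) :- (σ :- τ) :* 𝟙 :- s :* (𝟙 :- τ) := 𝟙 :+ s :* σ :+ (𝟙 :+ s) :* τ) refl (s i) (σ i) (τ i) ⟩
        1# + s i * σ i + (1# + s i) * τ i
          ≈⟨ +-cong (+-congˡ (sσ≈1 i)) ([1+s]τ≈1 i) ⟩
        1# + 1# + 1#
          ≈⟨ solve 0 (𝟙 :+ 𝟙 :+ 𝟙 := 𝟛) refl ⟩
        ι 3 ∎

      e₃ : ∀ i → α i * β i * γ i ≈ 1#
      e₃ i = begin
        α i * β i * γ i
          ≈⟨ solve 3 (λ s b c → (:- (s :* (𝟙 :+ s))) :* (:- b) :* c := (s :* b) :* ((𝟙 :+ s) :* c)) refl (s i) (σ i + σ i * σ i) (γ i) ⟩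
        (s i * (σ i + σ i * σ i)) * ((1# + s i) * γ i)    ≈⟨ *-cong (s[σ+σ²] i) ([1+s][τ-τ²] i) ⟩
        (1# + σ i) * (1# - τ i)                           ≈⟨ [1+σ][1-τ]≈1 i ⟩
        1#                                                ∎

      -- This is x = (w + 1)³ / w² with 1 / w = ω, so x depends on s only through w = s (s + 1), and
      -- differences of values factor.
      x≈ : ∀ i → x i ≈ ι 3 + w i + ι 3 * ω i + ω i * ω i
      x≈ i = begin
        x i
          ≈⟨ solve 4 (λ t w σ τ → t :- ((:- w) :+ (:- (σ :+ σ :* σ)) :+ (τ :- τ :* τ)) :=
               t :+ w :+ (σ :- τ) :+ (σ :- τ) :* (σ :- τ) :+ 𝟚 :* (σ :* τ)) refl (ι 3) (w i) (σ i) (τ i) ⟩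
        ι 3 + w i + (σ i - τ i) + (σ i - τ i) * (σ i - τ i) + ι 2 * ω i
          ≈⟨ +-congʳ (+-cong (+-congˡ (ω≈σ-τ i)) (*-cong (ω≈σ-τ i) (ω≈σ-τ i))) ⟨
        ι 3 + w i + ω i + ω i * ω i + ι 2 * ω i
          ≈⟨ solve 2 (λ w o → 𝟛 :+ w :+ o :+ o :* o :+ 𝟚 :* o := 𝟛 :+ w :+ 𝟛 :* o :+ o :* o) refl (w i) (ω i) ⟩
        ι 3 + w i + ι 3 * ω i + ω i * ω i ∎

      difference : ∀ i j → (w i - w j) * ((ω i * ω j) * (ω i * ω j) * (w i * w i * (w j * w j) - (ι 3 * (w i * w j) + w i + w j)))
                           ≈ x i - x j
      difference i j = begin
        (w i - w j) * ((ω i * ω j) * (ω i * ω j) * (w i * w i * (w j * w j) - (ι 3 * (w i * w j) + w i + w j)))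
          ≈⟨ solve 4 (λ w w′ o o′ →
               (w :- w′) :* ((o :* o′) :* (o :* o′) :* (w :* w :* (w′ :* w′) :- (𝟛 :* (w :* w′) :+ w :+ w′))) :=
               G w w′ o o′ (w :* o) (w′ :* o′)) refl (w i) (w j) (ω i) (ω j) ⟩
        g (w i * ω i) (w j * ω j)
          ≈⟨ g-cong (wω≈1 i) (wω≈1 j) ⟩
        g 1# 1#
          ≈⟨ solve 4 (λ w w′ o o′ → G w w′ o o′ 𝟙 𝟙 := (𝟛 :+ w :+ 𝟛 :* o :+ o :* o) :- (𝟛 :+ w′ :+ 𝟛 :* o′ :+ o′ :* o′))
               refl (w i) (w j) (ω i) (ω j) ⟩
        (ι 3 + w i + ι 3 * ω i + ω i * ω i) - (ι 3 + w j + ι 3 * ω j + ω j * ω j)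
          ≈⟨ +-cong (x≈ i) (-‿cong (x≈ j)) ⟨
        x i - x j ∎
        where
        -- The solver cannot use w ω = 1. So the products w ω are kept as separate arguments u and
        -- u′: the factorisation holds identically at u = w ω, and the wanted difference appears
        -- after replacing them by 1.
        G : ∀ {n} → SolverPolynomial n → SolverPolynomial n → SolverPolynomial n → SolverPolynomial n → SolverPolynomial n → SolverPolynomial n → SolverPolynomial n
        G w w′ o o′ u u′ = (w :- w′) :* ((u :* u) :* (u′ :* u′)) :- 𝟛 :* ((u :* u) :* (u′ :* o′) :- (u :* o) :* (u′ :* u′))
                           :- ((u :* u) :* (o′ :* o′) :- (u′ :* u′) :* (o :* o))

        g : Carrier → Carrier → Carrier
        g u u′ = (w i - w j) * ((u * u) * (u′ * u′)) - ι 3 * ((u * u) * (u′ * ω j) - (u * ω i) * (u′ * u′))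
                 - ((u * u) * (ω j * ω j) - (u′ * u′) * (ω i * ω i))

        g-cong : ∀ {u u′ v v′} → u ≈ v → u′ ≈ v′ → g u u′ ≈ g v v′
        g-cong e e′ = +-cong
          (+-cong (*-congˡ (*-cong (*-cong e e) (*-cong e′ e′)))
                  (-‿cong (*-congˡ (+-cong (*-cong (*-cong e e) (*-congʳ e′)) (-‿cong (*-cong (*-congʳ e) (*-cong e′ e′)))))))
          (-‿cong (+-cong (*-congʳ (*-cong e e)) (-‿cong (*-congʳ (*-cong e′ e′)))))

      W : ℕ → ℕ
      W i = suc i ℕ.* suc (suc i)

      w≈ιW : ∀ i → w i ≈ ι (W i)
      w≈ιW i = sym (ι-* (suc i) (suc (suc i)))

      differences : ∀ B → RegularDifferences B x
      differences B {i} i<j _ with d , ≡.refl ← ℕₚ.m≤n⇒∃[o]m+o≡n i<j =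
        regular-resp (difference i j) (regular-* (regular-resp w-diff (regular-neg (ι-regular D)))
          (regular-* (regular-* (regular-* (ω-regular i) (ω-regular j)) (regular-* (ω-regular i) (ω-regular j)))
            (regular-resp last-factor (ι-regular M))))
        where
        j = suc i ℕ.+ d
        -- D + 1 = (j - i)(i + j + 3), which is w j - w i.
        D = (2 ℕ.+ (i ℕ.+ i) ℕ.+ suc d) ℕ.+ d ℕ.* (3 ℕ.+ (i ℕ.+ i) ℕ.+ suc d)
        -- w i = 2 + v, w j = 3 + v′ and w i w j = 6 + A. In these variables w² w′² - (3 w w′ + w +
        -- w′) has only nonnegative coefficients and constant term 36 - 18 - 5 = 13, so it equals M
        -- + 1 and is a positive integer.
        v = i ℕ.* (3 ℕ.+ i)
        v′ = 3 ℕ.+ (i ℕ.+ d) ℕ.* (5 ℕ.+ (i ℕ.+ d))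
        A = 2 ℕ.* v′ ℕ.+ 3 ℕ.* v ℕ.+ v ℕ.* v′
        M = 12 ℕ.+ (26 ℕ.* v ℕ.+ 17 ℕ.* v′ ℕ.+ 9 ℕ.* (v ℕ.* v′) ℕ.+ A ℕ.* A)

        ω-regular : ∀ i → Regular (ω i)
        ω-regular i = regular-* (ρ-regular i) (ρ-regular (1 ℕ.+ i))


        W-diff : W j ≡ W i ℕ.+ suc D
        W-diff = solveℕ 2 (λ i d →
            (numeral 2 ⊕ i ⊕ d) ⊗ (numeral 3 ⊕ i ⊕ d) ⊜
            (numeral 1 ⊕ i) ⊗ (numeral 2 ⊕ i) ⊕ (numeral 1 ⊕ d) ⊗ (numeral 3 ⊕ (i ⊕ i) ⊕ (numeral 1 ⊕ d))) ≡.refl i d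

        w-diff : - ι (suc D) ≈ w i - w j
        w-diff = begin
          - ι (suc D)                      ≈⟨ solve 2 (λ a d → :- d := a :- (a :+ d)) refl (ι (W i)) (ι (suc D)) ⟩
          ι (W i) - (ι (W i) + ι (suc D))  ≈⟨ +-congˡ (-‿cong (ι-+ (W i) (suc D))) ⟨
          ι (W i) - ι (W i ℕ.+ suc D)      ≡⟨ ≡.cong (λ k → ι (W i) - ι k) W-diff ⟨
          ι (W i) - ι (W j)                ≈⟨ +-cong (w≈ιW i) (-‿cong (w≈ιW j)) ⟨
          w i - w j                        ∎

        W² : W i ℕ.* W i ℕ.* (W j ℕ.* W j) ≡ (3 ℕ.* (W i ℕ.* W j) ℕ.+ W i ℕ.+ W j) ℕ.+ suc M
        W² = ≡.subst₂ (λ a b → a ℕ.* a ℕ.* (b ℕ.* b) ≡ (3 ℕ.* (a ℕ.* b) ℕ.+ a ℕ.+ b) ℕ.+ suc M)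
          (solveℕ 1 (λ i → numeral 2 ⊕ i ⊗ (numeral 3 ⊕ i) ⊜ (numeral 1 ⊕ i) ⊗ (numeral 2 ⊕ i)) ≡.refl i)
          (solveℕ 2 (λ i d → numeral 3 ⊕ (numeral 3 ⊕ (i ⊕ d) ⊗ (numeral 5 ⊕ (i ⊕ d))) ⊜ (numeral 2 ⊕ i ⊕ d) ⊗ (numeral 3 ⊕ i ⊕ d)) ≡.refl i d)
          (polynomial v v′)
          where
          polynomial : ∀ v v′ → let A = 2 ℕ.* v′ ℕ.+ 3 ℕ.* v ℕ.+ v ℕ.* v′ in
            (2 ℕ.+ v) ℕ.* (2 ℕ.+ v) ℕ.* ((3 ℕ.+ v′) ℕ.* (3 ℕ.+ v′)) ≡
            (3 ℕ.* ((2 ℕ.+ v) ℕ.* (3 ℕ.+ v′)) ℕ.+ (2 ℕ.+ v) ℕ.+ (3 ℕ.+ v′))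
            ℕ.+ (13 ℕ.+ (26 ℕ.* v ℕ.+ 17 ℕ.* v′ ℕ.+ 9 ℕ.* (v ℕ.* v′) ℕ.+ A ℕ.* A))
          polynomial = solveℕ 2 (λ v v′ →
            let A = numeral 2 ⊗ v′ ⊕ numeral 3 ⊗ v ⊕ v ⊗ v′ in
            (numeral 2 ⊕ v) ⊗ (numeral 2 ⊕ v) ⊗ ((numeral 3 ⊕ v′) ⊗ (numeral 3 ⊕ v′)) ⊜
            (numeral 3 ⊗ ((numeral 2 ⊕ v) ⊗ (numeral 3 ⊕ v′)) ⊕ (numeral 2 ⊕ v) ⊕ (numeral 3 ⊕ v′))
            ⊕ (numeral 13 ⊕ (numeral 26 ⊗ v ⊕ numeral 17 ⊗ v′ ⊕ numeral 9 ⊗ (v ⊗ v′) ⊕ A ⊗ A))) ≡.refl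

        last-factor : ι (suc M) ≈ w i * w i * (w j * w j) - (ι 3 * (w i * w j) + w i + w j)
        last-factor = begin
          ι (suc M)                   ≈⟨ solve 2 (λ s m → m := (s :+ m) :- s) refl (ι S) (ι (suc M)) ⟩
          (ι S + ι (suc M)) - ι S     ≈⟨ +-congʳ (ι-+ S (suc M)) ⟨
          ι (S ℕ.+ suc M) - ι S       ≡⟨ ≡.cong (λ k → ι k - ι S) W² ⟨
          ι (W i ℕ.* W i ℕ.* (W j ℕ.* W j)) - ι S
            ≈⟨ +-cong (trans (ι-* (W i ℕ.* W i) (W j ℕ.* W j)) (*-cong (ι-* (W i) (W i)) (ι-* (W j) (W j))))
                 (-‿cong (trans (ι-+ (3 ℕ.* (W i ℕ.* W j) ℕ.+ W i) (W j))
                   (+-congʳ (trans (ι-+ (3 ℕ.* (W i ℕ.* W j)) (W i)) (+-congʳ (trans (ι-* 3 (W i ℕ.* W j)) (*-congˡ (ι-* (W i) (W j))))))))) ⟩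
          ι (W i) * ι (W i) * (ι (W j) * ι (W j)) - (ι 3 * (ι (W i) * ι (W j)) + ι (W i) + ι (W j))
            ≈⟨ +-cong (*-cong (*-cong (w≈ιW i) (w≈ιW i)) (*-cong (w≈ιW j) (w≈ιW j)))
                 (-‿cong (+-cong (+-cong (*-congˡ (*-cong (w≈ιW i) (w≈ιW j))) (w≈ιW i)) (w≈ιW j))) ⟨
          w i * w i * (w j * w j) - (ι 3 * (w i * w j) + w i + w j) ∎
          where
          S = 3 ℕ.* (W i ℕ.* W j) ℕ.+ W i ℕ.+ W j

-- Nested sums over decreasing indices.

module NestedSum {a ℓ} (R : CommutativeRing a ℓ) where
  open CommutativeRing R hiding (zero)
  open import Algebra.Properties.Monoid.Sum +-monoid using (sum)
  open import Algebra.Properties.Semiring.Exp semiring using (_^_)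

  -- The factor a_m of an entry k at index m + 1, with `u m` in the role of 1 / (1 - q^(m+1)).
  entryWeight : Carrier → (ℕ → Carrier) → ℕ → ℕ → Carrier
  entryWeight q u k m = q ^ ((k ∸ 1) ℕ.* suc m) * u m ^ k

  -- the sum over N ≥ m₁ > ⋯ > m_l > 0, with g k m the weight of an entry k at m + 1
  nested : (ℕ → ℕ → Carrier) → ℕ → List ℕ → Carrier
  nested g N       []       = 1#
  nested g zero    (k ∷ ks) = 0#
  nested g (suc N) (k ∷ ks) = nested g N (k ∷ ks) + g k N * nested g N ks

  -- `sum` recurses on the first summand, `nested` on the last one, the largest index.
  sum-suc : ∀ N (f : ℕ → Carrier) → sum {suc N} (λ i → f (toℕ i)) ≈ sum {N} (λ i → f (toℕ i)) + f N
  sum-suc zero    f = +-comm _ _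
  sum-suc (suc N) f = trans (+-congˡ (sum-suc N (λ i → f (suc i)))) (sym (+-assoc _ _ _))

  sum-nested : ∀ g N k ks → sum {N} (λ i → g k (toℕ i) * nested g (toℕ i) ks) ≈ nested g N (k ∷ ks)
  sum-nested g zero    k ks = refl
  sum-nested g (suc N) k ks = trans (sum-suc N (λ m → g k m * nested g m ks)) (+-congʳ (sum-nested g N k ks))

-- Elementary symmetric functions of the weights.

module ElementarySymmetric {a ℓ} (R : CommutativeRing a ℓ) (ρ : ℕ → CommutativeRing.Carrier R) where
  open CommutativeRing R hiding (zero)
  open import Algebra.Properties.Semiring.Exp semiring using (_^_; ^-congˡ; ^-homo-*)
  open import Algebra.Properties.CommutativeSemiring.Exp commutativeSemiring using (^-distrib-*)
  open IntegerCoefficientSolver R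
  open PowerSeries R
  open Polynomial R
  open BinomialRecurrence R
  open PowerSums R
  open Coefficients R
  open NestedSum R
  open ≈-Reasoning setoid

  module _ (ρ-inverse : ∀ m → ι (suc m) * ρ m ≈ 1#)
           (N : ℕ) (ζ : Carrier) (ζⁿ≈1 : ζ ^ suc N ≈ 1#)
           (u : ℕ → Carrier) (u-inverse : ∀ m → m ℕ.< N → (1# - ζ ^ suc m) * u m ≈ 1#) where
    n : ℕ
    n = suc N

    z : ℕ → Carrier
    z m = ζ ^ suc m

    weight : ℕ → ℕ → Carrier
    weight = entryWeight ζ u

    open RootsOfUnity N ζ ζⁿ≈1 (λ m m<N → regular-resp
      (solve 1 (λ z → :- (𝟙 :- z) := z :- 𝟙) refl (z m)) (regular-neg (unit⇒regular (u-inverse m m<N))))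

    -- n is the product of all 1 - ζ^m, so each factor n clears one power of the denominators.
    n*∏ : ∀ h → ι n * ∏ N h ≈ ∏ N (λ m → (1# - z m) * h m)
    n*∏ h = trans (*-congʳ (sym ∏ζ1≈n)) (sym (∏-* N (λ m → 1# - z m) h))

    product₁ : ∀ x → ι n * (x * ∏ N (λ m → 1# + weight 1 m * x)) ≈ (1# + x) ^ n - 1#
    product₁ x = begin
      ι n * (x * P)                      ≈⟨ solve 3 (λ n x p → n :* (x :* p) := ((𝟙 :+ x) :- 𝟙) :* (n :* p)) refl (ι n) x P ⟩
      ((1# + x) - 1#) * (ι n * P)        ≈⟨ *-congˡ (trans (n*∏ _) (∏-cong N factor)) ⟩
      ((1# + x) - 1#) * ∏ζ (1# + x)      ≈⟨ [x-1]∏ζ (1# + x) ⟩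
      (1# + x) ^ n - 1#                  ∎
      where
      P : Carrier
      P = ∏ N (λ m → 1# + weight 1 m * x)

      factor : ∀ m → m ℕ.< N → (1# - z m) * (1# + weight 1 m * x) ≈ (1# + x) - z m
      factor m m<N = begin
        (1# - z m) * (1# + 1# * (u m * 1#) * x)
          ≈⟨ solve 3 (λ z u x → (𝟙 :- z) :* (𝟙 :+ 𝟙 :* (u :* 𝟙) :* x) := (𝟙 :- z) :+ ((𝟙 :- z) :* u) :* x) refl (z m) (u m) x ⟩
        (1# - z m) + ((1# - z m) * u m) * x     ≈⟨ +-congˡ (*-congʳ (u-inverse m m<N)) ⟩
        (1# - z m) + 1# * x                     ≈⟨ solve 2 (λ z x → (𝟙 :- z) :+ 𝟙 :* x := (𝟙 :+ x) :- z) refl (z m) x ⟩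
        (1# + x) - z m                          ∎

    product₂ : ∀ x α β → α * β ≈ 1# → α + β ≈ ι 2 + x →
      ι n * ι n * (x * ∏ N (λ m → 1# + - weight 2 m * x)) ≈ α ^ n + β ^ n - ι 2
    product₂ x α β αβ≈1 α+β≈ = begin
      ι n * ι n * (x * P)
        ≈⟨ solve 3 (λ n x p → n :* n :* (x :* p) := (:- ((𝟙 :- (𝟚 :+ x)) :+ 𝟙)) :* (n :* (n :* p))) refl (ι n) x P ⟩
      -- The factor in front is x, rewritten as - (α - 1)(β - 1), to be shared out between the two
      -- products.
      - ((1# - (ι 2 + x)) + 1#) * (ι n * (ι n * P))
        ≈⟨ *-cong (-‿cong (+-congʳ (+-cong αβ≈1 (-‿cong α+β≈)))) (∏ζαβ) ⟨
      - ((α * β - (α + β)) + 1#) * (∏ζ α * ∏ζ β)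
        ≈⟨ solve 4 (λ a b c d → (:- ((a :* b :- (a :+ b)) :+ 𝟙)) :* (c :* d) := :- (((a :- 𝟙) :* c) :* ((b :- 𝟙) :* d))) refl α β (∏ζ α) (∏ζ β) ⟩
      - (((α - 1#) * ∏ζ α) * ((β - 1#) * ∏ζ β))
        ≈⟨ -‿cong (*-cong ([x-1]∏ζ α) ([x-1]∏ζ β)) ⟩
      - ((α ^ n - 1#) * (β ^ n - 1#))
        ≈⟨ solve 2 (λ s t → :- ((s :- 𝟙) :* (t :- 𝟙)) := s :+ t :- (s :* t :+ 𝟙)) refl (α ^ n) (β ^ n) ⟩
      α ^ n + β ^ n - (α ^ n * β ^ n + 1#)
        ≈⟨ +-congˡ (-‿cong (+-congʳ (trans (sym (^-distrib-* α β n)) (trans (^-congˡ n αβ≈1) (1^ n))))) ⟩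
      α ^ n + β ^ n - (1# + 1#)
        ≈⟨ solve 1 (λ s → s :- (𝟙 :+ 𝟙) := s :- 𝟚) refl _ ⟩
      α ^ n + β ^ n - ι 2 ∎
      where
      P : Carrier
      P = ∏ N (λ m → 1# + - weight 2 m * x)

      factor : ∀ m → m ℕ.< N → (1# - z m) * ((1# - z m) * (1# + - weight 2 m * x)) ≈ (α - z m) * (β - z m)
      factor m m<N = begin
        (1# - z m) * ((1# - z m) * (1# + - (ζ ^ (1 ℕ.* suc m) * u m ^ 2) * x))
          ≡⟨ ≡.cong (λ k → (1# - z m) * ((1# - z m) * (1# + - (ζ ^ k * u m ^ 2) * x))) (ℕₚ.*-identityˡ (suc m)) ⟩
        (1# - z m) * ((1# - z m) * (1# + - (z m * u m ^ 2) * x))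
          ≈⟨ solve 3 (λ z u x → (𝟙 :- z) :* ((𝟙 :- z) :* (𝟙 :+ (:- (z :* (u :* (u :* 𝟙)))) :* x)) :=
               (𝟙 :- z) :* (𝟙 :- z) :- (((𝟙 :- z) :* u) :* ((𝟙 :- z) :* u)) :* (z :* x)) refl (z m) (u m) x ⟩
        (1# - z m) * (1# - z m) - (((1# - z m) * u m) * ((1# - z m) * u m)) * (z m * x)
          ≈⟨ +-congˡ (-‿cong (*-congʳ (*-cong (u-inverse m m<N) (u-inverse m m<N)))) ⟩
        (1# - z m) * (1# - z m) - (1# * 1#) * (z m * x)
          ≈⟨ solve 2 (λ z x → (𝟙 :- z) :* (𝟙 :- z) :- (𝟙 :* 𝟙) :* (z :* x) := 𝟙 :- (𝟚 :+ x) :* z :+ z :* z) refl (z m) x ⟩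
        1# - (ι 2 + x) * z m + z m * z m
          ≈⟨ +-congʳ (+-cong αβ≈1 (-‿cong (*-congʳ α+β≈))) ⟨
        α * β - (α + β) * z m + z m * z m
          ≈⟨ solve 3 (λ a b z → a :* b :- (a :+ b) :* z :+ z :* z := (a :- z) :* (b :- z)) refl α β (z m) ⟩
        (α - z m) * (β - z m) ∎

      ∏ζαβ : ∏ζ α * ∏ζ β ≈ ι n * (ι n * P)
      ∏ζαβ = sym (trans (*-congˡ (n*∏ _)) (trans (n*∏ _) (trans (∏-cong N factor) (∏-* N _ _))))

    -- (1 - z)³ - x z² = (α - z)(β - z)(γ - z), and z = 1 gives - x = (α - 1)(β - 1)(γ - 1). In the
    -- expanded product of the α^n - 1 the constant and the triple product cancel because αβγ = 1.
    product₃ : ∀ x α β γ → α + β + γ ≈ ι 3 - x → α * β + β * γ + γ * α ≈ ι 3 → α * β * γ ≈ 1# →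
      ι n * ι n * ι n * (x * ∏ N (λ m → 1# + - weight 3 m * x))
      ≈ ((α * β) ^ n + (β * γ) ^ n + (γ * α) ^ n) - (α ^ n + β ^ n + γ ^ n)
    product₃ x α β γ e₁ e₂ e₃ = begin
      ι n * ι n * ι n * (x * P)
        ≈⟨ solve 3 (λ n x p → n :* n :* n :* (x :* p) := (:- (𝟙 :- 𝟛 :+ (𝟛 :- x) :- 𝟙)) :* (n :* (n :* (n :* p)))) refl (ι n) x P ⟩
      - (1# - ι 3 + (ι 3 - x) - 1#) * (ι n * (ι n * (ι n * P)))
        ≈⟨ *-cong (-‿cong (+-congʳ (+-cong (+-cong e₃ (-‿cong e₂)) e₁))) ∏ζαβγ ⟨
      - (α * β * γ - (α * β + β * γ + γ * α) + (α + β + γ) - 1#) * (∏ζ α * (∏ζ β * ∏ζ γ))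
        ≈⟨ solve 6 (λ a b c s t w →
             (:- (a :* b :* c :- (a :* b :+ b :* c :+ c :* a) :+ (a :+ b :+ c) :- 𝟙)) :* (s :* (t :* w)) :=
             :- (((a :- 𝟙) :* s) :* (((b :- 𝟙) :* t) :* ((c :- 𝟙) :* w)))) refl α β γ (∏ζ α) (∏ζ β) (∏ζ γ) ⟩
      - (((α - 1#) * ∏ζ α) * (((β - 1#) * ∏ζ β) * ((γ - 1#) * ∏ζ γ)))
        ≈⟨ -‿cong (*-cong ([x-1]∏ζ α) (*-cong ([x-1]∏ζ β) ([x-1]∏ζ γ))) ⟩
      - ((α ^ n - 1#) * ((β ^ n - 1#) * (γ ^ n - 1#)))
        ≈⟨ solve 3 (λ s t w → :- ((s :- 𝟙) :* ((t :- 𝟙) :* (w :- 𝟙))) :=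
             ((s :* t :+ t :* w :+ w :* s) :- (s :+ t :+ w)) :+ (𝟙 :- s :* t :* w)) refl (α ^ n) (β ^ n) (γ ^ n) ⟩
      ((α ^ n * β ^ n + β ^ n * γ ^ n + γ ^ n * α ^ n) - (α ^ n + β ^ n + γ ^ n)) + (1# - α ^ n * β ^ n * γ ^ n)
        ≈⟨ +-cong (+-congʳ (+-cong (+-cong (^-distrib-* α β n) (^-distrib-* β γ n)) (^-distrib-* γ α n)))
             (+-congˡ (-‿cong (trans (^-distrib-* (α * β) γ n) (*-congʳ (^-distrib-* α β n))))) ⟨
      S + (1# - (α * β * γ) ^ n)
        ≈⟨ +-congˡ (+-congˡ (-‿cong (trans (^-congˡ n e₃) (1^ n)))) ⟩
      S + (1# - 1#)
        ≈⟨ solve 1 (λ s → s :+ (𝟙 :- 𝟙) := s) refl S ⟩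
      S ∎
      where
      P S : Carrier
      P = ∏ N (λ m → 1# + - weight 3 m * x)
      S = ((α * β) ^ n + (β * γ) ^ n + (γ * α) ^ n) - (α ^ n + β ^ n + γ ^ n)

      ζ^2m : ∀ m → ζ ^ (2 ℕ.* suc m) ≈ z m * z m
      ζ^2m m = trans (reflexive (≡.cong (λ k → ζ ^ (suc m ℕ.+ k)) (ℕₚ.*-identityˡ (suc m)))) (^-homo-* ζ (suc m) (suc m))

      factor : ∀ m → m ℕ.< N → (1# - z m) * ((1# - z m) * ((1# - z m) * (1# + - weight 3 m * x)))
                               ≈ (α - z m) * ((β - z m) * (γ - z m))
      factor m m<N = begin
        (1# - z m) * ((1# - z m) * ((1# - z m) * (1# + - (ζ ^ (2 ℕ.* suc m) * u m ^ 3) * x)))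
          ≈⟨ *-congˡ (*-congˡ (*-congˡ (+-congˡ (*-congʳ (-‿cong (*-congʳ (ζ^2m m))))))) ⟩
        (1# - z m) * ((1# - z m) * ((1# - z m) * (1# + - (z m * z m * u m ^ 3) * x)))
          ≈⟨ solve 3 (λ z u x → (𝟙 :- z) :* ((𝟙 :- z) :* ((𝟙 :- z) :* (𝟙 :+ (:- (z :* z :* (u :* (u :* (u :* 𝟙))))) :* x))) :=
               (𝟙 :- z) :* (𝟙 :- z) :* (𝟙 :- z) :- (((𝟙 :- z) :* u) :* (((𝟙 :- z) :* u) :* ((𝟙 :- z) :* u))) :* (z :* z :* x))
               refl (z m) (u m) x ⟩
        (1# - z m) * (1# - z m) * (1# - z m) - (((1# - z m) * u m) * (((1# - z m) * u m) * ((1# - z m) * u m))) * (z m * z m * x)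
          ≈⟨ +-congˡ (-‿cong (*-congʳ (*-cong (u-inverse m m<N) (*-cong (u-inverse m m<N) (u-inverse m m<N))))) ⟩
        (1# - z m) * (1# - z m) * (1# - z m) - (1# * (1# * 1#)) * (z m * z m * x)
          ≈⟨ solve 2 (λ z x → (𝟙 :- z) :* (𝟙 :- z) :* (𝟙 :- z) :- (𝟙 :* (𝟙 :* 𝟙)) :* (z :* z :* x) :=
               𝟙 :- 𝟛 :* z :+ (𝟛 :- x) :* (z :* z) :- z :* z :* z) refl (z m) x ⟩
        1# - ι 3 * z m + (ι 3 - x) * (z m * z m) - z m * z m * z m
          ≈⟨ +-congʳ (+-cong (+-cong e₃ (-‿cong (*-congʳ e₂))) (*-congʳ e₁)) ⟨
        α * β * γ - (α * β + β * γ + γ * α) * z m + (α + β + γ) * (z m * z m) - z m * z m * z m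
          ≈⟨ solve 4 (λ a b c z → a :* b :* c :- (a :* b :+ b :* c :+ c :* a) :* z :+ (a :+ b :+ c) :* (z :* z) :- z :* z :* z :=
               (a :- z) :* ((b :- z) :* (c :- z))) refl α β γ (z m) ⟩
        (α - z m) * ((β - z m) * (γ - z m)) ∎

      ∏ζαβγ : ∏ζ α * (∏ζ β * ∏ζ γ) ≈ ι n * (ι n * (ι n * P))
      ∏ζαβγ = sym (trans (*-congˡ (trans (*-congˡ (n*∏ _)) (n*∏ _))) (trans (n*∏ _)
        (trans (∏-cong N factor) (trans (∏-* N _ _) (*-congˡ (∏-* N _ _))))))

    -- Agreement at `suc B` points with regular differences identifies the coefficients. The factor
    -- x in front of the product accounts for the step from `i` to `suc i`.
    coefficient-unique : ∀ c f D r i B → suc i ℕ.< suc B → N ℕ.< B → RegularDifferences (suc B) r →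
      (∀ j → c * (r j * ∏ N (λ m → 1# + f m * r j)) ≈ eval (suc B) D (r j)) → c * elementary f N i ≈ D (suc i)
    coefficient-unique c f D r i B i<B N<B reg eq =
      interpolation-unique (suc B) (shift (λ i → c * e i)) D r reg (λ j _ → begin
        eval (suc B) (shift (λ i → c * e i)) (r j)
          ≈⟨ eval-shift B (λ i → c * e i) (r j) (trans (*-congˡ (elementary-degree f N B N<B)) (zeroʳ c)) ⟩
        r j * eval (suc B) (λ i → c * e i) (r j)
          ≈⟨ *-congˡ (trans (eval-* (suc B) c e (r j)) (*-congˡ (eval-elementary f N (suc B) (r j) (ℕₚ.m<n⇒m<1+n N<B)))) ⟩
        r j * (c * ∏ N (λ m → 1# + f m * r j))
          ≈⟨ solve 3 (λ c r p → r :* (c :* p) := c :* (r :* p)) refl c (r j) _ ⟩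
        c * (r j * ∏ N (λ m → 1# + f m * r j))
          ≈⟨ eq j ⟩
        eval (suc B) D (r j) ∎) (suc i) i<B
      where
      e : Series
      e = elementary f N

    private
      -- The power sum formulas need 3 + n coefficients of room; the summand `suc i` is there
      -- because `i` ranges over all of ℕ, beyond the degree of P.
      bound : ℕ → ℕ
      bound i = 3 ℕ.+ n ℕ.+ suc i

      i<bound : ∀ i → suc i ℕ.< suc (bound i)
      i<bound i = ℕ.s≤s (ℕₚ.m≤n+m (suc i) (3 ℕ.+ n))

      n≤bound : ∀ i → 3 ℕ.+ n ℕ.≤ bound i
      n≤bound i = ℕₚ.m≤m+n (3 ℕ.+ n) (suc i)

      N<bound : ∀ i → N ℕ.< bound i
      N<bound i = ℕₚ.≤-trans (ℕₚ.m≤n+m n 3) (n≤bound i)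

    n-coefficient₁ : ∀ i → ι n * elementary (weight 1) N i ≈ ι (n C suc i)
    n-coefficient₁ i = trans
      (coefficient-unique (ι n) (weight 1) (λ j → ι (n C j) + - 1# * δ j) x i B (i<bound i) (N<bound i) (differences (suc B))
        λ j → begin
          ι n * (x j * ∏ N (λ m → 1# + weight 1 m * x j))   ≈⟨ product₁ (x j) ⟩
          (1# + x j) ^ n - 1#                               ≈⟨ solve 1 (λ p → p :- 𝟙 := p :+ (:- 𝟙) :* 𝟙) refl _ ⟩
          (1# + x j) ^ n + - 1# * 1#
            ≈⟨ +-cong (eval-binomial-theorem n B (x j) (ℕₚ.≤-trans (ℕₚ.m≤n+m n 3) (n≤bound i))) (*-congˡ (eval-δ B (x j))) ⟨
          eval (suc B) (λ j → ι (n C j)) (x j) + - 1# * eval (suc B) δ (x j)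
            ≈⟨ eval-linear (suc B) (- 1#) (λ j → ι (n C j)) δ (x j) ⟨
          eval (suc B) (λ j → ι (n C j) + - 1# * δ j) (x j) ∎)
      (solve 1 (λ c → c :+ (:- 𝟙) :* con (+ 0) := c) refl _)
      where
      open Points₁ ρ ρ-inverse
      B = bound i

    -- The summand - 2 of the product formula sits in degree 0 and disappears, since only degrees
    -- `suc i` are read off.
    n-coefficient₂ : ∀ i → ι n * ι n * elementary (λ m → - weight 2 m) N i
                           ≈ binomials 1 2 (1 ℕ.+ n) (suc i) + binomials 1 2 n (suc i)
    n-coefficient₂ i = trans
      (coefficient-unique (ι n * ι n) (λ m → - weight 2 m) D x i B (i<bound i) (N<bound i) (differences (suc B))
        λ j → begin
          ι n * ι n * (x j * ∏ N (λ m → 1# + - weight 2 m * x j))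
            ≈⟨ product₂ (x j) (α j) (β j) (αβ≈1 j) (α+β≈2+x j) ⟩
          α j ^ n + β j ^ n - ι 2
            ≈⟨ +-congʳ (powerSum-1-2 B (x j) (α j) (β j) (αβ≈1 j) (α+β≈2+x j) n (n≤bound i)) ⟩
          E (1 ℕ.+ n) j + E n j - ι 2
            ≈⟨ solve 2 (λ s t → s :- t := s :+ (:- t) :* 𝟙) refl _ (ι 2) ⟩
          E (1 ℕ.+ n) j + E n j + - ι 2 * 1#
            ≈⟨ +-cong (eval-+ (suc B) (binomials 1 2 (1 ℕ.+ n)) (binomials 1 2 n) (x j)) (*-congˡ (eval-δ B (x j))) ⟨
          eval (suc B) (λ j → binomials 1 2 (1 ℕ.+ n) j + binomials 1 2 n j) (x j) + - ι 2 * eval (suc B) δ (x j)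
            ≈⟨ eval-linear (suc B) (- ι 2) (λ j → binomials 1 2 (1 ℕ.+ n) j + binomials 1 2 n j) δ (x j) ⟨
          eval (suc B) D (x j) ∎)
      (solve 2 (λ c t → c :+ (:- t) :* con (+ 0) := c) refl _ (ι 2))
      where
      open Points₂ ρ ρ-inverse
      B = bound i

      D : Series
      D j = binomials 1 2 (1 ℕ.+ n) j + binomials 1 2 n j + - ι 2 * δ j

      E : ℕ → ℕ → Carrier
      E m j = eval (suc B) (binomials 1 2 m) (x j)

    -- The pairwise products of the roots have the symmetric functions 3, 3 - x, 1 and contribute at
    -- x; the roots themselves contribute at - x. Subtracting the latter turns (-1)^(i+1) into
    -- (-1)^i.
    n-coefficient₃ : ∀ i → ι n * ι n * ι n * elementary (λ m → - weight 3 m) N i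
      ≈ (ι 2 * binomials 1 3 (1 ℕ.+ n) (suc i) + binomials 1 3 n (suc i))
        + (- 1#) ^ i * (binomials 2 3 (1 ℕ.+ n) (suc i) + ι 2 * binomials 2 3 n (suc i))
    n-coefficient₃ i = trans
      (coefficient-unique (ι n * ι n * ι n) (λ m → - weight 3 m) D x i B (i<bound i) (N<bound i) (differences (suc B))
        λ j → begin
          ι n * ι n * ι n * (x j * ∏ N (λ m → 1# + - weight 3 m * x j))
            ≈⟨ product₃ (x j) (α j) (β j) (γ j) (e₁ j) (e₂ j) (e₃ j) ⟩
          ((α j * β j) ^ n + (β j * γ j) ^ n + (γ j * α j) ^ n) - (α j ^ n + β j ^ n + γ j ^ n)
            ≈⟨ +-cong (powerSum-1-3 B (x j) (e₂ j) (reciprocal-e₂ j) (reciprocal-e₃ j) n (n≤bound i))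
                 (-‿cong (powerSum-2-3 B (- 1# * x j)
                   (trans (e₁ j) (solve 2 (λ t x → t :- x := t :+ (:- 𝟙) :* x) refl (ι 3) (x j))) (e₂ j) (e₃ j) n (n≤bound i))) ⟩
          (ι 2 * eval (suc B) (binomials 1 3 (1 ℕ.+ n)) (x j) + eval (suc B) (binomials 1 3 n) (x j))
            - (eval (suc B) (binomials 2 3 (1 ℕ.+ n)) (- 1# * x j) + ι 2 * eval (suc B) (binomials 2 3 n) (- 1# * x j))
            ≈⟨ +-cong (trans (eval-linear′ (binomials 1 3 n) (binomials 1 3 (1 ℕ.+ n)) (x j)) (+-comm _ _))
                 (-‿cong (eval-linear′ (binomials 2 3 (1 ℕ.+ n)) (binomials 2 3 n) (- 1# * x j))) ⟨
          eval (suc B) D₁ (x j) - eval (suc B) D₂ (- 1# * x j)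
            ≈⟨ +-congˡ (-‿cong (eval-rescale (suc B) D₂ (- 1#) (x j))) ⟩
          eval (suc B) D₁ (x j) - eval (suc B) (rescale (- 1#) D₂) (x j)
            ≈⟨ solve 2 (λ s t → s :- t := s :+ (:- 𝟙) :* t) refl _ _ ⟩
          eval (suc B) D₁ (x j) + - 1# * eval (suc B) (rescale (- 1#) D₂) (x j)
            ≈⟨ eval-linear (suc B) (- 1#) D₁ (rescale (- 1#) D₂) (x j) ⟨
          eval (suc B) D (x j) ∎)
      (solve 5 (λ t a b c s → (a :+ t :* b) :+ (:- 𝟙) :* (c :* ((:- 𝟙) :* s)) := (t :* b :+ a) :+ s :* c)
        refl (ι 2) (binomials 1 3 n (suc i)) (binomials 1 3 (1 ℕ.+ n) (suc i)) (D₂ (suc i)) ((- 1#) ^ i))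
      where
      open Points₃ ρ ρ-inverse
      B = bound i

      D₁ D₂ D : Series
      D₁ j = binomials 1 3 n j + ι 2 * binomials 1 3 (1 ℕ.+ n) j
      D₂ j = binomials 2 3 (1 ℕ.+ n) j + ι 2 * binomials 2 3 n j
      D j = D₁ j + - 1# * rescale (- 1#) D₂ j

      eval-linear′ : ∀ f g x → eval (suc B) (λ j → f j + ι 2 * g j) x ≈ eval (suc B) f x + ι 2 * eval (suc B) g x
      eval-linear′ f g x = eval-linear (suc B) (ι 2) f g x

      reciprocal-e₂ : ∀ j → (α j * β j) * (β j * γ j) + (β j * γ j) * (γ j * α j) + (γ j * α j) * (α j * β j) ≈ ι 3 - x j
      reciprocal-e₂ j = begin
        (α j * β j) * (β j * γ j) + (β j * γ j) * (γ j * α j) + (γ j * α j) * (α j * β j)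
          ≈⟨ solve 3 (λ a b c → (a :* b) :* (b :* c) :+ (b :* c) :* (c :* a) :+ (c :* a) :* (a :* b) := (a :* b :* c) :* (a :+ b :+ c)) refl (α j) (β j) (γ j) ⟩
        (α j * β j * γ j) * (α j + β j + γ j)     ≈⟨ *-cong (e₃ j) (e₁ j) ⟩
        1# * (ι 3 - x j)                          ≈⟨ *-identityˡ _ ⟩
        ι 3 - x j                                 ∎

      reciprocal-e₃ : ∀ j → (α j * β j) * (β j * γ j) * (γ j * α j) ≈ 1#
      reciprocal-e₃ j = begin
        (α j * β j) * (β j * γ j) * (γ j * α j)
          ≈⟨ solve 3 (λ a b c → (a :* b) :* (b :* c) :* (c :* a) := (a :* b :* c) :* (a :* b :* c)) refl (α j) (β j) (γ j) ⟩
        (α j * β j * γ j) * (α j * β j * γ j)     ≈⟨ *-cong (e₃ j) (e₃ j) ⟩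
        1# * 1#                                   ≈⟨ *-identityˡ 1# ⟩
        1#                                        ∎

    -- The multiplicities a = k - c and b = c in the power sums are exactly those for which
    -- absorption yields a single binomial.
    weighted : ∀ a b i k m X Y → suc m ≡ n ℕ.+ b ℕ.* suc i → suc k ≡ (a ℕ.+ b) ℕ.* suc i → X ≡ suc m C suc k → Y ≡ m C suc k →
      ι (suc i) * (ι a * ι X + ι b * ι Y) ≈ ι n * ι (m C k)
    weighted a b i k m X Y m≡ k≡ X≡ Y≡ = begin
      ι (suc i) * (ι a * ι X + ι b * ι Y)          ≈⟨ *-congˡ (+-cong (ι-* a X) (ι-* b Y)) ⟨
      ι (suc i) * (ι (a ℕ.* X) + ι (b ℕ.* Y))      ≈⟨ *-congˡ (ι-+ (a ℕ.* X) (b ℕ.* Y)) ⟨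
      ι (suc i) * ι (a ℕ.* X ℕ.+ b ℕ.* Y)          ≈⟨ ι-* (suc i) (a ℕ.* X ℕ.+ b ℕ.* Y) ⟨
      ι (suc i ℕ.* (a ℕ.* X ℕ.+ b ℕ.* Y))
        ≡⟨ ≡.cong ι (≡.trans (≡.cong₂ (λ X Y → suc i ℕ.* (a ℕ.* X ℕ.+ b ℕ.* Y)) X≡ Y≡) (weighted-absorption a b (suc i) n k m m≡ k≡)) ⟩
      ι (n ℕ.* (m C k))                            ≈⟨ ι-* n (m C k) ⟩
      ι n * ι (m C k)                              ∎


    coefficient₁ : ∀ i → elementary (weight 1) N i ≈ ρ N * ι (n C (i ℕ.+ 1))
    coefficient₁ i = begin
      e                            ≈⟨ *-identityˡ e ⟨
      1# * e                       ≈⟨ *-congʳ (ρ-inverse N) ⟨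
      ι n * ρ N * e                ≈⟨ solve 3 (λ n r e → n :* r :* e := r :* (n :* e)) refl (ι n) (ρ N) e ⟩
      ρ N * (ι n * e)              ≈⟨ *-congˡ (n-coefficient₁ i) ⟩
      ρ N * ι (n C suc i)          ≡⟨ ≡.cong (λ k → ρ N * ι (n C k)) (ℕₚ.+-comm 1 i) ⟩
      ρ N * ι (n C (i ℕ.+ 1))      ∎
      where
      e : Carrier
      e = elementary (weight 1) N i

    coefficient₂ : ∀ i → elementary (λ m → - weight 2 m) N i ≈ ρ N * (ρ i * ι ((n ℕ.+ i) C (2 ℕ.* i ℕ.+ 1)))
    coefficient₂ i = begin
      e
        ≈⟨ solve 1 (λ e → e := 𝟙 :* 𝟙 :* 𝟙 :* e) refl e ⟩
      1# * 1# * 1# * e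
        ≈⟨ *-congʳ (*-cong (*-cong (ρ-inverse N) (ρ-inverse N)) (ρ-inverse i)) ⟨
      (ι n * ρ N) * (ι n * ρ N) * (ι (suc i) * ρ i) * e
        ≈⟨ solve 5 (λ n r s σ e → (n :* r) :* (n :* r) :* (s :* σ) :* e := r :* r :* σ :* (s :* (n :* n :* e)))
             refl (ι n) (ρ N) (ι (suc i)) (ρ i) e ⟩
      ρ N * ρ N * ρ i * (ι (suc i) * (ι n * ι n * e))
        ≈⟨ *-congˡ (*-congˡ (trans (n-coefficient₂ i) (solve 2 (λ x y → x :+ y := ⓘ 1 :* x :+ ⓘ 1 :* y) refl _ _))) ⟩
      ρ N * ρ N * ρ i * (ι (suc i) * (ι 1 * binomials 1 2 (1 ℕ.+ n) (suc i) + ι 1 * binomials 1 2 n (suc i)))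
        ≈⟨ *-congˡ (weighted 1 1 i k m _ _ m≡ k≡
             (≡.cong₂ _C_ (≡.sym m≡) (≡.sym k≡)) (≡.cong₂ (λ a b → (a ∸ 1) C b) (≡.sym m≡) (≡.sym k≡))) ⟩
      ρ N * ρ N * ρ i * (ι n * ι (m C k))
        ≈⟨ solve 4 (λ n r σ c → r :* r :* σ :* (n :* c) := (n :* r) :* (r :* (σ :* c))) refl (ι n) (ρ N) (ρ i) (ι (m C k)) ⟩
      -- The n gained by absorption cancels one of the two factors 1/n.
      (ι n * ρ N) * (ρ N * (ρ i * ι (m C k)))
        ≈⟨ trans (*-congʳ (ρ-inverse N)) (*-identityˡ _) ⟩
      ρ N * (ρ i * ι (m C k)) ∎
      where
      e : Carrier
      e = elementary (λ m → - weight 2 m) N i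

      m = n ℕ.+ i
      k = 2 ℕ.* i ℕ.+ 1

      m≡ : suc m ≡ n ℕ.+ 1 ℕ.* suc i
      m≡ = solveℕ 2 (λ n i → numeral 1 ⊕ (n ⊕ i) ⊜ n ⊕ numeral 1 ⊗ (numeral 1 ⊕ i)) ≡.refl n i

      k≡ : suc k ≡ 2 ℕ.* suc i
      k≡ = solveℕ 1 (λ i → numeral 1 ⊕ (numeral 2 ⊗ i ⊕ numeral 1) ⊜ numeral 2 ⊗ (numeral 1 ⊕ i)) ≡.refl i

    coefficient₃ : ∀ i → elementary (λ m → - weight 3 m) N i ≈
      ρ N * ρ N * (ρ i * (ι ((n ℕ.+ i) C (3 ℕ.* i ℕ.+ 2)) + (- 1#) ^ i * ι ((n ℕ.+ 2 ℕ.* i ℕ.+ 1) C (3 ℕ.* i ℕ.+ 2))))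
    coefficient₃ i = begin
      e
        ≈⟨ solve 1 (λ e → e := 𝟙 :* 𝟙 :* 𝟙 :* 𝟙 :* e) refl e ⟩
      1# * 1# * 1# * 1# * e
        ≈⟨ *-congʳ (*-cong (*-cong (*-cong (ρ-inverse N) (ρ-inverse N)) (ρ-inverse N)) (ρ-inverse i)) ⟨
      (ι n * ρ N) * (ι n * ρ N) * (ι n * ρ N) * (ι (suc i) * ρ i) * e
        ≈⟨ solve 5 (λ n r s σ e → (n :* r) :* (n :* r) :* (n :* r) :* (s :* σ) :* e := r :* r :* r :* σ :* (s :* (n :* n :* n :* e)))
             refl (ι n) (ρ N) (ι (suc i)) (ρ i) e ⟩
      ρ N * ρ N * ρ N * ρ i * (ι (suc i) * (ι n * ι n * ι n * e))
        ≈⟨ *-congˡ (*-congˡ (n-coefficient₃ i)) ⟩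
      ρ N * ρ N * ρ N * ρ i * (ι (suc i) * ((ι 2 * X₁ + Y₁) + s * (X₂ + ι 2 * Y₂)))
        ≈⟨ *-congˡ (solve 6 (λ j s x₁ y₁ x₂ y₂ → j :* ((𝟚 :* x₁ :+ y₁) :+ s :* (x₂ :+ 𝟚 :* y₂)) :=
             j :* (𝟚 :* x₁ :+ ⓘ 1 :* y₁) :+ s :* (j :* (ⓘ 1 :* x₂ :+ 𝟚 :* y₂))) refl (ι (suc i)) s X₁ Y₁ X₂ Y₂) ⟩
      ρ N * ρ N * ρ N * ρ i * (ι (suc i) * (ι 2 * X₁ + ι 1 * Y₁) + s * (ι (suc i) * (ι 1 * X₂ + ι 2 * Y₂)))
        ≈⟨ *-congˡ (+-cong
             (weighted 2 1 i k m _ _ m≡ k≡ (≡.cong₂ _C_ (≡.sym m≡) (≡.sym k≡)) (≡.cong₂ (λ a b → (a ∸ 1) C b) (≡.sym m≡) (≡.sym k≡)))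
             (*-congˡ (weighted 1 2 i k m′ _ _ m′≡ k≡ (≡.cong₂ _C_ (≡.sym m′≡) (≡.sym k≡)) (≡.cong₂ (λ a b → (a ∸ 1) C b) (≡.sym m′≡) (≡.sym k≡))))) ⟩
      ρ N * ρ N * ρ N * ρ i * (ι n * ι (m C k) + s * (ι n * ι (m′ C k)))
        ≈⟨ solve 6 (λ n r σ s c c′ → r :* r :* r :* σ :* (n :* c :+ s :* (n :* c′)) := (n :* r) :* (r :* r :* (σ :* (c :+ s :* c′))))
             refl (ι n) (ρ N) (ρ i) s (ι (m C k)) (ι (m′ C k)) ⟩
      (ι n * ρ N) * (ρ N * ρ N * (ρ i * (ι (m C k) + s * ι (m′ C k))))
        ≈⟨ trans (*-congʳ (ρ-inverse N)) (*-identityˡ _) ⟩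
      ρ N * ρ N * (ρ i * (ι (m C k) + s * ι (m′ C k))) ∎
      where
      e s X₁ Y₁ X₂ Y₂ : Carrier
      e = elementary (λ m → - weight 3 m) N i
      s = (- 1#) ^ i
      X₁ = binomials 1 3 (1 ℕ.+ n) (suc i)
      Y₁ = binomials 1 3 n (suc i)
      X₂ = binomials 2 3 (1 ℕ.+ n) (suc i)
      Y₂ = binomials 2 3 n (suc i)

      m = n ℕ.+ i
      m′ = n ℕ.+ 2 ℕ.* i ℕ.+ 1
      k = 3 ℕ.* i ℕ.+ 2

      m≡ : suc m ≡ n ℕ.+ 1 ℕ.* suc i
      m≡ = solveℕ 2 (λ n i → numeral 1 ⊕ (n ⊕ i) ⊜ n ⊕ numeral 1 ⊗ (numeral 1 ⊕ i)) ≡.refl n i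

      m′≡ : suc m′ ≡ n ℕ.+ 2 ℕ.* suc i
      m′≡ = solveℕ 2 (λ n i → numeral 1 ⊕ (n ⊕ numeral 2 ⊗ i ⊕ numeral 1) ⊜ n ⊕ numeral 2 ⊗ (numeral 1 ⊕ i)) ≡.refl n i

      k≡ : suc k ≡ 3 ℕ.* suc i
      k≡ = solveℕ 1 (λ i → numeral 1 ⊕ (numeral 3 ⊗ i ⊕ numeral 2) ⊜ numeral 3 ⊗ (numeral 1 ⊕ i)) ≡.refl i

-- Inverses in the Heyting field and the passage to nested sums.

module HeytingFieldRoots {c ℓ₁ ℓ₂} (K : HeytingField c ℓ₁ ℓ₂) where
  open FieldDefs K using (ring; inverse; PowersApartFrom1; restrict; z̄; 1/; CharZero)
  open HeytingField K using (_#_; #⇒invertible; #-sym)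
  open CommutativeRing ring hiding (zero; ring)
  open import Algebra.Properties.Monoid.Sum +-monoid using (sum-cong-≋)
  open import Algebra.Properties.Semiring.Exp semiring using (_^_; ^-congˡ; ^-homo-*)
  open IntegerCoefficientSolver ring
  open Polynomial ring
  open BinomialRecurrence ring using (ι)
  open NestedSum ring
  open ≈-Reasoning setoid

  inverseʳ : ∀ {x y} (x#y : x # y) → (x - y) * inverse x#y ≈ 1#
  inverseʳ x#y = proj₂ (proj₂ (#⇒invertible x#y))

  reciprocal : CharZero → ℕ → Carrier
  reciprocal char0 m = 1/ char0 (suc m)

  reciprocal-inverse : ∀ char0 m → ι (suc m) * reciprocal char0 m ≈ 1#
  reciprocal-inverse char0 m = trans
    (*-congʳ (solve 1 (λ x → x := x :- con (+ 0)) refl (ι (suc m)))) (inverseʳ (char0 (suc m)))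

  module _ {N : ℕ} {q : Carrier} (apart : PowersApartFrom1 (suc N) q) where
    -- Made total so that the weights form a plain function on ℕ; `0#` only fills in from `N` on,
    -- where no apartness is given.
    u : ℕ → Carrier
    u m with m ℕₚ.<? N
    ... | yes m<N = inverse (#-sym (apart {suc m} (ℕ.s≤s ℕ.z≤n) (ℕ.s≤s m<N)))
    ... | no _    = 0#

    u-inverse : ∀ m → m ℕ.< N → (1# - q ^ suc m) * u m ≈ 1#
    u-inverse m m<N with m ℕₚ.<? N
    ... | yes p   = inverseʳ (#-sym (apart {suc m} (ℕ.s≤s ℕ.z≤n) (ℕ.s≤s p)))
    ... | no m≮N  = contradiction m<N m≮N

    -- An inverse is computed from its proof of apartness, and the proofs met inside `z̄` have
    -- passed through `restrict`. Uniqueness of inverses makes the choice immaterial.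
    inverse≈u : ∀ {m} (x#y : 1# # q ^ suc m) → m ℕ.< N → inverse x#y ≈ u m
    inverse≈u {m} x#y m<N = regular-cancel (unit⇒regular (inverseʳ x#y)) (trans (inverseʳ x#y) (sym (u-inverse m m<N)))

    z̄≈nested : ∀ M (h : PowersApartFrom1 (suc M) q) ks → M ℕ.≤ N → z̄ (suc M) q h ks ≈ nested (entryWeight q u) M ks
    z̄≈nested M h []       M≤N = refl
    z̄≈nested M h (k ∷ ks) M≤N = trans
      (sum-cong-≋ {M} λ i → *-cong
        (*-congˡ (^-congˡ k (inverse≈u (#-sym (h (ℕ.s≤s ℕ.z≤n) (ℕ.s≤s (toℕ<n i)))) (ℕₚ.<-≤-trans (toℕ<n i) M≤N))))
        (z̄≈nested (toℕ i) (restrict (ℕ.s≤s (toℕ<n i)) h) ks (ℕₚ.≤-trans (ℕₚ.<⇒≤ (toℕ<n i)) M≤N)))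
      (sum-nested (entryWeight q u) M k ks)

  -- (1 - z) U = 1 says z U + 1 = U, so raising both exponents by one and adding the unraised term
  -- amounts to one more factor U.
  entryWeight-merge : ∀ q u m → (1# - q ^ suc m) * u m ≈ 1# → ∀ i j → let g = λ k → entryWeight q u k m in
    g (suc i ℕ.+ suc j) + g (suc i ℕ.+ suc j ∸ 1) ≈ g (suc i) * g (suc j)
  entryWeight-merge q u m inv i j = begin
    q ^ ((i ℕ.+ suc j) ℕ.* suc m) * U ^ (suc i ℕ.+ suc j) + q ^ ((i ℕ.+ suc j ∸ 1) ℕ.* suc m) * U ^ (i ℕ.+ suc j)
      ≡⟨ ≡.cong (λ k → q ^ (k ℕ.* suc m) * U ^ suc k + q ^ ((k ∸ 1) ℕ.* suc m) * U ^ k) (ℕₚ.+-suc i j) ⟩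
    q ^ (suc m ℕ.+ (i ℕ.+ j) ℕ.* suc m) * (U * (U * U ^ (i ℕ.+ j))) + q ^ ((i ℕ.+ j) ℕ.* suc m) * (U * U ^ (i ℕ.+ j))
      ≈⟨ +-congʳ (*-congʳ (^-homo-* q (suc m) ((i ℕ.+ j) ℕ.* suc m))) ⟩
    z * Q * (U * (U * V)) + Q * (U * V)
      ≈⟨ solve 4 (λ z Q U V → z :* Q :* (U :* (U :* V)) :+ Q :* (U :* V) :=
           Q :* (U :* (U :* V)) :+ Q :* (U :* V) :* (con (+ 1) :- (con (+ 1) :- z) :* U)) refl z Q U V ⟩
    Q * (U * (U * V)) + Q * (U * V) * (1# - (1# - z) * U)
      ≈⟨ +-congˡ (*-congˡ (+-congˡ (-‿cong inv))) ⟩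
    Q * (U * (U * V)) + Q * (U * V) * (1# - 1#)
      ≈⟨ solve 3 (λ Q U V → Q :* (U :* (U :* V)) :+ Q :* (U :* V) :* (con (+ 1) :- con (+ 1)) := Q :* (U :* (U :* V))) refl Q U V ⟩
    Q * (U * (U * V))
      ≈⟨ *-cong (trans (reflexive (≡.cong (q ^_) (ℕₚ.*-distribʳ-+ (suc m) i j))) (^-homo-* q (i ℕ.* suc m) (j ℕ.* suc m)))
                (*-congˡ (*-congˡ (^-homo-* U i j))) ⟩
    q ^ (i ℕ.* suc m) * q ^ (j ℕ.* suc m) * (U * (U * (U ^ i * U ^ j)))
      ≈⟨ solve 5 (λ a b U c d → a :* b :* (U :* (U :* (c :* d))) := (a :* (U :* c)) :* (b :* (U :* d)))
           refl (q ^ (i ℕ.* suc m)) (q ^ (j ℕ.* suc m)) U (U ^ i) (U ^ j) ⟩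
    q ^ (i ℕ.* suc m) * (U * U ^ i) * (q ^ (j ℕ.* suc m) * (U * U ^ j)) ∎
    where
    z U V Q : Carrier
    z = q ^ suc m
    U = u m
    V = U ^ (i ℕ.+ j)
    Q = q ^ ((i ℕ.+ j) ℕ.* suc m)

-- The interpolated generating series in the algebra.

module InterpolatedSeries {c ℓ₁ ℓ₂ a ℓ} (K : HeytingField c ℓ₁ ℓ₂) (A : CommutativeRing a ℓ)
  (φ : HeytingField.Carrier K → CommutativeRing.Carrier A)
  (φ-homo : IsRingHomomorphism (CommutativeRing.rawRing (FieldDefs.ring K)) (CommutativeRing.rawRing A) φ) where
  private
    module K = CommutativeRing (FieldDefs.ring K)
    module Kˢ = PowerSeries (FieldDefs.ring K)
    module Kᵖ = Polynomial (FieldDefs.ring K)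
    module Kᴺ = NestedSum (FieldDefs.ring K)
    module Kᶠ = HeytingFieldRoots K
  open AlgebraDefs K A φ using (z̄ᵗ; expansion)
  open FieldDefs K using (PowersApartFrom1; -1^_) renaming (_^_ to _^ᴷ_)
  open CommutativeRing A hiding (zero)
  open import Algebra.Properties.Monoid.Sum +-monoid using (sum-cong-≋)
  open import Algebra.Properties.Semiring.Exp semiring using (_^_; ^-congˡ; ^-homo-*)
  open IntegerCoefficientSolver A
  open PowerSeries A
  open ListSum A
  open IsRingHomomorphism φ-homo using (⟦⟧-cong; +-homo; *-homo; -‿homo; 0#-homo; 1#-homo)
  open ≈-Reasoning setoid

  φ-^ : ∀ x m → φ (x ^ᴷ m) ≈ φ x ^ m
  φ-^ x zero    = 1#-homo
  φ-^ x (suc m) = trans (*-homo x (x ^ᴷ m)) (*-congˡ (φ-^ x m))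

  φ-sign : ∀ m → φ (-1^ m) ≈ (- 1#) ^ m
  φ-sign m = trans (φ-^ (K.- K.1#) m) (^-congˡ m (trans (-‿homo K.1#) (-‿cong 1#-homo)))

  -- The series e(v x) over `A`. A single polynomial over `K` thus serves as numerator and as
  -- denominator, for two values of v.
  image : Carrier → (ℕ → K.Carrier) → Series
  image v e = rescale v (λ i → φ (e i))

  image-δ : ∀ v → image v Kˢ.δ ≋ δ
  image-δ v zero    = trans (*-identityʳ _) 1#-homo
  image-δ v (suc i) = trans (*-congʳ 0#-homo) (zeroˡ _)

  image-linear : ∀ v b e → image v (Kˢ.linear b e) ≋ linear (φ b * v) (image v e)
  image-linear v b e i = trans
    (*-congʳ (trans (+-homo (e i) _) (+-congˡ (trans (*-homo b _) (*-congˡ (φ-shift i))))))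
    (rescale-linear v (φ b) (λ j → φ (e j)) i)
    where
    φ-shift : ∀ i → φ (Kˢ.shift e i) ≈ shift (λ j → φ (e j)) i
    φ-shift zero    = 0#-homo
    φ-shift (suc i) = refl

  -- Each of the m + 1 binomial factors brings one constant d, which together form the power of 1/n
  -- in front. As l - i₀ = i₁ + ⋯ + i_m, the power of v is spread over the remaining factors.
  expansion-term : ∀ n l m r (e : ℕ → ℕ) (b E : ℕ → K.Carrier) d v w →
    (∀ i → E i K.≈ d K.* b i) → r ^ᴷ e m K.≈ d ^ᴷ suc m → (∀ i → n ℕ.≤ i → E i K.≈ K.0#) →
    φ ((-1^ m) K.* (r ^ᴷ e m)) * sumOver (indices n l m)
      (λ (i₀ , is) → φ (b i₀ K.* Vec.foldr′ (λ i x → b i K.* x) K.1# is) * (w ^ i₀ * v ^ (l ∸ i₀)))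
    ≈ (- 1#) ^ m * (image w E ⊛ dropConstant (image v E) ⊛^ m) l
  expansion-term n l m r e b E d v w E≈ r≈ E≈0 = begin
    φ ((-1^ m) K.* (r ^ᴷ e m)) * S
      ≈⟨ *-congʳ (trans (*-homo _ _) (*-cong (φ-sign m) (⟦⟧-cong r≈))) ⟩
    (- 1#) ^ m * φ (d ^ᴷ suc m) * S
      ≈⟨ *-assoc _ _ _ ⟩
    (- 1#) ^ m * (φ (d ^ᴷ suc m) * S)
      ≈⟨ *-congˡ (*-distribˡ-sumOver _ (indices n l m) _) ⟩
    (- 1#) ^ m * sumOver (indices n l m) (λ (i₀ , is) →
      φ (d ^ᴷ suc m) * (φ (b i₀ K.* ∏b is) * (w ^ i₀ * v ^ (l ∸ i₀))))
      ≈⟨ *-congˡ (sumOver-cong-All (Allₚ.all-filter (λ (i₀ , is) → i₀ ℕ.+ Vec.sum is ≟ l) (cartesianProduct (upTo n) (vectors (map suc (upTo (n ∸ 1))) m))) (λ { {i₀ , is} eq → summand i₀ is eq })) ⟩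
    (- 1#) ^ m * sumOver (indices n l m) (λ (i₀ , is) → image w E i₀ * product (image v E) is)
      ≈⟨ *-congˡ (sumOver-indices n l m (image w E) (image v E) (image-zero w) (image-zero v)) ⟩
    (- 1#) ^ m * (image w E ⊛ dropConstant (image v E) ⊛^ m) l ∎
    where
    ∏b : ∀ {m} → Vec ℕ m → K.Carrier
    ∏b = Vec.foldr′ (λ i x → b i K.* x) K.1#

    S : Carrier
    S = sumOver (indices n l m) (λ (i₀ , is) → φ (b i₀ K.* ∏b is) * (w ^ i₀ * v ^ (l ∸ i₀)))

    image-zero : ∀ v i → n ℕ.≤ i → image v E i ≈ 0#
    image-zero v i n≤i = trans (*-congʳ (trans (⟦⟧-cong (E≈0 i n≤i)) 0#-homo)) (zeroˡ _)

    φE : ∀ i → φ (E i) ≈ φ d * φ (b i)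
    φE i = trans (⟦⟧-cong (E≈ i)) (*-homo d (b i))

    product-image : ∀ {m} (is : Vec ℕ m) → product (image v E) is ≈ φ (d ^ᴷ m) * φ (∏b is) * v ^ Vec.sum is
    product-image []                = sym (trans (*-identityʳ _) (trans (*-cong 1#-homo 1#-homo) (*-identityˡ 1#)))
    product-image (_∷_ {n = m} i is) = begin
      φ (E i) * v ^ i * product (image v E) is
        ≈⟨ *-cong (*-congʳ (φE i)) (product-image is) ⟩
      φ d * φ (b i) * v ^ i * (φ (d ^ᴷ m) * φ (∏b is) * v ^ Vec.sum is)
        ≈⟨ solve 6 (λ d b x D B X → d :* b :* x :* (D :* B :* X) := (d :* D) :* (b :* B) :* (x :* X))
             refl (φ d) (φ (b i)) (v ^ i) (φ (d ^ᴷ m)) (φ (∏b is)) (v ^ Vec.sum is) ⟩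
      (φ d * φ (d ^ᴷ m)) * (φ (b i) * φ (∏b is)) * (v ^ i * v ^ Vec.sum is)
        ≈⟨ *-cong (*-cong (*-homo _ _) (*-homo _ _)) (^-homo-* v i (Vec.sum is)) ⟨
      φ (d ^ᴷ suc m) * φ (∏b (i ∷ is)) * v ^ Vec.sum (i ∷ is) ∎

    summand : ∀ i₀ (is : Vec ℕ m) → i₀ ℕ.+ Vec.sum is ≡ l →
      φ (d ^ᴷ suc m) * (φ (b i₀ K.* ∏b is) * (w ^ i₀ * v ^ (l ∸ i₀))) ≈ image w E i₀ * product (image v E) is
    summand i₀ is ≡.refl = begin
      φ (d ^ᴷ suc m) * (φ (b i₀ K.* ∏b is) * (w ^ i₀ * v ^ (i₀ ℕ.+ Vec.sum is ∸ i₀)))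
        ≈⟨ *-cong (*-homo _ _) (*-cong (*-homo _ _) (*-congˡ (reflexive (≡.cong (v ^_) (ℕₚ.m+n∸m≡n i₀ (Vec.sum is)))))) ⟩
      (φ d * φ (d ^ᴷ m)) * ((φ (b i₀) * φ (∏b is)) * (w ^ i₀ * v ^ Vec.sum is))
        ≈⟨ solve 6 (λ d D b B x X → (d :* D) :* ((b :* B) :* (x :* X)) := (d :* b) :* x :* (D :* B :* X))
             refl (φ d) (φ (d ^ᴷ m)) (φ (b i₀)) (φ (∏b is)) (w ^ i₀) (v ^ Vec.sum is) ⟩
      φ d * φ (b i₀) * w ^ i₀ * (φ (d ^ᴷ m) * φ (∏b is) * v ^ Vec.sum is)
        ≈⟨ *-cong (*-congʳ (φE i₀)) (product-image is) ⟨
      image w E i₀ * product (image v E) is ∎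

  module _ {N : ℕ} {q : K.Carrier} (apart : PowersApartFrom1 (suc N) q) (t : Carrier) (k : ℕ) where
    open FillingSum A t

    weights : ℕ → ℕ → K.Carrier
    weights = Kᴺ.entryWeight q (Kᶠ.u apart)

    interpolated : ℕ → Series
    interpolated M l = fillingSum (λ p → φ (Kᴺ.nested weights M p)) (replicate l (suc k))

    -- Fillings of a nonempty multi-index are never empty. This starts the induction on the bound:
    -- with no index available only the empty multi-index contributes.
    fillingSum-zero : ∀ Φ j ks → (∀ i p → Φ (i ∷ p) ≈ 0#) → fillingSum Φ (j ∷ ks) ≈ 0#
    fillingSum-zero Φ j []       eq = trans (+-identityʳ _) (trans (*-congʳ (eq j [])) (zeroˡ _))
    fillingSum-zero Φ j (i ∷ ks) eq = begin
      fillingSum Φ (j ∷ i ∷ ks)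
        ≈⟨ fillingSum-∷ Φ j i ks ⟩
      fillingSum (λ p → Φ (j ∷ p)) (i ∷ ks) + t * (fillingSum Φ (j ℕ.+ i ∷ ks) + fillingSum Φ (j ℕ.+ i ∸ 1 ∷ ks))
        ≈⟨ +-cong (fillingSum-zero (λ p → Φ (j ∷ p)) i ks (λ m p → eq j (m ∷ p)))
             (*-congˡ (+-cong (fillingSum-zero Φ (j ℕ.+ i) ks eq) (fillingSum-zero Φ (j ℕ.+ i ∸ 1) ks eq))) ⟩
      0# + t * (0# + 0#)
        ≈⟨ solve 1 (λ t → con (+ 0) :+ t :* (con (+ 0) :+ con (+ 0)) := con (+ 0)) refl t ⟩
      0# ∎

    interpolated-0 : interpolated 0 ≋ δ
    interpolated-0 zero    = trans (+-identityʳ _) (trans (*-identityʳ _) 1#-homo)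
    interpolated-0 (suc l) = fillingSum-zero _ (suc k) (replicate l (suc k)) (λ _ _ → 0#-homo)

    interpolated-suc : ∀ M → M ℕ.< N → let b = φ (weights (suc k) M) in
      linear (- (t * b)) (interpolated (suc M)) ≋ linear ((1# - t) * b) (interpolated M)
    interpolated-suc M M<N = linear-fillingSum
      (λ { []      → sym (+-identityʳ _)
         ; (j ∷ p) → trans (+-homo _ _) (+-congˡ (*-homo _ _)) })
      1#-homo k
      where
      open Merging (λ j → φ (weights j M))
        (λ i j → trans (sym (+-homo _ _)) (trans
          (⟦⟧-cong (Kᶠ.entryWeight-merge q (Kᶠ.u apart) M (Kᶠ.u-inverse apart M M<N) i j)) (*-homo _ _)))
        (λ p → φ (Kᴺ.nested weights M p))

    -- ∑ z̄ᵗ({k}^l) x^l = ∏ (1 + (1 - t) a x) / (1 - t a x) over the weights a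
    interpolated-product : ∀ f v w →
      (∀ m → φ (f m) * v ≈ - (t * φ (weights (suc k) m))) → (∀ m → φ (f m) * w ≈ (1# - t) * φ (weights (suc k) m)) →
      ∀ M → M ℕ.≤ N → image v (Kᵖ.elementary f M) ⊛ interpolated M ≋ image w (Kᵖ.elementary f M)
    interpolated-product f v w f*v f*w zero _ i = begin
      (image v Kˢ.δ ⊛ interpolated 0) i   ≈⟨ ⊛-congʳ _ (image-δ v) i ⟩
      (δ ⊛ interpolated 0) i              ≈⟨ ⊛-identityˡ _ i ⟩
      interpolated 0 i                    ≈⟨ interpolated-0 i ⟩
      δ i                                 ≈⟨ image-δ w i ⟨
      image w Kˢ.δ i                      ∎
    interpolated-product f v w f*v f*w (suc M) M<N i = begin
      (image v (Kˢ.linear (f M) e) ⊛ interpolated (suc M)) i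
        ≈⟨ ⊛-congʳ _ (λ j → trans (image-linear v (f M) e j) (linear-cong (f*v M) (λ _ → refl) j)) i ⟩
      (linear (- (t * b)) (image v e) ⊛ interpolated (suc M)) i
        -- The new linear factor is moved from the denominator onto the series, where
        -- `interpolated-suc` exchanges it for the numerator factor.
        ≈⟨ trans (linear-⊛ˡ _ _ _ i) (sym (linear-⊛ʳ _ _ _ i)) ⟩
      (image v e ⊛ linear (- (t * b)) (interpolated (suc M))) i
        ≈⟨ ⊛-congˡ _ (interpolated-suc M M<N) i ⟩
      (image v e ⊛ linear ((1# - t) * b) (interpolated M)) i
        ≈⟨ linear-⊛ʳ _ _ _ i ⟩
      linear ((1# - t) * b) (image v e ⊛ interpolated M) i
        ≈⟨ linear-cong (sym (f*w M)) (interpolated-product f v w f*v f*w M (ℕₚ.<⇒≤ M<N)) i ⟩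
      linear (φ (f M) * w) (image w e) i
        ≈⟨ image-linear w (f M) e i ⟨
      image w (Kˢ.linear (f M) e) i ∎
      where
      e : Kˢ.Series
      e = Kᵖ.elementary f M

      b : Carrier
      b = φ (weights (suc k) M)

    z̄ᵗ≈interpolated : ∀ l → z̄ᵗ (suc N) q apart t (replicate l (suc k)) ≈ interpolated N l
    z̄ᵗ≈interpolated l = fillingSum-cong (replicate l (suc k)) λ p → ⟦⟧-cong (Kᶠ.z̄≈nested apart N apart p ℕₚ.≤-refl)

    z̄ᵗ-expansion : ∀ f v w r (e : ℕ → ℕ) (b : ℕ → K.Carrier) d →
      (∀ m → φ (f m) * v ≈ - (t * φ (weights (suc k) m))) → (∀ m → φ (f m) * w ≈ (1# - t) * φ (weights (suc k) m)) →
      (∀ m → r ^ᴷ e m K.≈ d ^ᴷ suc m) → (∀ i → Kᵖ.elementary f N i K.≈ d K.* b i) →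
      ∀ l → z̄ᵗ (suc N) q apart t (replicate l (suc k)) ≈ expansion (suc N) l r e b w v
    z̄ᵗ-expansion f v w r e b d f*v f*w r≈ E≈ l = begin
      z̄ᵗ (suc N) q apart t (replicate l (suc k))
        ≈⟨ z̄ᵗ≈interpolated l ⟩
      interpolated N l
        ≈⟨ quotient-expansion (image w E) (image v E) (interpolated N)
             (trans (*-identityʳ _) (trans (⟦⟧-cong (Kᵖ.elementary-0 f N)) 1#-homo))
             (interpolated-product f v w f*v f*w N ℕₚ.≤-refl) l ⟩
      _
        ≈⟨ sum-cong-≋ {suc l} (λ j → expansion-term (suc N) l (toℕ j) r e b E d v w E≈ (r≈ (toℕ j)) (λ i N<i → Kᵖ.elementary-degree f N i N<i)) ⟨
      expansion (suc N) l r e b w v ∎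
      where
      E : Kˢ.Series
      E = Kᵖ.elementary f N

-- Evaluation at the repeated entries 1, 2 and 3.

open import Data.Nat.Base using (ℕ; suc; _+_; _*_; NonZero)

corollary1p5 :
  ∀ {c ℓ₁ ℓ₂ a ℓ} (K : HeytingField c ℓ₁ ℓ₂) (A : CommutativeRing a ℓ)
    (φ : HeytingField.Carrier K → CommutativeRing.Carrier A) →
    let module K = HeytingField K
        module A = CommutativeRing A
        open FieldDefs K
        open AlgebraDefs K A φ
    in
    IsRingHomomorphism (CommutativeRing.rawRing ring) A.rawRing φ →
    (char0 : CharZero) (n : ℕ) .{{_ : NonZero n}} (ζ : K.Carrier)
    (ζ-prim : IsPrimitiveRoot n ζ) (t : A.Carrier) (l : ℕ) →
    let z̄ᵗ[_] = λ k → z̄ᵗ n ζ (IsPrimitiveRoot.apart ζ-prim) t (replicate l k)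
        1/n   = 1/ char0 n
    in
    (z̄ᵗ[ 1 ] A.≈
      expansion n l 1/n (λ m → m + 1)
        (λ i → ι (n C (i + 1)))
        (A.1# A.- t) (A.- t))
    ×
    (z̄ᵗ[ 2 ] A.≈
      expansion n l 1/n (λ m → m + 1)
        (λ i → 1/ char0 (suc i) K.* ι ((n + i) C (2 * i + 1)))
        (t A.- A.1#) t)
    ×
    (z̄ᵗ[ 3 ] A.≈
      expansion n l 1/n (λ m → 2 * m + 2)
        (λ i → 1/ char0 (suc i) K.*
          (ι ((n + i) C (3 * i + 2)) K.+ (-1^ i) K.* ι ((n + 2 * i + 1) C (3 * i + 2))))
        (t A.- A.1#) t)
corollary1p5 K A φ φ-homo char0 n@(suc N) ζ ζ-prim t l =
    -- For entry 1, P = ∏ (1 + a_m x), so the denominator is P(- t x) and the numerator P((1 - t)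
    -- x).
    z̄ᵗ-expansion apart t 0 (weights apart t 0 1) (- t) (1# - t) 1/n (λ m → m + 1) _ 1/n
      (λ m → solve 2 (λ a t → a :* (:- t) := :- (t :* a)) refl (φ (weights apart t 0 1 m)) t)
      (λ m → *-comm _ _)
      (λ m → K.reflexive (≡.cong (1/n ^_) (ℕₚ.+-comm m 1)))
      (coefficient₁ ρ-inverse N ζ ζⁿ≈1 (u apart) (u-inverse apart)) l
  -- From here on P = ∏ (1 - a_m x); the sign passes into the arguments, which become t and t - 1.
  , z̄ᵗ-expansion apart t 1 (λ m → K.- weights apart t 1 2 m) t (t - 1#) 1/n (λ m → m + 1) _ 1/n
      (λ m → f*t (weights apart t 1 2 m)) (λ m → f*[t-1] (weights apart t 1 2 m))
      (λ m → K.reflexive (≡.cong (1/n ^_) (ℕₚ.+-comm m 1)))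
      (coefficient₂ ρ-inverse N ζ ζⁿ≈1 (u apart) (u-inverse apart)) l
  -- Each coefficient now carries 1/n², hence the exponent 2 m + 2 for m + 1 factors.
  , z̄ᵗ-expansion apart t 2 (λ m → K.- weights apart t 2 3 m) t (t - 1#) 1/n (λ m → 2 * m + 2) _ (1/n K.* 1/n)
      (λ m → f*t (weights apart t 2 3 m)) (λ m → f*[t-1] (weights apart t 2 3 m))
      1/n-power
      (coefficient₃ ρ-inverse N ζ ζⁿ≈1 (u apart) (u-inverse apart)) l
  where
  open FieldDefs K using (ring; 1/; _^_; module IsPrimitiveRoot)
  module K = CommutativeRing ring
  open CommutativeRing A hiding (zero; ring; _+_; _*_)
  open CommutativeRing A using () renaming (_*_ to _*ᴬ_)
  open import Algebra.Properties.Semiring.Exp K.semiring using (^-homo-*)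
  open import Algebra.Properties.CommutativeSemiring.Exp K.commutativeSemiring using (^-distrib-*)
  open IntegerCoefficientSolver A
  open HeytingFieldRoots K using (reciprocal; reciprocal-inverse; u; u-inverse)
  open ElementarySymmetric ring (reciprocal char0) using (coefficient₁; coefficient₂; coefficient₃)
  open InterpolatedSeries K A φ φ-homo
  open IsPrimitiveRoot ζ-prim
  open IsRingHomomorphism φ-homo using (-‿homo)
  module K-Reasoning = ≈-Reasoning K.setoid

  1/n : K.Carrier
  1/n = 1/ char0 n

  ρ-inverse : ∀ m → BinomialRecurrence.ι ring (suc m) K.* reciprocal char0 m K.≈ K.1#
  ρ-inverse = reciprocal-inverse char0

  1/n-power : ∀ m → 1/n ^ (2 * m + 2) K.≈ (1/n K.* 1/n) ^ suc m
  1/n-power m = begin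
    1/n ^ (2 * m + 2)                   ≡⟨ ≡.cong (1/n ^_) (solveℕ 1 (λ m → numeral 2 ⊗ m ⊕ numeral 2
                                             ⊜ (numeral 1 ⊕ m) ⊕ (numeral 1 ⊕ m)) ≡.refl m) ⟩
    1/n ^ (suc m + suc m)               ≈⟨ ^-homo-* 1/n (suc m) (suc m) ⟩
    1/n ^ suc m K.* 1/n ^ suc m         ≈⟨ ^-distrib-* 1/n 1/n (suc m) ⟨
    (1/n K.* 1/n) ^ suc m               ∎
    where open K-Reasoning

  f*t : ∀ a → φ (K.- a) *ᴬ t ≈ - (t *ᴬ φ a)
  f*t a = trans (*-congʳ (-‿homo a)) (solve 2 (λ a t → (:- a) :* t := :- (t :* a)) refl (φ a) t)

  f*[t-1] : ∀ a → φ (K.- a) *ᴬ (t - 1#) ≈ (1# - t) *ᴬ φ a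
  f*[t-1] a = trans (*-congʳ (-‿homo a)) (solve 2 (λ a t → (:- a) :* (t :- con (+ 1)) := (con (+ 1) :- t) :* a) refl (φ a) t)
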